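{- Let $H$ be a real symmetric matrix indexed by a finite set $V$, let $a,b\in V$ be distinct, and suppose that $\operatorname{supp}_H(e_a)\cup\operatorname{supp}_H(e_b)\subseteq c\mathbb Z$ for some real $c>0$. Let $k\in\mathcal K(H;a,b)$ and put $K=H/c$. Choose $\eta_0\in\operatorname{supp}_{K^k}(e_a)$ and define \[ \delta_k=\gcd\{|\eta-\eta_0|:\eta\in\operatorname{supp}_{K^k}(e_a)\setminus\{\eta_0\}\}. \] Then the integer $\delta_k$ is independent of the choice of $\eta_0$, and the minimum positive transfer time from $a$ to $b$ under $H^k$ is \[ \frac{\pi}{c^k\delta_k}. \]
   Context: $\mathbb N^+=\{1,2,3,\ldots\}$. For a finite set $V$, $e_v$ denotes the standard basis vector indexed by $v\in V$. For a real symmetric matrix $H$ indexed by $V$ with spectral decomposition $H=\sum_{\lambda\in\operatorname{Spec}(H)}\lambda E_\lambda$ ($E_\lambda$ the orthogonal projection onto the $\lambda$-eigenspace), and a vector $x$, put $\operatorname{supp}_H(x)=\{\lambda\in\operatorname{Spec}(H):E_\lambda x\neq 0\}$. A real symmetric matrix $M$ has perfect state transfer (PST) from $a$ to $b$ at time $\tau>0$ if $\exp(-\mathrm i\tau M)e_a=\gamma e_b$ for some $\gamma\in\mathbb C$ with $|\gamma|=1$; such a $\tau$ is called a transfer time under $M$. $M$ has PST from $a$ to $b$ if this holds for some $\tau>0$. $\mathcal K(H;a,b)=\{k\in\mathbb N^+: H^k\text{ has PST from }a\text{ to }b\}$. -}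

module Defs where

open import Level using (0ℓ)
open import Data.Nat.Base as ℕ using (ℕ; zero; suc; _!)
import Data.Nat.Divisibility as ℕ
open import Data.Integer.Base using (ℤ; +_; -[1+_])
open import Data.Fin.Base using (Fin; toℕ)
open import Data.Fin.Properties using (_≟_)
open import Data.Product using (∃; _×_)
open import Data.Sum.Base using (_⊎_)
open import Data.Bool.Base using (if_then_else_)
open import Data.Vec.Functional using (Vector)
open import Relation.Nullary using (¬_)
open import Relation.Nullary.Decidable using (⌊_⌋)
open import Relation.Binary.Core using (Rel)
open import Relation.Binary.Definitions using (tri<; tri≈; tri>)
open import Relation.Binary.Structures using (IsStrictTotalOrder)
open import Algebra.Core using (Op₁; Op₂)
open import Algebra.Structures using (IsCommutativeRing)
open import Algebra.Bundles using (RawRing)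
import Algebra.Definitions.RawSemiring as RawSemiringDefs

-- The axioms characterising the field of real numbers up to isomorphism.
-- Equality is a setoid equality so that, with excluded middle, Cauchy
-- sequences of rationals are a model.  The value of 0# ⁻¹ is unspecified.
record CompleteOrderedField : Set₁ where
  infix  9 _⁻¹
  infix  8 -_
  infixl 7 _*_ _/_
  infixl 6 _+_ _-_
  infix  4 _≈_ _<_ _≤_
  field
    Carrier : Set
    _≈_ _<_ : Rel Carrier 0ℓ
    _+_ _*_ : Op₂ Carrier
    -_ _⁻¹  : Op₁ Carrier
    0# 1#   : Carrier
    isCommutativeRing  : IsCommutativeRing _≈_ _+_ _*_ -_ 0# 1#
    isStrictTotalOrder : IsStrictTotalOrder _≈_ _<_
    0<1         : 0# < 1#
    +-monoˡ-<   : ∀ {x y} z → x < y → (x + z) < (y + z)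
    *-pos       : ∀ {x y} → 0# < x → 0# < y → 0# < (x * y)
    *-inverseʳ  : ∀ {x} → ¬ (x ≈ 0#) → (x * (x ⁻¹)) ≈ 1#

  _≤_ : Rel Carrier 0ℓ
  x ≤ y = x < y ⊎ x ≈ y

  UpperBound : (Carrier → Set) → Carrier → Set
  UpperBound P u = ∀ x → P x → x ≤ u

  field
    complete : (P : Carrier → Set) → ∃ P → ∃ (UpperBound P) →
               ∃ λ s → UpperBound P s × (∀ u → UpperBound P u → s ≤ u)

  open IsStrictTotalOrder isStrictTotalOrder public using (compare)

  _-_ _/_ : Op₂ Carrier
  x - y = x + (- y)
  x / y = x * y ⁻¹

  rawRing : RawRing 0ℓ 0ℓ
  rawRing = record
    { Carrier = Carrier ; _≈_ = _≈_ ; _+_ = _+_ ; _*_ = _*_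
    ; -_ = -_ ; 0# = 0# ; 1# = 1# }

module Matrices (R : RawRing 0ℓ 0ℓ) where
  open RawRing R
  open RawSemiringDefs rawSemiring using (sum)

  infix  4 _≋_
  infixr 7 _·_
  infixr 8 _^^_

  Matrix : ℕ → Set
  Matrix n = Fin n → Fin n → Carrier

  _≋_ : ∀ {n} → Vector Carrier n → Vector Carrier n → Set
  x ≋ y = ∀ v → x v ≈ y v

  e : ∀ {n} → Fin n → Vector Carrier n
  e v w = if ⌊ v ≟ w ⌋ then 1# else 0#

  𝟎 : ∀ {n} → Vector Carrier n
  𝟎 _ = 0#

  scale : ∀ {n} → Carrier → Vector Carrier n → Vector Carrier n
  scale s x v = s * x v

  _·_ : ∀ {n} → Matrix n → Vector Carrier n → Vector Carrier n
  (A · x) i = sum (λ j → A i j * x j)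

  ⟨_,_⟩ : ∀ {n} → Vector Carrier n → Vector Carrier n → Carrier
  ⟨ x , y ⟩ = sum (λ j → x j * y j)

  scaleᴹ : ∀ {n} → Carrier → Matrix n → Matrix n
  scaleᴹ s A i j = s * A i j

  _⊗_ : ∀ {n} → Matrix n → Matrix n → Matrix n
  (A ⊗ B) i k = sum (λ j → A i j * B j k)

  _^^_ : ∀ {n} → Matrix n → ℕ → Matrix n
  A ^^ zero  = e
  A ^^ suc m = A ⊗ (A ^^ m)

  Symmetric : ∀ {n} → Matrix n → Set
  Symmetric A = ∀ i j → A i j ≈ A j i

module RealAnalysis (ℛ : CompleteOrderedField) where
  open CompleteOrderedField ℛ renaming (Carrier to ℝ)
  open RawSemiringDefs (RawRing.rawSemiring rawRing)
    using (sum; _^_) renaming (_×_ to _×ℝ_)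
  open Matrices rawRing

  fromℕ : ℕ → ℝ
  fromℕ m = m ×ℝ 1#

  fromℤ : ℤ → ℝ
  fromℤ (+ m)    = fromℕ m
  fromℤ -[1+ m ] = - fromℕ (suc m)

  ∣_∣ : ℝ → ℝ
  ∣ x ∣ with compare 0# x
  ... | tri< _ _ _ = x
  ... | tri≈ _ _ _ = x
  ... | tri> _ _ _ = - x

  infix 4 _⟶_
  _⟶_ : (ℕ → ℝ) → ℝ → Set
  u ⟶ l = ∀ ε → 0# < ε → ∃ λ N → ∀ m → N ℕ.≤ m → ∣ u m - l ∣ < ε

  IsSin : ℝ → ℝ → Set
  IsSin x y = (λ N → sum {N} λ m → term (toℕ m)) ⟶ y
    where
    term : ℕ → ℝ
    term m = (- 1#) ^ m * x ^ suc (2 ℕ.* m) / fromℕ (suc (2 ℕ.* m) !)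

  -- π is the least positive zero of the sine.
  IsPi : ℝ → Set
  IsPi p = 0# < p × IsSin p 0# × (∀ x → 0# < x → x < p → ¬ IsSin x 0#)

  IsLeast : (ℝ → Set) → ℝ → Set
  IsLeast S t = S t × (∀ s → S s → t ≤ s)

  -- Divisibility of a real number by d within ℤ; in particular s ∈ ℤ.
  _Divides_ : ℕ → ℝ → Set
  d Divides s = ∃ λ m → s ≈ fromℤ m * fromℕ d

  -- The first component also says that the elements of S are integers.
  IsGCD : (ℝ → Set) → ℕ → Set
  IsGCD S g = (∀ s → S s → g Divides s)
            × (∀ d → (∀ s → S s → d Divides s) → d ℕ.∣ g)

  Eigenspace : ∀ {n} → Matrix n → ℝ → Vector ℝ n → Set
  Eigenspace H μ x = (H · x) ≋ scale μ x

  Spec : ∀ {n} → Matrix n → ℝ → Set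
  Spec H μ = ∃ λ x → ¬ (x ≋ 𝟎) × Eigenspace H μ x

  IsOrthogonalProjection : ∀ {n} → (Vector ℝ n → Set) → Matrix n → Set
  IsOrthogonalProjection W E = ∀ x →
    W (E · x) × (∀ w → W w → ⟨ (λ v → x v - (E · x) v) , w ⟩ ≈ 0#)

  supp : ∀ {n} → Matrix n → Vector ℝ n → ℝ → Set
  supp H x μ = Spec H μ ×
    ∃ λ E → IsOrthogonalProjection (Eigenspace H μ) E × ¬ ((E · x) ≋ 𝟎)

  record ℂ : Set where
    constructor _+i_
    field
      re im : ℝ
  open ℂ public

  complexRawRing : RawRing 0ℓ 0ℓ
  complexRawRing = record
    { Carrier = ℂ
    ; _≈_ = λ z w → re z ≈ re w × im z ≈ im w
    ; _+_ = λ z w → (re z + re w) +i (im z + im w)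
    ; _*_ = λ z w → (re z * re w - im z * im w) +i (re z * im w + im z * re w)
    ; -_  = λ z → (- re z) +i (- im z)
    ; 0#  = 0# +i 0#
    ; 1#  = 1# +i 0# }

  private
    module C  = RawRing complexRawRing
    module CM = Matrices complexRawRing
    module CS = RawSemiringDefs C.rawSemiring

  ofReal : ℝ → ℂ
  ofReal x = x +i 0#

  𝕚 : ℂ
  𝕚 = 0# +i 1#

  -- |γ| = 1, stated as |γ|² = 1.
  UnitModulus : ℂ → Set
  UnitModulus γ = re γ * re γ + im γ * im γ ≈ 1#

  expPartialSum : ∀ {n} → CM.Matrix n → ℕ → CM.Matrix n
  expPartialSum A N i j =
    CS.sum {N} λ m → ofReal (fromℕ (toℕ m !) ⁻¹) C.* (A CM.^^ toℕ m) i j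

  -- U = exp A, with entrywise convergence of the exponential series.
  IsExp : ∀ {n} → CM.Matrix n → CM.Matrix n → Set
  IsExp A U = ∀ i j → ((λ N → re (expPartialSum A N i j)) ⟶ re (U i j))
                    × ((λ N → im (expPartialSum A N i j)) ⟶ im (U i j))

  TransferTime : ∀ {n} → Matrix n → Fin n → Fin n → ℝ → Set
  TransferTime M a b τ = 0# < τ ×
    ∃ λ U → IsExp (CM.scaleᴹ (C.- (𝕚 C.* ofReal τ)) (λ i j → ofReal (M i j))) U ×
    ∃ λ γ → UnitModulus γ × (U CM.· CM.e a) CM.≋ CM.scale γ (CM.e b)

  PST : ∀ {n} → Matrix n → Fin n → Fin n → Set
  PST M a b = ∃ (TransferTime M a b)

  𝒦 : ∀ {n} → Matrix n → Fin n → Fin n → ℕ → Set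
  𝒦 H a b k = 1 ℕ.≤ k × PST (H ^^ k) a b

  -- {|η − η₀| : η ∈ S ∖ {η₀}}
  Differences : (ℝ → Set) → ℝ → ℝ → Set
  Differences S η₀ s = ∃ λ η → S η × ¬ (η ≈ η₀) × s ≈ ∣ η - η₀ ∣

module Submission where

-- Write e_a = Σ w_l x_l(a) x_l in an orthogonal eigenbasis x_l of H, so that K^k has support
-- {N_l : x_l(a) ≠ 0} ⊆ ℤ at e_a.  Then τ is a transfer time of H^k iff some unit γ satisfies
-- exp(-iτ c^k N_l) x_l(a) = γ x_l(b) for all l.  Dividing by the equation for a fixed index l₀
-- leaves real phases, so sin(τ c^k (N_l - N_l₀)) = 0.  The integers d with sin(τ c^k d) = 0 form a
-- group, which therefore contains δ; hence τ c^k δ ≥ π.  Moreover cos(τ c^k δ) = -1, since the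
-- value 1 would make e_a and e_b proportional, so π and τ c^k δ have the same cosine and sine, and
-- the phases at time π/(c^k δ) agree with those at time τ up to a common factor.
--
-- The eigenbasis comes from deflation: the least eigenvalue of a symmetric matrix is the supremum
-- of the t for which A - tI is positive semidefinite.  No intermediate value theorem is needed for
-- π: the zeros of the sine form a group without elements in (0,1), and perfect state transfer
-- itself provides a positive one.

open import Defs
open import Level using (0ℓ)
open import Axiom.ExcludedMiddle using (ExcludedMiddle)
open import Data.Nat.Base as ℕ using (ℕ; zero; suc; _!)
import Data.Nat.Properties as ℕ
import Data.Nat.Divisibility as ℕ
open import Data.Integer.Base as ℤ using (ℤ; +_; -[1+_])
import Data.Integer.Properties as ℤ
import Data.Sign.Base as Sign
open import Data.Fin.Base using (Fin; toℕ) renaming (zero to fzero; suc to fsuc)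
import Data.Fin.Properties as Fin
open import Data.Product using (∃; _×_; _,_; proj₁; proj₂)
open import Data.Sum.Base using (_⊎_; inj₁; inj₂; [_,_]′)
open import Data.Bool.Base using (T)
open import Data.Maybe.Base using (Maybe; just; nothing; is-just)
open import Data.Empty using (⊥-elim)
open import Data.Vec.Functional using (Vector)
open import Function.Base using (_∘_)
open import Relation.Nullary using (¬_; Dec; yes; no)
open import Relation.Binary.Definitions using (tri<; tri≈; tri>)
open import Relation.Binary.PropositionalEquality as ≡ using (_≡_; _≢_)
open import Relation.Binary.Bundles using (StrictPartialOrder)
open import Relation.Binary.Structures using (IsStrictTotalOrder)
open import Algebra.Bundles using (RawRing; CommutativeRing)
import Algebra.Solver.Ring.AlmostCommutativeRing as ACR
open import Data.Vec.N-ary using (N-ary; Eq; curryⁿ; curryⁿ-cong)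
open import Data.Nat.GCD as ℕ using (gcd)
import Data.Integer.Divisibility.Signed as ℤ

-- The ground field is known only through its axioms, so exponential, sine and spectral theory are
-- all built from least upper bounds. Compactness of the unit sphere is replaced by elimination: a
-- positive semidefinite form either has a null vector or dominates a positive multiple of |x|², and
-- the second is impossible at the supremum. Square roots are avoided: eigenvectors stay
-- unnormalised and are weighted by 1/|x|², and |re| + |im| serves as the complex norm. Eigenvalues
-- may repeat, and powers may merge them, so the argument runs over basis indices l with x_l(a) ≠ 0
-- and is translated to supports only at the interface; a repeated value adds a difference 0, which
-- does not change a gcd. For the other indices the phase equation reads 0 = γ x_l(b), whatever the
-- time. The phases at the two times agree because N_l - N_l₀ = q_l δ: apart from a factor common to
-- all l, the phase is the q_l-th power of exp(-iu) with u = τ c^k δ. So only exp(iu) matters, and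
-- it is -1 at both times.

-- Integer multiples in a commutative ring, and a ring solver with integer coefficients.

module IntegerCoefficients (R : CommutativeRing 0ℓ 0ℓ) where
  open CommutativeRing R
  open import Algebra.Properties.Ring ring
  open import Algebra.Properties.Semiring.Mult.TCOptimised semiring using (1+×; ×-homo-+; ×1-homo-*)
    renaming (_×_ to _×′_)
  open import Relation.Binary.Reasoning.Setoid setoid

  -- With this multiple 1 ×′ x reduces to x, so `0ₚ` and `1ₚ` denote `0#` and `1#` themselves and
  -- solved equations match their goals. In `fromℕ`, by contrast, 1 unfolds to `1# + 0#`.
  ι : ℤ → Carrier
  ι (+ m)    = m ×′ 1#
  ι -[1+ m ] = - (suc m ×′ 1#)

  private
    ℤ-rawRing : RawRing 0ℓ 0ℓ
    ℤ-rawRing = record { Carrier = ℤ ; _≈_ = _≡_ ; _+_ = ℤ._+_ ; _*_ = ℤ._*_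
                       ; -_ = ℤ.-_ ; 0# = + 0 ; 1# = + 1 }

    cancel : ∀ x y z → (x + y) - (x + z) ≈ y - z
    cancel x y z = begin
      (x + y) + - (x + z)     ≈⟨ +-cong (+-comm x y) (sym (-‿+-comm x z)) ⟩
      (y + x) + (- x + - z)   ≈⟨ +-assoc y x _ ⟩
      y + (x + (- x + - z))   ≈⟨ +-congˡ (sym (+-assoc x (- x) (- z))) ⟩
      y + ((x - x) + - z)     ≈⟨ +-congˡ (trans (+-congʳ (-‿inverseʳ x)) (+-identityˡ _)) ⟩
      y - z                   ∎

  ι-⊖ : ∀ m n → ι (m ℤ.⊖ n) ≈ ι (+ m) - ι (+ n)
  ι-⊖ m       zero    = sym (trans (+-congˡ -0#≈0#) (+-identityʳ _))
  ι-⊖ zero    (suc n) = sym (+-identityˡ _)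
  ι-⊖ (suc m) (suc n) = begin
    ι (suc m ℤ.⊖ suc n)           ≡⟨ ≡.cong ι (ℤ.[1+m]⊖[1+n]≡m⊖n m n) ⟩
    ι (m ℤ.⊖ n)                   ≈⟨ ι-⊖ m n ⟩
    ι (+ m) - ι (+ n)             ≈⟨ sym (cancel 1# _ _) ⟩
    (1# + m ×′ 1#) - (1# + n ×′ 1#) ≈⟨ +-cong (sym (1+× m 1#)) (-‿cong (sym (1+× n 1#))) ⟩
    ι (+ suc m) - ι (+ suc n)     ∎

  ι-+ : ∀ i j → ι (i ℤ.+ j) ≈ ι i + ι j
  ι-+ (+ m)    (+ n)    = ×-homo-+ 1# m n
  ι-+ (+ m)    -[1+ n ] = ι-⊖ m (suc n)
  ι-+ -[1+ m ] (+ n)    = trans (ι-⊖ n (suc m)) (+-comm _ _)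
  ι-+ -[1+ m ] -[1+ n ] = begin
    - (suc (suc (m ℕ.+ n)) ×′ 1#)         ≡⟨ ≡.cong (λ k → - (suc k ×′ 1#)) (≡.sym (ℕ.+-suc m n)) ⟩
    - ((suc m ℕ.+ suc n) ×′ 1#)           ≈⟨ -‿cong (×-homo-+ 1# (suc m) (suc n)) ⟩
    - (suc m ×′ 1# + suc n ×′ 1#)         ≈⟨ sym (-‿+-comm _ _) ⟩
    - (suc m ×′ 1#) + - (suc n ×′ 1#)     ∎

  ι-neg : ∀ i → ι (ℤ.- i) ≈ - ι i
  ι-neg (+ zero)  = sym -0#≈0#
  ι-neg (+ suc n) = refl
  ι-neg -[1+ n ]  = sym (-‿involutive _)

  ι-* : ∀ i j → ι (i ℤ.* j) ≈ ι i * ι j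
  ι-* (+ m)    (+ n)    = begin
    ι (Sign.+ ℤ.◃ m ℕ.* n)   ≡⟨ ≡.cong ι (ℤ.+◃n≡+n (m ℕ.* n)) ⟩
    (m ℕ.* n) ×′ 1#          ≈⟨ ×1-homo-* m n ⟩
    ι (+ m) * ι (+ n)        ∎
  ι-* (+ m)    -[1+ n ] = begin
    ι (Sign.- ℤ.◃ m ℕ.* suc n)   ≡⟨ ≡.cong ι (ℤ.-◃n≡-n (m ℕ.* suc n)) ⟩
    ι (ℤ.- (+ (m ℕ.* suc n)))    ≈⟨ ι-neg (+ (m ℕ.* suc n)) ⟩
    - ((m ℕ.* suc n) ×′ 1#)      ≈⟨ -‿cong (×1-homo-* m (suc n)) ⟩
    - (ι (+ m) * ι (+ suc n))    ≈⟨ -‿distribʳ-* _ _ ⟩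
    ι (+ m) * - ι (+ suc n)      ∎
  ι-* -[1+ m ] (+ n)    = begin
    ι (Sign.- ℤ.◃ suc m ℕ.* n)   ≡⟨ ≡.cong ι (ℤ.-◃n≡-n (suc m ℕ.* n)) ⟩
    ι (ℤ.- (+ (suc m ℕ.* n)))    ≈⟨ ι-neg (+ (suc m ℕ.* n)) ⟩
    - ((suc m ℕ.* n) ×′ 1#)      ≈⟨ -‿cong (×1-homo-* (suc m) n) ⟩
    - (ι (+ suc m) * ι (+ n))    ≈⟨ -‿distribˡ-* _ _ ⟩
    - ι (+ suc m) * ι (+ n)      ∎
  ι-* -[1+ m ] -[1+ n ] = begin
    (suc m ℕ.* suc n) ×′ 1#              ≈⟨ ×1-homo-* (suc m) (suc n) ⟩
    ι (+ suc m) * ι (+ suc n)            ≈⟨ sym (-‿involutive _) ⟩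
    - - (ι (+ suc m) * ι (+ suc n))      ≈⟨ -‿cong (-‿distribˡ-* _ _) ⟩
    - (- ι (+ suc m) * ι (+ suc n))      ≈⟨ -‿distribʳ-* _ _ ⟩
    - ι (+ suc m) * - ι (+ suc n)        ∎

  private
    ι-morphism : ℤ-rawRing ACR.-Raw-AlmostCommutative⟶ ACR.fromCommutativeRing R
    ι-morphism = record
      { ⟦_⟧ = ι ; +-homo = ι-+ ; *-homo = ι-* ; -‿homo = ι-neg ; 0-homo = refl ; 1-homo = refl }

    ι-≟ : ∀ i j → Maybe (ι i ≈ ι j)
    ι-≟ i j with i ℤ.≟ j
    ... | yes i≡j = just (reflexive (≡.cong ι i≡j))
    ... | no  _   = nothing

  open import Algebra.Solver.Ring ℤ-rawRing (ACR.fromCommutativeRing R) ι-morphism ι-≟ public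
    using (Polynomial; _:+_; _:*_; _:-_; :-_; con)
  open import Algebra.Solver.Ring ℤ-rawRing (ACR.fromCommutativeRing R) ι-morphism ι-≟
    using (⟦_⟧; ⟦_⟧N; ⟦_⟧↓; ⟦_⟧N-cong; normalise; correct; var; _≟N_; _≈N_)
  open import Relation.Binary.Reflection setoid var ⟦_⟧ ⟦_⟧↓ correct public
    using () renaming (_⊜_ to _:=_)
  open import Relation.Binary.Reflection setoid var ⟦_⟧ ⟦_⟧↓ correct
    using (prove; close)

  0ₚ 1ₚ : ∀ {n} → Polynomial n
  0ₚ = con (+ 0)
  1ₚ = con (+ 1)

  -- Comparing closed normal forms, rather than their values as the library solver does,
  -- keeps the check cheap.
  solve : ∀ n (f : N-ary n (Polynomial n) (Polynomial n × Polynomial n)) →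
          {_ : T (is-just (normalise (proj₁ (close n f)) ≟N normalise (proj₂ (close n f))))} →
          Eq n _≈_ (curryⁿ ⟦ proj₁ (close n f) ⟧) (curryⁿ ⟦ proj₂ (close n f) ⟧)
  solve n f {same} = curryⁿ-cong _≈_ ⟦ p ⟧ ⟦ q ⟧ λ ρ →
    prove ρ p q (semantic (normalise p ≟N normalise q) same ρ)
    where
    p = proj₁ (close n f)
    q = proj₂ (close n f)
    semantic : (d : Maybe (normalise p ≈N normalise q)) → T (is-just d) →
               ∀ ρ → ⟦ normalise p ⟧N ρ ≈ ⟦ normalise q ⟧N ρ
    semantic (just p≈q) _ ρ = ⟦ p≈q ⟧N-cong ρ

-- Arithmetic of an ordered field.

module OrderedField (ℛ : CompleteOrderedField) where
  open CompleteOrderedField ℛ public renaming (Carrier to ℝ)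

  ℝ-ring : CommutativeRing 0ℓ 0ℓ
  ℝ-ring = record { isCommutativeRing = isCommutativeRing }

  open CommutativeRing ℝ-ring public
    using ( setoid; ring; semiring; commutativeSemiring; +-monoid; refl; sym; trans; reflexive
          ; +-cong; +-congˡ; +-congʳ; *-cong; *-congˡ; *-congʳ; -‿cong
          ; +-assoc; +-comm; +-identityˡ; +-identityʳ; -‿inverseʳ; -‿inverseˡ
          ; *-assoc; *-comm; *-identityˡ; *-identityʳ; zeroˡ; zeroʳ; distribˡ; distribʳ )
  open IntegerCoefficients ℝ-ring public
  open IsStrictTotalOrder isStrictTotalOrder public
    using (isStrictPartialOrder; <-respʳ-≈; <-respˡ-≈; _≟_)
    renaming (irrefl to <-irrefl; trans to <-trans)
  import Relation.Binary.Construct.StrictToNonStrict _≈_ _<_ as NonStrict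
  open RealAnalysis ℛ using (fromℕ)
  open import Relation.Binary.Structures using (IsTotalOrder)
  open IsTotalOrder (NonStrict.isTotalOrder isStrictTotalOrder) public
    using (≤-respʳ-≈; ≤-respˡ-≈)
    renaming (trans to ≤-trans; antisym to ≤-antisym; total to ≤-total; refl to ≤-refl; reflexive to ≤-reflexive)

  <-strictPartialOrder : StrictPartialOrder 0ℓ 0ℓ 0ℓ
  <-strictPartialOrder = record { isStrictPartialOrder = isStrictPartialOrder }

  module ≤-Reasoning where
    open import Relation.Binary.Reasoning.StrictPartialOrder <-strictPartialOrder public
  module ≈-Reasoning where
    open import Relation.Binary.Reasoning.Setoid setoid public

  <⇒≤ : ∀ {x y} → x < y → x ≤ y
  <⇒≤ = inj₁

  <-≤-trans : ∀ {x y z} → x < y → y ≤ z → x < z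
  <-≤-trans = NonStrict.<-≤-trans <-trans <-respʳ-≈

  ≤-<-trans : ∀ {x y z} → x ≤ y → y < z → x < z
  ≤-<-trans = NonStrict.≤-<-trans sym <-trans <-respˡ-≈

  ≰⇒> : ∀ {x y} → ¬ (x ≤ y) → y < x
  ≰⇒> {x} {y} x≰y with compare x y
  ... | tri< x<y _ _ = ⊥-elim (x≰y (inj₁ x<y))
  ... | tri≈ _ x≈y _ = ⊥-elim (x≰y (inj₂ x≈y))
  ... | tri> _ _ y<x = y<x

  ≮⇒≥ : ∀ {x y} → ¬ (x < y) → y ≤ x
  ≮⇒≥ {x} {y} x≮y with compare x y
  ... | tri< x<y _ _ = ⊥-elim (x≮y x<y)
  ... | tri≈ _ x≈y _ = inj₂ (sym x≈y)
  ... | tri> _ _ y<x = inj₁ y<x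

  <⇒≱ : ∀ {x y} → x < y → ¬ (y ≤ x)
  <⇒≱ x<y y≤x = <-irrefl refl (<-≤-trans x<y y≤x)

  0<⇒≉0 : ∀ {x} → 0# < x → ¬ (x ≈ 0#)
  0<⇒≉0 0<x x≈0 = <-irrefl (sym x≈0) 0<x

  -- With `≤-by`, the usual way inequalities are proved below: the difference d is written as a
  -- visibly positive expression, and the identity is left to the ring solver.
  <-by : ∀ {x y} d → 0# < d → y ≈ x + d → x < y
  <-by {x} d 0<d y≈x+d =
    <-respʳ-≈ (trans (+-comm d x) (sym y≈x+d)) (<-respˡ-≈ (+-identityˡ x) (+-monoˡ-< x 0<d))

  ≤-by : ∀ {x y} d → 0# ≤ d → y ≈ x + d → x ≤ y
  ≤-by d (inj₁ 0<d) eq = inj₁ (<-by d 0<d eq)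
  ≤-by {x} d (inj₂ 0≈d) eq = inj₂ (sym (trans eq (trans (+-congˡ (sym 0≈d)) (+-identityʳ x))))

  0<y-x : ∀ {x y} → x < y → 0# < y - x
  0<y-x {x} x<y = <-respˡ-≈ (-‿inverseʳ x) (+-monoˡ-< (- x) x<y)

  0≤y-x : ∀ {x y} → x ≤ y → 0# ≤ y - x
  0≤y-x {x} (inj₁ x<y) = inj₁ (0<y-x x<y)
  0≤y-x {x} (inj₂ x≈y) = inj₂ (trans (sym (-‿inverseʳ x)) (+-congʳ x≈y))

  0<x+y : ∀ {x y} → 0# < x → 0# ≤ y → 0# < x + y
  0<x+y {x} {y} 0<x 0≤y = <-≤-trans 0<x (≤-by y 0≤y refl)

  0≤x+y : ∀ {x y} → 0# ≤ x → 0# ≤ y → 0# ≤ x + y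
  0≤x+y {x} {y} 0≤x 0≤y = ≤-trans 0≤x (≤-by y 0≤y refl)

  0≤x*y : ∀ {x y} → 0# ≤ x → 0# ≤ y → 0# ≤ x * y
  0≤x*y (inj₁ 0<x) (inj₁ 0<y) = inj₁ (*-pos 0<x 0<y)
  0≤x*y {x} {y} (inj₂ 0≈x) _  = inj₂ (sym (trans (*-congʳ (sym 0≈x)) (zeroˡ y)))
  0≤x*y {x} {y} _ (inj₂ 0≈y)  = inj₂ (sym (trans (*-congˡ (sym 0≈y)) (zeroʳ x)))

  x<0⇒0<-x : ∀ {x} → x < 0# → 0# < - x
  x<0⇒0<-x {x} x<0 = <-respʳ-≈ (+-identityˡ _) (0<y-x x<0)

  x≤0⇒0≤-x : ∀ {x} → x ≤ 0# → 0# ≤ - x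
  x≤0⇒0≤-x {x} x≤0 = ≤-respʳ-≈ (+-identityˡ _) (0≤y-x x≤0)

  neg*neg : ∀ x → - x * - x ≈ x * x
  neg*neg x = solve 1 (λ x → :- x :* :- x := x :* x) x

  x≉0⇒0<x² : ∀ {x} → ¬ (x ≈ 0#) → 0# < x * x
  x≉0⇒0<x² {x} x≉0 with compare 0# x
  ... | tri< 0<x _ _ = *-pos 0<x 0<x
  ... | tri≈ _ 0≈x _ = ⊥-elim (x≉0 (sym 0≈x))
  ... | tri> _ _ x<0 = <-respʳ-≈ (neg*neg x) (*-pos (x<0⇒0<-x x<0) (x<0⇒0<-x x<0))

  0≤x² : ∀ x → 0# ≤ x * x
  0≤x² x with x ≟ 0#
  ... | yes x≈0 = inj₂ (sym (trans (*-congʳ x≈0) (zeroˡ x)))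
  ... | no  x≉0 = inj₁ (x≉0⇒0<x² x≉0)

  x²≤0⇒x≈0 : ∀ {x} → x * x ≤ 0# → x ≈ 0#
  x²≤0⇒x≈0 {x} x²≤0 with x ≟ 0#
  ... | yes x≈0 = x≈0
  ... | no  x≉0 = ⊥-elim (<⇒≱ (x≉0⇒0<x² x≉0) x²≤0)

  0≤1 : 0# ≤ 1#
  0≤1 = inj₁ 0<1

  0≤2 : 0# ≤ 1# + 1#
  0≤2 = 0≤x+y 0≤1 0≤1

  x*x⁻¹≈1 : ∀ {x} → 0# < x → x * x ⁻¹ ≈ 1#
  x*x⁻¹≈1 0<x = *-inverseʳ (0<⇒≉0 0<x)

  *-cancelˡ-0 : ∀ {x y} → ¬ (x ≈ 0#) → x * y ≈ 0# → y ≈ 0#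
  *-cancelˡ-0 {x} {y} x≉0 xy≈0 = begin
    y              ≈⟨ sym (*-identityˡ y) ⟩
    1# * y         ≈⟨ *-congʳ (sym (*-inverseʳ x≉0)) ⟩
    x * x ⁻¹ * y   ≈⟨ solve 3 (λ x z y → x :* z :* y := z :* (x :* y)) x (x ⁻¹) y ⟩
    x ⁻¹ * (x * y) ≈⟨ *-congˡ xy≈0 ⟩
    x ⁻¹ * 0#      ≈⟨ zeroʳ _ ⟩
    0#             ∎
    where open ≈-Reasoning

  x-y≈0⇒x≈y : ∀ {x y} → x - y ≈ 0# → x ≈ y
  x-y≈0⇒x≈y {x} {y} eq = begin
    x             ≈⟨ solve 2 (λ x y → x := (x :- y) :+ y) x y ⟩
    (x - y) + y   ≈⟨ +-congʳ eq ⟩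
    0# + y        ≈⟨ +-identityˡ y ⟩
    y             ∎
    where open ≈-Reasoning

  x≈y⇒x-y≈0 : ∀ {x y} → x ≈ y → x - y ≈ 0#
  x≈y⇒x-y≈0 {x} {y} eq = trans (+-congʳ eq) (-‿inverseʳ y)

  *-cancelˡ : ∀ {x y z} → ¬ (x ≈ 0#) → x * y ≈ x * z → y ≈ z
  *-cancelˡ {x} {y} {z} x≉0 eq = x-y≈0⇒x≈y (*-cancelˡ-0 x≉0 (begin
    x * (y - z)     ≈⟨ solve 3 (λ x y z → x :* (y :- z) := x :* y :- x :* z) x y z ⟩
    x * y - x * z   ≈⟨ x≈y⇒x-y≈0 eq ⟩
    0#              ∎))
    where open ≈-Reasoning

  *-≉0 : ∀ {x y} → ¬ (x ≈ 0#) → ¬ (y ≈ 0#) → ¬ (x * y ≈ 0#)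
  *-≉0 x≉0 y≉0 xy≈0 = y≉0 (*-cancelˡ-0 x≉0 xy≈0)

  0<xy⇒0<y : ∀ {x y} → 0# ≤ x → 0# < x * y → 0# < y
  0<xy⇒0<y {x} {y} 0≤x 0<xy = ≰⇒> λ y≤0 → <⇒≱ 0<xy
    (≤-by _ (0≤x*y 0≤x (x≤0⇒0≤-x y≤0))
      (solve 2 (λ x y → 0ₚ := x :* y :+ x :* :- y) x y))

  0<x⁻¹ : ∀ {x} → 0# < x → 0# < x ⁻¹
  0<x⁻¹ {x} 0<x = 0<xy⇒0<y (<⇒≤ 0<x) (<-respʳ-≈ (sym (x*x⁻¹≈1 0<x)) 0<1)

  +-mono-≤ : ∀ {x y u v} → x ≤ y → u ≤ v → x + u ≤ y + v
  +-mono-≤ {x} {y} {u} {v} x≤y u≤v = ≤-by _ (0≤x+y (0≤y-x x≤y) (0≤y-x u≤v))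
    (solve 4 (λ x y u v → y :+ v := (x :+ u) :+ ((y :- x) :+ (v :- u))) x y u v)

  +-mono-<-≤ : ∀ {x y u v} → x < y → u ≤ v → x + u < y + v
  +-mono-<-≤ {x} {y} {u} {v} x<y u≤v = <-by _ (0<x+y (0<y-x x<y) (0≤y-x u≤v))
    (solve 4 (λ x y u v → y :+ v := (x :+ u) :+ ((y :- x) :+ (v :- u))) x y u v)

  *-monoˡ-≤ : ∀ {x y z} → 0# ≤ z → x ≤ y → z * x ≤ z * y
  *-monoˡ-≤ {x} {y} {z} 0≤z x≤y = ≤-by _ (0≤x*y 0≤z (0≤y-x x≤y))
    (solve 3 (λ x y z → z :* y := z :* x :+ z :* (y :- x)) x y z)

  *-mono-≤ : ∀ {x y u v} → 0# ≤ y → 0# ≤ u → x ≤ y → u ≤ v → x * u ≤ y * v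
  *-mono-≤ {x} {y} {u} {v} 0≤y 0≤u x≤y u≤v = ≤-by _ (0≤x+y (0≤x*y (0≤y-x x≤y) 0≤u) (0≤x*y 0≤y (0≤y-x u≤v)))
    (solve 4 (λ x y u v → y :* v := x :* u :+ ((y :- x) :* u :+ y :* (v :- u))) x y u v)

  *-cancelˡ-≤ : ∀ {x y z} → 0# < z → z * x ≤ z * y → x ≤ y
  *-cancelˡ-≤ {x} {y} {z} 0<z zx≤zy = ≮⇒≥ λ y<x → <⇒≱ (*-pos 0<z (0<y-x y<x))
    (≤-by _ (0≤y-x zx≤zy) (solve 3 (λ x y z → 0ₚ := z :* (x :- y) :+ (z :* y :- z :* x)) x y z))

  ½ : ℝ
  ½ = (1# + 1#) ⁻¹

  0<½ : 0# < ½
  0<½ = 0<x⁻¹ (0<x+y 0<1 0≤1)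

  ½+½ : ∀ x → x * ½ + x * ½ ≈ x
  ½+½ x = begin
    x * ½ + x * ½     ≈⟨ solve 2 (λ x h → x :* h :+ x :* h := x :* ((1ₚ :+ 1ₚ) :* h)) x ½ ⟩
    x * ((1# + 1#) * ½) ≈⟨ *-congˡ (x*x⁻¹≈1 (0<x+y 0<1 0≤1)) ⟩
    x * 1#            ≈⟨ *-identityʳ x ⟩
    x                 ∎
    where open ≈-Reasoning

  0≤fromℕ : ∀ m → 0# ≤ fromℕ m
  0≤fromℕ zero    = ≤-refl
  0≤fromℕ (suc m) = 0≤x+y 0≤1 (0≤fromℕ m)

  0<fromℕ-suc : ∀ m → 0# < fromℕ (suc m)
  0<fromℕ-suc m = 0<x+y 0<1 (0≤fromℕ m)

-- Vectors and matrices over a commutative ring, for use over both ℝ and ℂ.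

module LinearAlgebra (R : CommutativeRing 0ℓ 0ℓ) where
  open CommutativeRing R
  open import Algebra.Properties.Semiring.Sum semiring public
    using (sum; sum-cong-≋; sum-replicate-zero; ∑-distrib-+; ∑-comm; *-distribˡ-sum; *-distribʳ-sum)
  open IntegerCoefficients R
  open Matrices (CommutativeRing.rawRing R) public
  open import Relation.Binary.Reasoning.Setoid setoid

  sum-zero : ∀ {n} {f : Vector Carrier n} → (∀ i → f i ≈ 0#) → sum f ≈ 0#
  sum-zero {n} f≈0 = trans (sum-cong-≋ f≈0) (sum-replicate-zero n)

  sum-single : ∀ {n} {f : Vector Carrier n} i → (∀ j → j ≢ i → f j ≈ 0#) → sum f ≈ f i
  sum-single fzero f≈0 = trans (+-congˡ (sum-zero (λ j → f≈0 (fsuc j) λ ()))) (+-identityʳ _)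
  sum-single (fsuc i) f≈0 = trans (+-cong (f≈0 fzero λ ())
    (sum-single i (λ j j≢i → f≈0 (fsuc j) (j≢i ∘ Fin.suc-injective)))) (+-identityˡ _)

  e-diagonal : ∀ {n} (i : Fin n) → e i i ≈ 1#
  e-diagonal i with i Fin.≟ i
  ... | yes _   = refl
  ... | no  i≢i = ⊥-elim (i≢i ≡.refl)

  e-offDiagonal : ∀ {n} {i j : Fin n} → i ≢ j → e i j ≈ 0#
  e-offDiagonal {i = i} {j} i≢j with i Fin.≟ j
  ... | yes i≡j = ⊥-elim (i≢j i≡j)
  ... | no  _   = refl

  e-symmetric : ∀ {n} → Symmetric (e {n})
  e-symmetric i j with i Fin.≟ j
  ... | yes ≡.refl = sym (e-diagonal i)
  ... | no i≢j     = sym (e-offDiagonal (i≢j ∘ ≡.sym))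

  ⟨e,_⟩ : ∀ {n} (x : Vector Carrier n) i → ⟨ e i , x ⟩ ≈ x i
  ⟨e,_⟩ x i = begin
    ⟨ e i , x ⟩   ≈⟨ sum-single i (λ j j≢i → trans (*-congʳ (e-offDiagonal (j≢i ∘ ≡.sym))) (zeroˡ _)) ⟩
    e i i * x i   ≈⟨ *-congʳ (e-diagonal i) ⟩
    1# * x i      ≈⟨ *-identityˡ _ ⟩
    x i           ∎

  ⟨⟩-cong : ∀ {n} {x x′ y y′ : Vector Carrier n} → x ≋ x′ → y ≋ y′ → ⟨ x , y ⟩ ≈ ⟨ x′ , y′ ⟩
  ⟨⟩-cong x≋x′ y≋y′ = sum-cong-≋ (λ i → *-cong (x≋x′ i) (y≋y′ i))

  ⟨⟩-comm : ∀ {n} (x y : Vector Carrier n) → ⟨ x , y ⟩ ≈ ⟨ y , x ⟩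
  ⟨⟩-comm x y = sum-cong-≋ (λ i → *-comm (x i) (y i))

  comb : ∀ {n} → Carrier → Vector Carrier n → Carrier → Vector Carrier n → Vector Carrier n
  comb s x t y v = s * x v + t * y v

  ⟨⟩-combˡ : ∀ {n} s (x : Vector Carrier n) t y z →
             ⟨ comb s x t y , z ⟩ ≈ s * ⟨ x , z ⟩ + t * ⟨ y , z ⟩
  ⟨⟩-combˡ s x t y z = begin
    sum (λ i → comb s x t y i * z i)
      ≈⟨ sum-cong-≋ (λ i → solve 5 (λ s x t y z → (s :* x :+ t :* y) :* z := s :* (x :* z) :+ t :* (y :* z)) s (x i) t (y i) (z i)) ⟩
    sum (λ i → s * (x i * z i) + t * (y i * z i))
      ≈⟨ ∑-distrib-+ (λ i → s * (x i * z i)) (λ i → t * (y i * z i)) ⟩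
    sum (λ i → s * (x i * z i)) + sum (λ i → t * (y i * z i))
      ≈⟨ +-cong (sym (*-distribˡ-sum s (λ i → x i * z i))) (sym (*-distribˡ-sum t (λ i → y i * z i))) ⟩
    s * ⟨ x , z ⟩ + t * ⟨ y , z ⟩ ∎

  ⟨⟩-combʳ : ∀ {n} (z : Vector Carrier n) s x t y →
             ⟨ z , comb s x t y ⟩ ≈ s * ⟨ z , x ⟩ + t * ⟨ z , y ⟩
  ⟨⟩-combʳ z s x t y = begin
    ⟨ z , comb s x t y ⟩            ≈⟨ ⟨⟩-comm z _ ⟩
    ⟨ comb s x t y , z ⟩            ≈⟨ ⟨⟩-combˡ s x t y z ⟩
    s * ⟨ x , z ⟩ + t * ⟨ y , z ⟩   ≈⟨ +-cong (*-congˡ (⟨⟩-comm x z)) (*-congˡ (⟨⟩-comm y z)) ⟩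
    s * ⟨ z , x ⟩ + t * ⟨ z , y ⟩   ∎

  ⟨⟩-scaleˡ : ∀ {n} s (x : Vector Carrier n) y → ⟨ scale s x , y ⟩ ≈ s * ⟨ x , y ⟩
  ⟨⟩-scaleˡ s x y = trans (sum-cong-≋ (λ i → *-assoc s (x i) (y i))) (sym (*-distribˡ-sum s (λ i → x i * y i)))

  ⟨⟩-scaleʳ : ∀ {n} (y : Vector Carrier n) s x → ⟨ y , scale s x ⟩ ≈ s * ⟨ y , x ⟩
  ⟨⟩-scaleʳ y s x = trans (⟨⟩-comm y _) (trans (⟨⟩-scaleˡ s x y) (*-congˡ (⟨⟩-comm x y)))

  ·-cong : ∀ {n} (A : Matrix n) {x y} → x ≋ y → A · x ≋ A · y
  ·-cong A x≋y i = ⟨⟩-cong (λ _ → refl) x≋y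

  ·-comb : ∀ {n} (A : Matrix n) s x t y → A · comb s x t y ≋ comb s (A · x) t (A · y)
  ·-comb A s x t y i = ⟨⟩-combʳ (A i) s x t y

  ·-scale : ∀ {n} (A : Matrix n) s x → A · scale s x ≋ scale s (A · x)
  ·-scale A s x i = ⟨⟩-scaleʳ (A i) s x

  ·-e : ∀ {n} (A : Matrix n) j i → (A · e j) i ≈ A i j
  ·-e A j i = trans (⟨⟩-comm (A i) (e j)) (⟨e, A i ⟩ j)

  e-· : ∀ {n} (x : Vector Carrier n) → e · x ≋ x
  e-· x i = ⟨e, x ⟩ i

  ⟨⟩-sumʳ : ∀ {m n} (y : Vector Carrier n) (f : Fin m → Vector Carrier n) →
            ⟨ y , (λ v → sum (λ l → f l v)) ⟩ ≈ sum (λ l → ⟨ y , f l ⟩)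
  ⟨⟩-sumʳ y f = begin
    sum (λ v → y v * sum (λ l → f l v))     ≈⟨ sum-cong-≋ (λ v → *-distribˡ-sum (y v) (λ l → f l v)) ⟩
    sum (λ v → sum (λ l → y v * f l v))     ≈⟨ ∑-comm (λ v l → y v * f l v) ⟩
    sum (λ l → sum (λ v → y v * f l v))     ∎

  ⊗-· : ∀ {n} (A B : Matrix n) x → (A ⊗ B) · x ≋ A · (B · x)
  ⊗-· A B x i = begin
    sum (λ k → sum (λ j → A i j * B j k) * x k)
      ≈⟨ sum-cong-≋ (λ k → trans (*-distribʳ-sum (x k) (λ j → A i j * B j k))
                                 (sum-cong-≋ (λ j → *-assoc (A i j) (B j k) (x k)))) ⟩
    sum (λ k → sum (λ j → A i j * (B j k * x k)))
      ≈⟨ ∑-comm (λ k j → A i j * (B j k * x k)) ⟩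
    sum (λ j → sum (λ k → A i j * (B j k * x k)))
      ≈⟨ sum-cong-≋ (λ j → sym (*-distribˡ-sum (A i j) (λ k → B j k * x k))) ⟩
    sum (λ j → A i j * (B · x) j) ∎

  SelfAdjoint : ∀ {n} → Matrix n → Set
  SelfAdjoint A = ∀ x y → ⟨ A · x , y ⟩ ≈ ⟨ x , A · y ⟩

  symmetric⇒selfAdjoint : ∀ {n} {A : Matrix n} → Symmetric A → SelfAdjoint A
  symmetric⇒selfAdjoint {A = A} A-sym x y = begin
    sum (λ i → (A · x) i * y i)
      ≈⟨ sum-cong-≋ (λ i → *-distribʳ-sum (y i) (λ j → A i j * x j)) ⟩
    sum (λ i → sum (λ j → A i j * x j * y i))
      ≈⟨ ∑-comm (λ i j → A i j * x j * y i) ⟩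
    sum (λ j → sum (λ i → A i j * x j * y i))
      ≈⟨ sum-cong-≋ (λ j → trans (sum-cong-≋ (λ i → trans
           (solve 3 (λ a x y → a :* x :* y := x :* (a :* y)) (A i j) (x j) (y i))
           (*-congˡ (*-congʳ (A-sym i j))))) (sym (*-distribˡ-sum (x j) (λ i → A j i * y i)))) ⟩
    sum (λ j → x j * (A · y) j) ∎

  -- Moving the factors across the pairing one by one reverses their order; `commute` restores it.
  ^^-selfAdjoint : ∀ {n} {A : Matrix n} → SelfAdjoint A → ∀ k → SelfAdjoint (A ^^ k)
  ^^-selfAdjoint A-adj zero = symmetric⇒selfAdjoint e-symmetric
  ^^-selfAdjoint {A = A} A-adj (suc k) x y = begin
    ⟨ (A ⊗ (A ^^ k)) · x , y ⟩    ≈⟨ ⟨⟩-cong (⊗-· A (A ^^ k) x) (λ _ → refl) ⟩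
    ⟨ A · (A ^^ k) · x , y ⟩    ≈⟨ A-adj _ _ ⟩
    ⟨ (A ^^ k) · x , A · y ⟩    ≈⟨ ^^-selfAdjoint A-adj k x (A · y) ⟩
    ⟨ x , (A ^^ k) · A · y ⟩    ≈⟨ ⟨⟩-cong {x = x} (λ _ → refl) (commute k y) ⟩
    ⟨ x , A · (A ^^ k) · y ⟩    ≈⟨ ⟨⟩-cong {x = x} (λ _ → refl) (λ i → sym (⊗-· A (A ^^ k) y i)) ⟩
    ⟨ x , (A ⊗ (A ^^ k)) · y ⟩    ∎
    where
    commute : ∀ k y → (A ^^ k) · A · y ≋ A · (A ^^ k) · y
    commute zero    y i = trans (e-· (A · y) i) (·-cong A (λ j → sym (e-· y j)) i)
    commute (suc k) y i = begin
      ((A ⊗ (A ^^ k)) · A · y) i   ≈⟨ ⊗-· A (A ^^ k) (A · y) i ⟩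
      (A · (A ^^ k) · A · y) i   ≈⟨ ·-cong A (commute k y) i ⟩
      (A · A · (A ^^ k) · y) i   ≈⟨ ·-cong A (λ j → sym (⊗-· A (A ^^ k) y j)) i ⟩
      (A · (A ⊗ (A ^^ k)) · y) i   ∎

-- Quadratic forms and Gaussian elimination.

module SpectralTheorem (ℛ : CompleteOrderedField) where
  open OrderedField ℛ
  open LinearAlgebra ℝ-ring public
  open RealAnalysis ℛ using (fromℕ)

  private
    Vec : ℕ → Set
    Vec = Vector ℝ

    -- Lets the ring solver work modulo a relation z ≈ 0: the identity it checks may carry an
    -- explicit multiple of z.
    ≈-modulo : ∀ {x y z} w → z ≈ 0# → x ≈ y + z * w → x ≈ y
    ≈-modulo {y = y} w z≈0 eq = trans eq (trans (+-congˡ (trans (*-congʳ z≈0) (zeroˡ w))) (+-identityʳ y))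

  sum-nonneg : ∀ {n} {f : Vec n} → (∀ i → 0# ≤ f i) → 0# ≤ sum f
  sum-nonneg {zero}  0≤f = ≤-refl
  sum-nonneg {suc n} 0≤f = 0≤x+y (0≤f fzero) (sum-nonneg (0≤f ∘ fsuc))

  term≤sum : ∀ {n} {f : Vec n} → (∀ i → 0# ≤ f i) → ∀ i → f i ≤ sum f
  term≤sum 0≤f fzero    = ≤-by _ (sum-nonneg (0≤f ∘ fsuc)) refl
  term≤sum {f = f} 0≤f (fsuc i) = ≤-trans (term≤sum (0≤f ∘ fsuc) i) (≤-by (f fzero) (0≤f fzero) (+-comm _ _))

  0≤⟨x,x⟩ : ∀ {n} (x : Vec n) → 0# ≤ ⟨ x , x ⟩
  0≤⟨x,x⟩ x = sum-nonneg (λ i → 0≤x² (x i))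

  ⟨x,x⟩≤0⇒x≋𝟎 : ∀ {n} {x : Vec n} → ⟨ x , x ⟩ ≤ 0# → x ≋ 𝟎
  ⟨x,x⟩≤0⇒x≋𝟎 {x = x} x²≤0 i = x²≤0⇒x≈0 (≤-trans (term≤sum (λ i → 0≤x² (x i)) i) x²≤0)

  x≉𝟎⇒0<⟨x,x⟩ : ∀ {n} {x : Vec n} → ¬ (x ≋ 𝟎) → 0# < ⟨ x , x ⟩
  x≉𝟎⇒0<⟨x,x⟩ x≉𝟎 = ≰⇒> (λ x²≤0 → x≉𝟎 (⟨x,x⟩≤0⇒x≋𝟎 x²≤0))

  qf : ∀ {n} → Matrix n → Vec n → ℝ
  qf A x = ⟨ x , A · x ⟩

  qf-comb : ∀ {n} {A : Matrix n} → Symmetric A → ∀ s x t y →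
            qf A (comb s x t y) ≈ s * s * qf A x + (1# + 1#) * (s * t) * ⟨ y , A · x ⟩ + t * t * qf A y
  qf-comb {A = A} A-sym s x t y = begin
    ⟨ comb s x t y , A · comb s x t y ⟩
      ≈⟨ ⟨⟩-cong (λ _ → refl) (·-comb A s x t y) ⟩
    ⟨ comb s x t y , comb s (A · x) t (A · y) ⟩
      ≈⟨ ⟨⟩-combˡ s x t y _ ⟩
    s * ⟨ x , comb s (A · x) t (A · y) ⟩ + t * ⟨ y , comb s (A · x) t (A · y) ⟩
      ≈⟨ +-cong (*-congˡ (⟨⟩-combʳ x s _ t _)) (*-congˡ (⟨⟩-combʳ y s _ t _)) ⟩
    s * (s * qf A x + t * ⟨ x , A · y ⟩) + t * (s * ⟨ y , A · x ⟩ + t * qf A y)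
      ≈⟨ +-congʳ (*-congˡ (+-congˡ (*-congˡ xAy≈yAx))) ⟩
    s * (s * qf A x + t * ⟨ y , A · x ⟩) + t * (s * ⟨ y , A · x ⟩ + t * qf A y)
      ≈⟨ solve 5 (λ s t p q r → s :* (s :* p :+ t :* q) :+ t :* (s :* q :+ t :* r)
                   := s :* s :* p :+ (1ₚ :+ 1ₚ) :* (s :* t) :* q :+ t :* t :* r) s t (qf A x) ⟨ y , A · x ⟩ (qf A y) ⟩
    s * s * qf A x + (1# + 1#) * (s * t) * ⟨ y , A · x ⟩ + t * t * qf A y ∎
    where
    open ≈-Reasoning
    xAy≈yAx : ⟨ x , A · y ⟩ ≈ ⟨ y , A · x ⟩
    xAy≈yAx = trans (sym (symmetric⇒selfAdjoint A-sym x y)) (⟨⟩-comm (A · x) y)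

  -- Used twice: for the Schur complement of a pivot, and to remove the line of an eigenvector from
  -- a projection.
  rankOneUpdate : ∀ {n} → Matrix n → ℝ → Vec n → Matrix n
  rankOneUpdate A s v i j = A i j - s * (v i * v j)

  rankOneUpdate-symmetric : ∀ {n} {A : Matrix n} → Symmetric A → ∀ s v → Symmetric (rankOneUpdate A s v)
  rankOneUpdate-symmetric A-sym s v i j = +-cong (A-sym i j) (-‿cong (*-congˡ (*-comm (v i) (v j))))

  rankOneUpdate-· : ∀ {n} (A : Matrix n) s v x i →
                    (rankOneUpdate A s v · x) i ≈ (A · x) i - s * (v i * ⟨ v , x ⟩)
  rankOneUpdate-· A s v x i = begin
    sum (λ j → (A i j - s * (v i * v j)) * x j)
      ≈⟨ sum-cong-≋ (λ j → solve 5 (λ a s v w x → (a :- s :* (v :* w)) :* x := a :* x :+ :- (s :* v) :* (w :* x)) (A i j) s (v i) (v j) (x j)) ⟩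
    sum (λ j → A i j * x j + - (s * v i) * (v j * x j))
      ≈⟨ ∑-distrib-+ (λ j → A i j * x j) (λ j → - (s * v i) * (v j * x j)) ⟩
    (A · x) i + sum (λ j → - (s * v i) * (v j * x j))
      ≈⟨ +-congˡ (sym (*-distribˡ-sum (- (s * v i)) (λ j → v j * x j))) ⟩
    (A · x) i + - (s * v i) * ⟨ v , x ⟩
      ≈⟨ solve 4 (λ a s v p → a :+ :- (s :* v) :* p := a :- s :* (v :* p)) ((A · x) i) s (v i) ⟨ v , x ⟩ ⟩
    (A · x) i - s * (v i * ⟨ v , x ⟩) ∎
    where open ≈-Reasoning

  qf-rankOneUpdate : ∀ {n} (A : Matrix n) s v x →
                     qf (rankOneUpdate A s v) x ≈ qf A x - s * (⟨ v , x ⟩ * ⟨ v , x ⟩)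
  qf-rankOneUpdate A s v x = begin
    ⟨ x , rankOneUpdate A s v · x ⟩
      ≈⟨ sum-cong-≋ (λ i → trans (*-congˡ (rankOneUpdate-· A s v x i))
           (solve 5 (λ x a s v p → x :* (a :- s :* (v :* p)) := x :* a :+ :- (s :* p) :* (v :* x)) (x i) ((A · x) i) s (v i) p)) ⟩
    sum (λ i → x i * (A · x) i + - (s * p) * (v i * x i))
      ≈⟨ ∑-distrib-+ (λ i → x i * (A · x) i) (λ i → - (s * p) * (v i * x i)) ⟩
    qf A x + sum (λ i → - (s * p) * (v i * x i))
      ≈⟨ +-congˡ (sym (*-distribˡ-sum (- (s * p)) (λ i → v i * x i))) ⟩
    qf A x + - (s * p) * p
      ≈⟨ solve 3 (λ a s p → a :+ :- (s :* p) :* p := a :- s :* (p :* p)) (qf A x) s p ⟩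
    qf A x - s * (p * p) ∎
    where
    open ≈-Reasoning
    p = ⟨ v , x ⟩

  tailBlock : ∀ {n} → Matrix (suc n) → Matrix n
  tailBlock A i j = A (fsuc i) (fsuc j)

  qf-block : ∀ {n} {A : Matrix (suc n)} → Symmetric A → ∀ x → let x₀ = x fzero ; x′ = x ∘ fsuc in
             qf A x ≈ A fzero fzero * (x₀ * x₀) + (1# + 1#) * (x₀ * ⟨ A fzero ∘ fsuc , x′ ⟩) + qf (tailBlock A) x′
  qf-block {A = A} A-sym x = begin
    x₀ * (a * x₀ + p) + sum (λ i → x′ i * (A (fsuc i) fzero * x₀ + (A′ · x′) i))
      ≈⟨ +-congˡ (sum-cong-≋ (λ i → trans (*-congˡ (+-congʳ (*-congʳ (A-sym (fsuc i) fzero))))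
           (solve 4 (λ x v y b → x :* (v :* y :+ b) := y :* (v :* x) :+ x :* b) (x′ i) (v i) x₀ ((A′ · x′) i)))) ⟩
    x₀ * (a * x₀ + p) + sum (λ i → x₀ * (v i * x′ i) + x′ i * (A′ · x′) i)
      ≈⟨ +-congˡ (trans (∑-distrib-+ (λ i → x₀ * (v i * x′ i)) (λ i → x′ i * (A′ · x′) i))
                        (+-congʳ (sym (*-distribˡ-sum x₀ (λ i → v i * x′ i))))) ⟩
    x₀ * (a * x₀ + p) + (x₀ * p + qf A′ x′)
      ≈⟨ solve 4 (λ x a p q → x :* (a :* x :+ p) :+ (x :* p :+ q)
                   := a :* (x :* x) :+ (1ₚ :+ 1ₚ) :* (x :* p) :+ q) x₀ a p (qf A′ x′) ⟩
    a * (x₀ * x₀) + (1# + 1#) * (x₀ * p) + qf A′ x′ ∎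
    where
    open ≈-Reasoning
    x₀ = x fzero
    x′ = x ∘ fsuc
    v  = A fzero ∘ fsuc
    a  = A fzero fzero
    A′ = tailBlock A
    p  = ⟨ v , x′ ⟩

  -- A crude substitute for Cauchy-Schwarz, by induction from (s + t)² ≤ 2s² + 2t²; only the
  -- existence of some constant matters.
  linearForm-bounded : ∀ {n} (v : Vec n) → ∃ λ G → 0# ≤ G × (∀ x → ⟨ v , x ⟩ * ⟨ v , x ⟩ ≤ G * ⟨ x , x ⟩)
  linearForm-bounded {zero} v = 0# , ≤-refl , λ x → ≤-reflexive refl
  linearForm-bounded {suc n} v with linearForm-bounded (v ∘ fsuc)
  ... | G , 0≤G , bound = 2v² + 2G , 0≤x+y 0≤2v² 0≤2G , λ x →
    let x₀ = x fzero ; x′ = x ∘ fsuc ; p = ⟨ v ∘ fsuc , x′ ⟩ ; X = ⟨ x′ , x′ ⟩ in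
    ≤-by (0≤part x₀ p X) (0≤x+y (0≤x+y (0≤x+y (0≤x² _) (0≤x*y 0≤2 (0≤y-x (bound x′))))
                          (0≤x*y 0≤2v² (0≤⟨x,x⟩ x′))) (0≤x*y 0≤2G (0≤x² x₀)))
      (solve 5 (λ v x p G X →
          ((1ₚ :+ 1ₚ) :* (v :* v) :+ (1ₚ :+ 1ₚ) :* G) :* (x :* x :+ X)
          := (v :* x :+ p) :* (v :* x :+ p) :+ ((v :* x :- p) :* (v :* x :- p) :+ (1ₚ :+ 1ₚ) :* (G :* X :- p :* p)
             :+ (1ₚ :+ 1ₚ) :* (v :* v) :* X :+ (1ₚ :+ 1ₚ) :* G :* (x :* x))) v₀ x₀ p G X)
    where
    v₀ = v fzero
    2v² = (1# + 1#) * (v₀ * v₀)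
    2G  = (1# + 1#) * G
    0≤2v² = 0≤x*y 0≤2 (0≤x² v₀)
    0≤2G  = 0≤x*y 0≤2 0≤G
    0≤part : ℝ → ℝ → ℝ → ℝ
    0≤part x p X = (v₀ * x - p) * (v₀ * x - p) + (1# + 1#) * (G * X - p * p) + 2v² * X + 2G * (x * x)

  PSD : ∀ {n} → Matrix n → Set
  PSD A = ∀ x → 0# ≤ qf A x

  -- Definiteness with a uniform constant. That a semidefinite form without null vector has such a
  -- constant would normally come from compactness of the unit sphere.
  Coercive : ∀ {n} → Matrix n → Set
  Coercive A = ∃ λ ε → 0# < ε × (∀ x → ε * ⟨ x , x ⟩ ≤ qf A x)

  HasNull : ∀ {n} → Matrix n → Set
  HasNull A = ∃ λ x → ¬ (x ≋ 𝟎) × qf A x ≈ 0#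

  module _ {n} {A : Matrix (suc n)} (A-sym : Symmetric A) (0<a : 0# < A fzero fzero) where
    private
      a = A fzero fzero
      i = a ⁻¹
      v = A fzero ∘ fsuc
      ai-1≈0 : a * i - 1# ≈ 0#
      ai-1≈0 = x≈y⇒x-y≈0 (x*x⁻¹≈1 0<a)

    schurComplement : Matrix n
    schurComplement = rankOneUpdate (tailBlock A) i v

    schurComplement-symmetric : Symmetric schurComplement
    schurComplement-symmetric = rankOneUpdate-symmetric (λ j k → A-sym (fsuc j) (fsuc k)) i v

    qf-completeSquare : ∀ x → let y = x fzero + i * ⟨ v , x ∘ fsuc ⟩ in
                        qf A x ≈ a * (y * y) + qf schurComplement (x ∘ fsuc)
    qf-completeSquare x = begin
      qf A x
        ≈⟨ qf-block A-sym x ⟩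
      a * (x₀ * x₀) + (1# + 1#) * (x₀ * p) + q
        ≈⟨ sym (≈-modulo ((1# + 1#) * (x₀ * p) + i * (p * p)) ai-1≈0
             (solve 5 (λ a i x p q → a :* ((x :+ i :* p) :* (x :+ i :* p)) :+ (q :- i :* (p :* p))
                := (a :* (x :* x) :+ (1ₚ :+ 1ₚ) :* (x :* p) :+ q)
                   :+ (a :* i :- 1ₚ) :* ((1ₚ :+ 1ₚ) :* (x :* p) :+ i :* (p :* p))) a i x₀ p q)) ⟩
      a * ((x₀ + i * p) * (x₀ + i * p)) + (q - i * (p * p))
        ≈⟨ +-congˡ (sym (qf-rankOneUpdate (tailBlock A) i v x′)) ⟩
      a * ((x₀ + i * p) * (x₀ + i * p)) + qf schurComplement x′ ∎
      where
      open ≈-Reasoning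
      x₀ = x fzero
      x′ = x ∘ fsuc
      p = ⟨ v , x′ ⟩
      q = qf (tailBlock A) x′

    -- The first coordinate is chosen to make the completed square vanish, so that the form takes
    -- its minimum over that coordinate.
    lift : Vec n → Vec (suc n)
    lift x fzero    = - (i * ⟨ v , x ⟩)
    lift x (fsuc j) = x j

    qf-lift : ∀ x → qf A (lift x) ≈ qf schurComplement x
    qf-lift x = trans (qf-completeSquare (lift x))
      (solve 3 (λ a p q → a :* ((:- p :+ p) :* (:- p :+ p)) :+ q := q) a (i * ⟨ v , x ⟩) _)

    -- In the coordinates y, x′ of the completed square the form is at least a y² + ε |x′|². Since
    -- x₀ = y - i p, the norm |x|² is at most 2 y² + g |x′|², and it remains to compare these two
    -- diagonal forms.
    coercive-from-schurComplement : Coercive schurComplement → Coercive A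
    coercive-from-schurComplement (ε , 0<ε , bound) with linearForm-bounded v
    ... | G , 0≤G , v-bound = a * ε * K ⁻¹ , *-pos (*-pos 0<a 0<ε) (0<x⁻¹ 0<K) , λ x →
      *-cancelˡ-≤ 0<K (coercive x)
      where
      g = (1# + 1#) * (i * i * G) + 1#
      -- Chosen so that K (a y² + ε X) exceeds a ε (2 y² + g X) by nonnegative terms.
      K = g * a + (1# + 1#) * ε
      0<i = 0<x⁻¹ 0<a
      0≤g : 0# ≤ g
      0≤g = 0≤x+y (0≤x*y 0≤2 (0≤x*y (<⇒≤ (*-pos 0<i 0<i)) 0≤G)) 0≤1
      0<K : 0# < K
      0<K = <-respʳ-≈ (+-comm _ _) (0<x+y (*-pos (0<x+y 0<1 0≤1) 0<ε) (0≤x*y 0≤g (<⇒≤ 0<a)))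
      coercive : ∀ x → K * (a * ε * K ⁻¹ * ⟨ x , x ⟩) ≤ K * qf A x
      coercive x = begin
        K * (a * ε * K ⁻¹ * (x₀ * x₀ + X))
          ≈⟨ solve 5 (λ K a ε k S → K :* (a :* ε :* k :* S) := K :* k :* (a :* ε :* S)) K a ε (K ⁻¹) (x₀ * x₀ + X) ⟩
        K * K ⁻¹ * (a * ε * (x₀ * x₀ + X))
          ≈⟨ trans (*-congʳ (x*x⁻¹≈1 0<K)) (*-identityˡ _) ⟩
        a * ε * (x₀ * x₀ + X)
          ≤⟨ *-monoˡ-≤ (<⇒≤ (*-pos 0<a 0<ε)) square-bound ⟩
        a * ε * ((1# + 1#) * (y * y) + g * X)
          ≤⟨ ≤-by ((g * a) * (a * (y * y)) + (1# + 1#) * (ε * ε * X))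
               (0≤x+y (0≤x*y (0≤x*y 0≤g (<⇒≤ 0<a)) (0≤x*y (<⇒≤ 0<a) (0≤x² y)))
                      (0≤x*y 0≤2 (0≤x*y (0≤x² ε) (0≤⟨x,x⟩ x′))))
               (solve 5 (λ g a ε Y X → (g :* a :+ (1ₚ :+ 1ₚ) :* ε) :* (a :* Y :+ ε :* X)
                   := a :* ε :* ((1ₚ :+ 1ₚ) :* Y :+ g :* X)
                      :+ ((g :* a) :* (a :* Y) :+ (1ₚ :+ 1ₚ) :* (ε :* ε :* X))) g a ε (y * y) X) ⟩
        K * (a * (y * y) + ε * X)
          ≤⟨ *-monoˡ-≤ (<⇒≤ 0<K) (+-mono-≤ ≤-refl (bound x′)) ⟩
        K * (a * (y * y) + qf schurComplement x′)
          ≈⟨ *-congˡ (sym (qf-completeSquare x)) ⟩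
        K * qf A x ∎
        where
        open ≤-Reasoning
        x₀ = x fzero
        x′ = x ∘ fsuc
        X = ⟨ x′ , x′ ⟩
        p = ⟨ v , x′ ⟩
        y = x₀ + i * p
        square-bound : x₀ * x₀ + X ≤ (1# + 1#) * (y * y) + g * X
        square-bound = ≤-by ((y + i * p) * (y + i * p) + (1# + 1#) * (i * i * (G * X - p * p)))
          (0≤x+y (0≤x² _) (0≤x*y 0≤2 (0≤x*y (0≤x² i) (0≤y-x (v-bound x′)))))
          (solve 5 (λ x i p G X → (1ₚ :+ 1ₚ) :* ((x :+ i :* p) :* (x :+ i :* p)) :+ ((1ₚ :+ 1ₚ) :* (i :* i :* G) :+ 1ₚ) :* X
              := (x :* x :+ X) :+ (((x :+ i :* p) :+ i :* p) :* ((x :+ i :* p) :+ i :* p)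
                 :+ (1ₚ :+ 1ₚ) :* (i :* i :* (G :* X :- p :* p)))) x₀ i p G X)

  -- Cholesky elimination, stopping at the first zero pivot.
  null-or-coercive : ∀ {n} {A : Matrix n} → Symmetric A → PSD A → HasNull A ⊎ Coercive A
  null-or-coercive {zero} _ _ = inj₂ (1# , 0<1 , λ x → ≤-reflexive (zeroʳ 1#))
  null-or-coercive {suc n} {A} A-sym A-psd = pivot (≤-respʳ-≈ qf-e₀ (A-psd (e fzero)))
    where
    qf-e₀ : qf A (e fzero) ≈ A fzero fzero
    qf-e₀ = trans (⟨e, A · e fzero ⟩ fzero) (·-e A fzero fzero)
    pivot : 0# ≤ A fzero fzero → HasNull A ⊎ Coercive A
    pivot (inj₂ 0≈a) = inj₁ (e fzero , e≉𝟎 , trans qf-e₀ (sym 0≈a))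
      where
      e≉𝟎 : ¬ (e {suc n} fzero ≋ 𝟎)
      e≉𝟎 e≈0 = <-irrefl (trans (sym (e≈0 fzero)) (e-diagonal {suc n} fzero)) 0<1
    pivot (inj₁ 0<a) = [ inj₁ ∘ lift-null , inj₂ ∘ coercive-from-schurComplement A-sym 0<a ]′
      (null-or-coercive (schurComplement-symmetric A-sym 0<a) psd)
      where
      psd : PSD (schurComplement A-sym 0<a)
      psd x = ≤-respʳ-≈ (qf-lift A-sym 0<a x) (A-psd (lift A-sym 0<a x))
      lift-null : HasNull (schurComplement A-sym 0<a) → HasNull A
      lift-null (x , x≉𝟎 , qx≈0) =
        lift A-sym 0<a x , (λ eq → x≉𝟎 (eq ∘ fsuc)) , trans (qf-lift A-sym 0<a x) qx≈0

-- Existence of eigenvectors.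

module Eigenvectors (ℛ : CompleteOrderedField) where
  open OrderedField ℛ
  open SpectralTheorem ℛ public
  open RealAnalysis ℛ using (fromℕ; Eigenspace)

  -- Perturb x towards y = B x: at (1 + r) x - p y with p = |y|² and r = ⟨y, B y⟩ the form equals
  -- -p² (2 + r). As it is nonnegative and r ≥ 0, p must vanish.
  psd-null⇒kernel : ∀ {n} {B : Matrix n} → Symmetric B → PSD B → ∀ {x} → qf B x ≈ 0# → B · x ≋ 𝟎
  psd-null⇒kernel {B = B} B-sym B-psd {x} qx≈0 = ⟨x,x⟩≤0⇒x≋𝟎 (≤-reflexive (x²≤0⇒x≈0 p²≤0))
    where
    y = B · x
    p = ⟨ y , y ⟩
    r = qf B y
    1+r = r + 1#
    p²≤0 : p * p ≤ 0#
    p²≤0 = ≤-by (p * p * 1+r + qf B (comb 1+r x (- p) y))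
      (0≤x+y (0≤x*y (0≤x² p) (0≤x+y (B-psd y) 0≤1)) (B-psd (comb 1+r x (- p) y))) (begin
        0#
          ≈⟨ solve 2 (λ p r → 0ₚ := p :* p :+ (p :* p :* (r :+ 1ₚ) :+ ((r :+ 1ₚ) :* (r :+ 1ₚ) :* 0ₚ
               :+ (1ₚ :+ 1ₚ) :* ((r :+ 1ₚ) :* :- p) :* p :+ :- p :* :- p :* r))) p r ⟩
        p * p + (p * p * 1+r + (1+r * 1+r * 0# + (1# + 1#) * (1+r * - p) * p + - p * - p * r))
          ≈⟨ +-congˡ (+-congˡ (+-congʳ (+-congʳ (*-congˡ (sym qx≈0))))) ⟩
        p * p + (p * p * 1+r + (1+r * 1+r * qf B x + (1# + 1#) * (1+r * - p) * p + - p * - p * r))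
          ≈⟨ +-congˡ (+-congˡ (sym (qf-comb B-sym 1+r x (- p) y))) ⟩
        p * p + (p * p * 1+r + qf B (comb 1+r x (- p) y)) ∎)
      where open ≈-Reasoning

  shift : ∀ {n} → Matrix n → ℝ → Matrix n
  shift A t i j = A i j - t * e i j

  shift-· : ∀ {n} (A : Matrix n) t x i → (shift A t · x) i ≈ (A · x) i - t * x i
  shift-· A t x i = begin
    sum (λ j → (A i j - t * e i j) * x j)
      ≈⟨ sum-cong-≋ (λ j → solve 4 (λ a t d x → (a :- t :* d) :* x := a :* x :+ :- t :* (d :* x)) (A i j) t (e i j) (x j)) ⟩
    sum (λ j → A i j * x j + - t * (e i j * x j))
      ≈⟨ ∑-distrib-+ (λ j → A i j * x j) (λ j → - t * (e i j * x j)) ⟩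
    (A · x) i + sum (λ j → - t * (e i j * x j))
      ≈⟨ +-congˡ (sym (*-distribˡ-sum (- t) (λ j → e i j * x j))) ⟩
    (A · x) i + - t * ⟨ e i , x ⟩
      ≈⟨ +-congˡ (*-congˡ (⟨e, x ⟩ i)) ⟩
    (A · x) i + - t * x i
      ≈⟨ solve 3 (λ a t x → a :+ :- t :* x := a :- t :* x) ((A · x) i) t (x i) ⟩
    (A · x) i - t * x i ∎
    where open ≈-Reasoning

  shift-symmetric : ∀ {n} {A : Matrix n} → Symmetric A → ∀ t → Symmetric (shift A t)
  shift-symmetric A-sym t i j = +-cong (A-sym i j) (-‿cong (*-congˡ (e-symmetric i j)))

  qf-shift : ∀ {n} (A : Matrix n) t x → qf (shift A t) x ≈ qf A x - t * ⟨ x , x ⟩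
  qf-shift A t x = begin
    ⟨ x , shift A t · x ⟩
      ≈⟨ sum-cong-≋ (λ i → trans (*-congˡ (shift-· A t x i))
           (solve 3 (λ x a t → x :* (a :- t :* x) := x :* a :+ :- t :* (x :* x)) (x i) ((A · x) i) t)) ⟩
    sum (λ i → x i * (A · x) i + - t * (x i * x i))
      ≈⟨ ∑-distrib-+ (λ i → x i * (A · x) i) (λ i → - t * (x i * x i)) ⟩
    qf A x + sum (λ i → - t * (x i * x i))
      ≈⟨ +-congˡ (sym (*-distribˡ-sum (- t) (λ i → x i * x i))) ⟩
    qf A x + - t * ⟨ x , x ⟩
      ≈⟨ solve 3 (λ a t x → a :+ :- t :* x := a :- t :* x) (qf A x) t ⟨ x , x ⟩ ⟩
    qf A x - t * ⟨ x , x ⟩ ∎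
    where open ≈-Reasoning

  LowerBound : ∀ {n} → Matrix n → ℝ → Set
  LowerBound A t = ∀ x → t * ⟨ x , x ⟩ ≤ qf A x

  -- Sum x_i (A x)_i ≥ -(x_i² + (A x)_i²) over i, bounding (A x)_i² by G_i |x|².
  lowerBound : ∀ {n} (A : Matrix n) → ∃ (LowerBound A)
  lowerBound A = - (1# + sum G) , λ x → ≤-by _ (sum-nonneg (0≤term x)) (expand x)
    where
    open ≈-Reasoning
    G : Vector ℝ _
    G i = proj₁ (linearForm-bounded (A i))
    term : Vector ℝ _ → Vector ℝ _
    term x i = x i * (A · x) i + (x i * x i + ⟨ x , x ⟩ * G i)
    0≤xp+x²+p² : ∀ x p → 0# ≤ x * p + (x * x + p * p)
    0≤xp+x²+p² x p = *-cancelˡ-≤ (0<x+y 0<1 0≤1) (≤-by ((x + p) * (x + p) + (x * x + p * p))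
      (0≤x+y (0≤x² _) (0≤x+y (0≤x² x) (0≤x² p)))
      (solve 2 (λ x p → (1ₚ :+ 1ₚ) :* (x :* p :+ (x :* x :+ p :* p))
                  := (1ₚ :+ 1ₚ) :* 0ₚ :+ ((x :+ p) :* (x :+ p) :+ (x :* x :+ p :* p))) x p))
    0≤term : ∀ x i → 0# ≤ term x i
    0≤term x i = ≤-trans (0≤xp+x²+p² (x i) ((A · x) i)) (+-mono-≤ ≤-refl (+-mono-≤ ≤-refl
      (≤-respʳ-≈ (*-comm _ _) (proj₂ (proj₂ (linearForm-bounded (A i))) x))))
    expand : ∀ x → qf A x ≈ - (1# + sum G) * ⟨ x , x ⟩ + sum (term x)
    expand x = sym (begin
      - (1# + sum G) * X + sum (term x)
        ≈⟨ +-congˡ (trans (∑-distrib-+ (λ i → x i * (A · x) i) (λ i → x i * x i + X * G i))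
             (+-congˡ (trans (∑-distrib-+ (λ i → x i * x i) (λ i → X * G i))
               (+-congˡ (sym (*-distribˡ-sum X G)))))) ⟩
      - (1# + sum G) * X + (qf A x + (X + X * sum G))
        ≈⟨ solve 3 (λ g X q → :- (1ₚ :+ g) :* X :+ (q :+ (X :+ X :* g)) := q) (sum G) X (qf A x) ⟩
      qf A x ∎)
      where X = ⟨ x , x ⟩

  lowerBound-≤-rayleigh : ∀ {n} {A : Matrix n} {t x} → 0# < ⟨ x , x ⟩ → t * ⟨ x , x ⟩ ≤ qf A x → t ≤ qf A x / ⟨ x , x ⟩
  lowerBound-≤-rayleigh {A = A} {t} {x} 0<X tX≤q = *-cancelˡ-≤ 0<X (≤-respˡ-≈ (*-comm t X) (≤-respʳ-≈ (sym (begin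
    X * (qf A x * X ⁻¹)   ≈⟨ solve 3 (λ X q i → X :* (q :* i) := X :* i :* q) X (qf A x) (X ⁻¹) ⟩
    X * X ⁻¹ * qf A x     ≈⟨ trans (*-congʳ (x*x⁻¹≈1 0<X)) (*-identityˡ _) ⟩
    qf A x                ∎)) tX≤q))
    where
    open ≈-Reasoning
    X = ⟨ x , x ⟩

  leastEigenvector : ∀ {n} {A : Matrix n} → Symmetric A → (∃ λ (y : Vector ℝ n) → ¬ (y ≋ 𝟎)) →
                     ∃ λ μ → LowerBound A μ × ∃ λ x → ¬ (x ≋ 𝟎) × Eigenspace A μ x
  leastEigenvector {A = A} A-sym (y , y≉𝟎) = μ , μ-lower , eigenvector
    where
    sup = complete (LowerBound A) (lowerBound A)
            (_ , λ t t-lower → lowerBound-≤-rayleigh {A = A} (x≉𝟎⇒0<⟨x,x⟩ y≉𝟎) (t-lower y))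
    μ = proj₁ sup
    -- The supremum is attained: for every x ≠ 0 the Rayleigh quotient at x is an upper bound of the
    -- set, hence at least μ.
    μ-lower : LowerBound A μ
    μ-lower x = case (0≤⟨x,x⟩ x)
      where
      open ≤-Reasoning
      X = ⟨ x , x ⟩
      case : 0# ≤ X → μ * X ≤ qf A x
      case (inj₁ 0<X) = begin
        μ * X                     ≈⟨ *-comm μ X ⟩
        X * μ                     ≤⟨ *-monoˡ-≤ (<⇒≤ 0<X)
                                       (proj₂ (proj₂ sup) (qf A x / X)
                                         (λ t t-lower → lowerBound-≤-rayleigh {A = A} 0<X (t-lower x))) ⟩
        X * (qf A x * X ⁻¹)       ≈⟨ solve 3 (λ X q i → X :* (q :* i) := X :* i :* q) X (qf A x) (X ⁻¹) ⟩
        X * X ⁻¹ * qf A x         ≈⟨ trans (*-congʳ (x*x⁻¹≈1 0<X)) (*-identityˡ _) ⟩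
        qf A x                    ∎
      case (inj₂ 0≈X) = inj₂ (trans (trans (*-congˡ (sym 0≈X)) (zeroʳ μ)) (sym (sum-zero {f = λ i → x i * (A · x) i} λ i →
        trans (*-congʳ (⟨x,x⟩≤0⇒x≋𝟎 {x = x} (≤-reflexive (sym 0≈X)) i)) (zeroˡ _))))
    B = shift A μ
    B-psd : PSD B
    B-psd x = ≤-respʳ-≈ (sym (qf-shift A μ x)) (0≤y-x (μ-lower x))
    -- With a coercivity constant ε the number μ + ε would still be a lower bound of the form.
    notCoercive : ¬ Coercive B
    notCoercive (ε , 0<ε , bound) = <⇒≱ (<-by ε 0<ε refl) (proj₁ (proj₂ sup) (μ + ε) λ x →
      ≤-by _ (0≤y-x (≤-respʳ-≈ (qf-shift A μ x) (bound x)))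
        (solve 4 (λ μ ε X q → q := (μ :+ ε) :* X :+ ((q :- μ :* X) :- ε :* X)) μ ε ⟨ x , x ⟩ (qf A x)))
    kernelVector : HasNull B → ∃ λ x → ¬ (x ≋ 𝟎) × Eigenspace A μ x
    kernelVector (x , x≉𝟎 , qx≈0) = x , x≉𝟎 , λ i → x-y≈0⇒x≈y
      (trans (sym (shift-· A μ x i)) (psd-null⇒kernel (shift-symmetric A-sym μ) B-psd qx≈0 i))
    eigenvector : ∃ λ x → ¬ (x ≋ 𝟎) × Eigenspace A μ x
    eigenvector = [ kernelVector , ⊥-elim ∘ notCoercive ]′
      (null-or-coercive (shift-symmetric A-sym μ) B-psd)

  record Projection {n} (A P : Matrix n) : Set where
    field
      symmetric  : Symmetric P
      idempotent : ∀ x → P · (P · x) ≋ P · x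
      commutes   : ∀ x → P · (A · x) ≋ A · (P · x)

  eigenvectorInRange : ∀ {n} {A P : Matrix n} → Symmetric A → Projection A P →
    (∃ λ y → P · y ≋ y × ¬ (y ≋ 𝟎)) → ∃ λ μ → ∃ λ x → ¬ (x ≋ 𝟎) × P · x ≋ x × Eigenspace A μ x
  eigenvectorInRange {n} {A} {P} A-sym proj (y , Py≋y , y≉𝟎) = μ , x , x≉𝟎 , Px≋x , Ax≋μx
    where
    open Projection proj
    t₀ = proj₁ (lowerBound A)
    Y = ⟨ y , y ⟩
    -- Makes μ - s ≤ t₀ - 1 for the least eigenvalue μ of `B`, because μ is at most the Rayleigh
    -- quotient of y. The part z of the eigenvector in the kernel of P satisfies A z = (μ - s) z,
    -- which contradicts the lower bound t₀ unless z = 0.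
    s = qf A y / Y - t₀ + 1#
    -- A + s (I − P): eigenvalues belonging to the kernel of P are moved above those on its range.
    B : Matrix n
    B i j = A i j + s * (e i j - P i j)
    B-sym : Symmetric B
    B-sym i j = +-cong (A-sym i j) (*-congˡ (+-cong (e-symmetric i j) (-‿cong (symmetric i j))))
    B-· : ∀ x i → (B · x) i ≈ (A · x) i + s * (x i - (P · x) i)
    B-· x i = begin
      sum (λ j → (A i j + s * (e i j - P i j)) * x j)
        ≈⟨ sum-cong-≋ (λ j → solve 5 (λ a s d p x → (a :+ s :* (d :- p)) :* x := a :* x :+ s :* (d :* x :+ :- 1ₚ :* (p :* x)))
             (A i j) s (e i j) (P i j) (x j)) ⟩
      sum (λ j → A i j * x j + s * (e i j * x j + - 1# * (P i j * x j)))
        ≈⟨ trans (∑-distrib-+ (λ j → A i j * x j) (λ j → s * (e i j * x j + - 1# * (P i j * x j))))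
             (+-congˡ (trans (sym (*-distribˡ-sum s (λ j → e i j * x j + - 1# * (P i j * x j))))
               (*-congˡ (trans (∑-distrib-+ (λ j → e i j * x j) (λ j → - 1# * (P i j * x j)))
                 (+-cong (⟨e, x ⟩ i) (sym (*-distribˡ-sum (- 1#) (λ j → P i j * x j)))))))) ⟩
      (A · x) i + s * (x i + - 1# * (P · x) i)
        ≈⟨ solve 4 (λ a s x p → a :+ s :* (x :+ :- 1ₚ :* p) := a :+ s :* (x :- p)) ((A · x) i) s (x i) ((P · x) i) ⟩
      (A · x) i + s * (x i - (P · x) i) ∎
      where open ≈-Reasoning
    least = leastEigenvector B-sym (y , y≉𝟎)
    μ = proj₁ least
    x = proj₁ (proj₂ (proj₂ least))
    x≉𝟎 = proj₁ (proj₂ (proj₂ (proj₂ least)))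
    Bx≋μx = proj₂ (proj₂ (proj₂ (proj₂ least)))
    μ≤rayleigh : μ ≤ qf A y / Y
    μ≤rayleigh = lowerBound-≤-rayleigh {A = A} (x≉𝟎⇒0<⟨x,x⟩ y≉𝟎) (≤-respʳ-≈ (sum-cong-≋ λ i → *-congˡ (trans (B-· y i)
        (trans (+-congˡ (trans (*-congˡ (x≈y⇒x-y≈0 (sym (Py≋y i)))) (zeroʳ s))) (+-identityʳ _))))
      (proj₁ (proj₂ least) y))
    z : Vector ℝ n
    z = comb 1# x (- 1#) (P · x)
    APx≋μPx : A · (P · x) ≋ scale μ (P · x)
    APx≋μPx i = begin
      (A · P · x) i
        ≈⟨ sym (commutes x i) ⟩
      (P · A · x) i
        ≈⟨ ·-cong P (λ j → trans (solve 4 (λ a s x p → a := 1ₚ :* (a :+ s :* (x :- p)) :+ :- s :* (1ₚ :* x :+ :- 1ₚ :* p))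
             ((A · x) j) s (x j) ((P · x) j)) (+-congʳ (*-congˡ (trans (sym (B-· x j)) (Bx≋μx j))))) i ⟩
      (P · comb 1# (scale μ x) (- s) z) i
        ≈⟨ ·-comb P 1# (scale μ x) (- s) z i ⟩
      1# * (P · scale μ x) i + - s * (P · z) i
        ≈⟨ +-cong (*-congˡ (·-scale P μ x i)) (*-congˡ (trans (·-comb P 1# x (- 1#) (P · x) i)
             (+-congˡ (*-congˡ (idempotent x i))))) ⟩
      1# * (μ * (P · x) i) + - s * (1# * (P · x) i + - 1# * (P · x) i)
        ≈⟨ solve 3 (λ μ p s → 1ₚ :* (μ :* p) :+ :- s :* (1ₚ :* p :+ :- 1ₚ :* p) := μ :* p) μ ((P · x) i) s ⟩
      μ * (P · x) i ∎
      where open ≈-Reasoning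
    Ax≈μx-sz : ∀ i → (A · x) i ≈ μ * x i - s * z i
    Ax≈μx-sz i = trans (solve 4 (λ a s x p → a := (a :+ s :* (x :- p)) :- s :* (1ₚ :* x :+ :- 1ₚ :* p))
      ((A · x) i) s (x i) ((P · x) i)) (+-congʳ (trans (sym (B-· x i)) (Bx≋μx i)))
    Az≋[μ-s]z : A · z ≋ scale (μ - s) z
    Az≋[μ-s]z i = begin
      (A · z) i
        ≈⟨ ·-comb A 1# x (- 1#) (P · x) i ⟩
      1# * (A · x) i + - 1# * (A · P · x) i
        ≈⟨ +-cong (*-congˡ (Ax≈μx-sz i)) (*-congˡ (APx≋μPx i)) ⟩
      1# * (μ * x i - s * z i) + - 1# * (μ * (P · x) i)
        ≈⟨ solve 4 (λ μ x s p → 1ₚ :* (μ :* x :- s :* (1ₚ :* x :+ :- 1ₚ :* p)) :+ :- 1ₚ :* (μ :* p)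
             := (μ :- s) :* (1ₚ :* x :+ :- 1ₚ :* p)) μ (x i) s ((P · x) i) ⟩
      (μ - s) * z i ∎
      where open ≈-Reasoning
    z≋𝟎 : z ≋ 𝟎
    z≋𝟎 = ⟨x,x⟩≤0⇒x≋𝟎 {x = z} (≤-by _
      (0≤x+y (0≤y-x (≤-respʳ-≈ (trans (⟨⟩-cong {x = z} (λ _ → refl) Az≋[μ-s]z) (⟨⟩-scaleʳ z (μ - s) z))
                       (proj₂ (lowerBound A) z)))
             (0≤x*y (0≤y-x μ≤rayleigh) (0≤⟨x,x⟩ z)))
      (solve 4 (λ μ t Z q → 0ₚ := Z :+ (((μ :- (q :- t :+ 1ₚ)) :* Z :- t :* Z) :+ (q :- μ) :* Z))
        μ t₀ ⟨ z , z ⟩ (qf A y / Y)))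
    Px≋x : P · x ≋ x
    Px≋x i = trans (solve 2 (λ x p → p := x :- (1ₚ :* x :+ :- 1ₚ :* p)) (x i) ((P · x) i))
      (trans (+-congˡ (-‿cong (z≋𝟎 i))) (solve 1 (λ x → x :- 0ₚ := x) (x i)))
    Ax≋μx : Eigenspace A μ x
    Ax≋μx i = trans (Ax≈μx-sz i) (trans (+-congˡ (-‿cong (*-congˡ (z≋𝟎 i))))
      (solve 3 (λ μ x s → μ :* x :- s :* 0ₚ := μ :* x) μ (x i) s))

-- Orthogonal eigenbases by deflation.

module EigenDecomposition (ℛ : CompleteOrderedField) where
  open OrderedField ℛ
  open Eigenvectors ℛ public
  open RealAnalysis ℛ using (fromℕ; Eigenspace)
  open import Algebra.Properties.Monoid.Sum +-monoid using (sum-replicate)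

  -- The vectors are orthogonal but not normalised, and `weight` makes up for their lengths. For P =
  -- `e` the field `resolution` is the completeness relation of a basis.
  record EigenFamily {n} (A P : Matrix n) (m : ℕ) : Set where
    field
      vec        : Fin m → Vector ℝ n
      val        : Fin m → ℝ
      nonzero    : ∀ l → ¬ (vec l ≋ 𝟎)
      eigen      : ∀ l → Eigenspace A (val l) (vec l)
      inRange    : ∀ l → P · vec l ≋ vec l
      orthogonal : ∀ l k → l ≢ k → ⟨ vec l , vec k ⟩ ≈ 0#
    weight : Fin m → ℝ
    weight l = ⟨ vec l , vec l ⟩ ⁻¹
    field
      resolution : ∀ i j → sum (λ l → weight l * (vec l i * vec l j)) ≈ P i j

  -- For a projection the trace is the rank; here it counts the eigenvectors still to be found.
  trace : ∀ {n} → Matrix n → ℝ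
  trace P = sum (λ i → P i i)

  module _ {n} {A P : Matrix n} (proj : Projection A P) where
    open Projection proj

    -- From P = PᵀP. Diagonal entries are thus squared column lengths: they are nonnegative, and a
    -- zero entry kills its column.
    diagonal≈ : ∀ i → P i i ≈ ⟨ P · e i , P · e i ⟩
    diagonal≈ i = begin
      P i i                       ≈⟨ sym (·-e P i i) ⟩
      (P · e i) i                 ≈⟨ sym (idempotent (e i) i) ⟩
      (P · P · e i) i             ≈⟨ sym (⟨e, P · P · e i ⟩ i) ⟩
      ⟨ e i , P · P · e i ⟩       ≈⟨ sym (symmetric⇒selfAdjoint symmetric (e i) (P · e i)) ⟩
      ⟨ P · e i , P · e i ⟩       ∎
      where open ≈-Reasoning

    diagonal≈0⇒column≈0 : ∀ i → P i i ≈ 0# → ∀ j → P j i ≈ 0#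
    diagonal≈0⇒column≈0 i Pii≈0 j = trans (sym (·-e P i j))
      (⟨x,x⟩≤0⇒x≋𝟎 {x = P · e i} (≤-reflexive (trans (sym (diagonal≈ i)) Pii≈0)) j)

    trace≈0⇒zero : trace P ≈ 0# → ∀ i j → P i j ≈ 0#
    trace≈0⇒zero tr≈0 i j = diagonal≈0⇒column≈0 j (≤-antisym Pjj≤0 (0≤Pii j)) i
      where
      0≤Pii : ∀ i → 0# ≤ P i i
      0≤Pii i = ≤-respʳ-≈ (sym (diagonal≈ i)) (0≤⟨x,x⟩ (P · e i))
      Pjj≤0 : P j j ≤ 0#
      Pjj≤0 = ≤-respʳ-≈ tr≈0 (term≤sum {f = λ i → P i i} 0≤Pii j)

    nonzeroRange : ∀ {m} → trace P ≈ fromℕ (suc m) → ∃ λ y → P · y ≋ y × ¬ (y ≋ 𝟎)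
    nonzeroRange {m} tr≈1+m = P · e i , idempotent (e i)
                        , λ Pe≋𝟎 → Pii≉0 (trans (sym (·-e P i i)) (Pe≋𝟎 i))
      where
      nonzeroDiagonal : ∃ λ i → ¬ (P i i ≈ 0#)
      nonzeroDiagonal = Fin.¬∀⟶∃¬ n (λ i → P i i ≈ 0#) (λ i → P i i ≟ 0#)
        (λ diag≈0 → 0<⇒≉0 (0<fromℕ-suc m) (trans (sym tr≈1+m) (sum-zero {f = λ i → P i i} diag≈0)))
      i = proj₁ nonzeroDiagonal
      Pii≉0 = proj₂ nonzeroDiagonal

    -- `P′` is P minus the orthogonal projection onto the line of x. It still commutes with A
    -- because x is an eigenvector, and it kills x, which makes every vector found later in its
    -- range orthogonal to x.
    module Deflation (A-sym : Symmetric A) {μ x} (x≉𝟎 : ¬ (x ≋ 𝟎)) (Px≋x : P · x ≋ x) (Ax≋μx : Eigenspace A μ x) where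
      X = ⟨ x , x ⟩
      r = X ⁻¹
      Xr≈1 : X * r ≈ 1#
      Xr≈1 = x*x⁻¹≈1 (x≉𝟎⇒0<⟨x,x⟩ x≉𝟎)

      P′ : Matrix n
      P′ = rankOneUpdate P r x

      P′-sym : Symmetric P′
      P′-sym = rankOneUpdate-symmetric symmetric r x

      P′-· : ∀ y → P′ · y ≋ comb 1# (P · y) (- (r * ⟨ x , y ⟩)) x
      P′-· y i = trans (rankOneUpdate-· P r x y i)
        (solve 4 (λ p r x q → p :- r :* (x :* q) := 1ₚ :* p :+ :- (r :* q) :* x) ((P · y) i) r (x i) ⟨ x , y ⟩)

      P′x≋𝟎 : P′ · x ≋ 𝟎
      P′x≋𝟎 i = begin
        (P′ · x) i                              ≈⟨ P′-· x i ⟩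
        1# * (P · x) i + - (r * X) * x i        ≈⟨ +-cong (*-congˡ (Px≋x i)) (*-congʳ (-‿cong (trans (*-comm r X) Xr≈1))) ⟩
        1# * x i + - 1# * x i                   ≈⟨ solve 1 (λ x → 1ₚ :* x :+ :- 1ₚ :* x := 0ₚ) (x i) ⟩
        0#                                      ∎
        where open ≈-Reasoning

      P′P≋P′ : ∀ y → P′ · (P · y) ≋ P′ · y
      P′P≋P′ y i = begin
        (P′ · P · y) i
          ≈⟨ P′-· (P · y) i ⟩
        1# * (P · P · y) i + - (r * ⟨ x , P · y ⟩) * x i
          ≈⟨ +-cong (*-congˡ (idempotent y i)) (*-congʳ (-‿cong (*-congˡ
               (trans (sym (symmetric⇒selfAdjoint symmetric x y)) (⟨⟩-cong {y = y} Px≋x (λ _ → refl)))))) ⟩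
        1# * (P · y) i + - (r * ⟨ x , y ⟩) * x i
          ≈⟨ sym (P′-· y i) ⟩
        (P′ · y) i ∎
        where open ≈-Reasoning

      P′-idempotent : ∀ y → P′ · (P′ · y) ≋ P′ · y
      P′-idempotent y i = begin
        (P′ · P′ · y) i
          ≈⟨ ·-cong P′ (P′-· y) i ⟩
        (P′ · comb 1# (P · y) s x) i
          ≈⟨ ·-comb P′ 1# (P · y) s x i ⟩
        1# * (P′ · P · y) i + s * (P′ · x) i
          ≈⟨ +-cong (*-congˡ (P′P≋P′ y i)) (*-congˡ (P′x≋𝟎 i)) ⟩
        1# * (P′ · y) i + s * 0#
          ≈⟨ solve 2 (λ p s → 1ₚ :* p :+ s :* 0ₚ := p) ((P′ · y) i) s ⟩
        (P′ · y) i ∎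
        where
        open ≈-Reasoning
        s = - (r * ⟨ x , y ⟩)

      P′-commutes : ∀ y → P′ · (A · y) ≋ A · (P′ · y)
      P′-commutes y i = begin
        (P′ · A · y) i
          ≈⟨ P′-· (A · y) i ⟩
        1# * (P · A · y) i + - (r * ⟨ x , A · y ⟩) * x i
          ≈⟨ +-cong (*-congˡ (commutes y i)) (*-congʳ (-‿cong (*-congˡ xAy≈μxy))) ⟩
        1# * (A · P · y) i + - (r * (μ * ⟨ x , y ⟩)) * x i
          ≈⟨ solve 5 (λ a r μ p x → 1ₚ :* a :+ :- (r :* (μ :* p)) :* x := 1ₚ :* a :+ :- (r :* p) :* (μ :* x))
               ((A · P · y) i) r μ ⟨ x , y ⟩ (x i) ⟩
        1# * (A · P · y) i + - (r * ⟨ x , y ⟩) * (μ * x i)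
          ≈⟨ +-congˡ (*-congˡ (sym (Ax≋μx i))) ⟩
        1# * (A · P · y) i + - (r * ⟨ x , y ⟩) * (A · x) i
          ≈⟨ sym (·-comb A 1# (P · y) (- (r * ⟨ x , y ⟩)) x i) ⟩
        (A · comb 1# (P · y) (- (r * ⟨ x , y ⟩)) x) i
          ≈⟨ ·-cong A (λ j → sym (P′-· y j)) i ⟩
        (A · P′ · y) i ∎
        where
        open ≈-Reasoning
        xAy≈μxy : ⟨ x , A · y ⟩ ≈ μ * ⟨ x , y ⟩
        xAy≈μxy = trans (sym (symmetric⇒selfAdjoint A-sym x y))
          (trans (⟨⟩-cong {y = y} Ax≋μx (λ _ → refl)) (⟨⟩-scaleˡ μ x y))

      P′-projection : Projection A P′
      P′-projection = record { symmetric = P′-sym ; idempotent = P′-idempotent ; commutes = P′-commutes }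

      P′-trace : ∀ {m} → trace P ≈ fromℕ (suc m) → trace P′ ≈ fromℕ m
      P′-trace {m} tr≈1+m = begin
        sum (λ i → P i i - r * (x i * x i))
          ≈⟨ sum-cong-≋ (λ i → solve 3 (λ p r x → p :- r :* x := p :+ :- r :* x) (P i i) r (x i * x i)) ⟩
        sum (λ i → P i i + - r * (x i * x i))
          ≈⟨ trans (∑-distrib-+ (λ i → P i i) (λ i → - r * (x i * x i)))
                   (+-congˡ (sym (*-distribˡ-sum (- r) (λ i → x i * x i)))) ⟩
        trace P + - r * X
          ≈⟨ +-cong tr≈1+m (trans (solve 2 (λ r X → :- r :* X := :- (X :* r)) r X) (-‿cong Xr≈1)) ⟩
        (1# + fromℕ m) + - 1#
          ≈⟨ solve 1 (λ m → (1ₚ :+ m) :+ :- 1ₚ := m) (fromℕ m) ⟩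
        fromℕ m ∎
        where open ≈-Reasoning

      extend : ∀ {m} → EigenFamily A P′ m → EigenFamily A P (suc m)
      extend {m} family = record
        { vec = vec⁺ ; val = val⁺
        ; nonzero = λ { fzero → x≉𝟎 ; (fsuc l) → nonzero l }
        ; eigen = λ { fzero → Ax≋μx ; (fsuc l) → eigen l }
        ; inRange = λ { fzero → Px≋x ; (fsuc l) → inRange⁺ l }
        ; orthogonal = orthogonal⁺
        ; resolution = λ i j → trans (+-congˡ (resolution i j))
            (solve 2 (λ p q → q :+ (p :- q) := p) (P i j) (r * (x i * x j)))
        }
        where
        open EigenFamily family
        open ≈-Reasoning
        vec⁺ : Fin (suc m) → Vector ℝ n
        vec⁺ fzero    = x
        vec⁺ (fsuc l) = vec l
        val⁺ : Fin (suc m) → ℝ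
        val⁺ fzero    = μ
        val⁺ (fsuc l) = val l
        x⊥vec : ∀ l → ⟨ x , vec l ⟩ ≈ 0#
        x⊥vec l = begin
          ⟨ x , vec l ⟩          ≈⟨ ⟨⟩-cong {x = x} (λ _ → refl) (λ i → sym (inRange l i)) ⟩
          ⟨ x , P′ · vec l ⟩     ≈⟨ sym (symmetric⇒selfAdjoint P′-sym x (vec l)) ⟩
          ⟨ P′ · x , vec l ⟩     ≈⟨ sum-zero {f = λ i → (P′ · x) i * vec l i} (λ i → trans (*-congʳ (P′x≋𝟎 i)) (zeroˡ _)) ⟩
          0#                     ∎
        inRange⁺ : ∀ l → P · vec l ≋ vec l
        inRange⁺ l i = begin
          (P · vec l) i
            ≈⟨ solve 3 (λ p r x → p := 1ₚ :* p :+ :- (r :* 0ₚ) :* x) ((P · vec l) i) r (x i) ⟩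
          1# * (P · vec l) i + - (r * 0#) * x i
            ≈⟨ +-congˡ (*-congʳ (-‿cong (*-congˡ (sym (x⊥vec l))))) ⟩
          1# * (P · vec l) i + - (r * ⟨ x , vec l ⟩) * x i
            ≈⟨ sym (P′-· (vec l) i) ⟩
          (P′ · vec l) i
            ≈⟨ inRange l i ⟩
          vec l i ∎
        orthogonal⁺ : ∀ l k → l ≢ k → ⟨ vec⁺ l , vec⁺ k ⟩ ≈ 0#
        orthogonal⁺ fzero fzero l≢k = ⊥-elim (l≢k ≡.refl)
        orthogonal⁺ fzero (fsuc k) _ = x⊥vec k
        orthogonal⁺ (fsuc l) fzero _ = trans (⟨⟩-comm (vec l) x) (x⊥vec l)
        orthogonal⁺ (fsuc l) (fsuc k) l≢k = orthogonal l k (l≢k ∘ ≡.cong fsuc)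

  -- Each eigenvector found in the range of P lowers the trace of P by one.
  eigenFamily : ∀ {n} {A : Matrix n} → Symmetric A → ∀ m {P} → Projection A P →
                trace P ≈ fromℕ m → EigenFamily A P m
  eigenFamily A-sym zero proj tr≈0 = record
    { vec = λ () ; val = λ () ; nonzero = λ () ; eigen = λ () ; inRange = λ () ; orthogonal = λ ()
    ; resolution = λ i j → sym (trace≈0⇒zero proj tr≈0 i j) }
  eigenFamily {A = A} A-sym (suc m) {P} proj tr≈1+m =
    build (eigenvectorInRange A-sym proj (nonzeroRange proj {m} tr≈1+m))
    where
    build : (∃ λ μ → ∃ λ x → ¬ (x ≋ 𝟎) × P · x ≋ x × Eigenspace A μ x) → EigenFamily A P (suc m)
    build (μ , x , x≉𝟎 , Px≋x , Ax≋μx) = extend (eigenFamily A-sym m P′-projection (P′-trace {m} tr≈1+m))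
      where open Deflation proj A-sym x≉𝟎 Px≋x Ax≋μx

  eigenDecomposition : ∀ {n} {A : Matrix n} → Symmetric A → EigenFamily A e n
  eigenDecomposition {n} {A} A-sym = eigenFamily A-sym n
    (record { symmetric = e-symmetric ; idempotent = λ x → e-· (e · x)
            ; commutes = λ x i → trans (e-· (A · x) i) (·-cong A (λ j → sym (e-· x j)) i) })
    (trans (sum-cong-≋ (e-diagonal {n})) (sum-replicate n))

-- Functions of a matrix in an eigenbasis, and eigenvalue supports.

module SpectralCalculus (ℛ : CompleteOrderedField) where
  open OrderedField ℛ
  open EigenDecomposition ℛ public
  open RealAnalysis ℛ using (Eigenspace; supp; IsOrthogonalProjection)

  indicator : ∀ {P : Set} → Dec P → ℝ
  indicator (yes _) = 1#
  indicator (no _)  = 0#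

  module Calculus {n} {A : Matrix n} (family : EigenFamily A e n) where
    open EigenFamily family

    weight*norm≈1 : ∀ l → weight l * ⟨ vec l , vec l ⟩ ≈ 1#
    weight*norm≈1 l = trans (*-comm _ _) (x*x⁻¹≈1 (x≉𝟎⇒0<⟨x,x⟩ (nonzero l)))

    fromCoordinates : Vector ℝ n → Vector ℝ n
    fromCoordinates d i = sum (λ l → d l * vec l i)

    ⟨vec,fromCoordinates⟩ : ∀ d l → ⟨ vec l , fromCoordinates d ⟩ ≈ d l * ⟨ vec l , vec l ⟩
    ⟨vec,fromCoordinates⟩ d l = begin
      ⟨ vec l , fromCoordinates d ⟩
        ≈⟨ ⟨⟩-sumʳ (vec l) (λ k → scale (d k) (vec k)) ⟩
      sum (λ k → ⟨ vec l , scale (d k) (vec k) ⟩)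
        ≈⟨ sum-cong-≋ (λ k → ⟨⟩-scaleʳ (vec l) (d k) (vec k)) ⟩
      sum (λ k → d k * ⟨ vec l , vec k ⟩)
        ≈⟨ sum-single {f = λ k → d k * ⟨ vec l , vec k ⟩} l
             (λ k k≢l → trans (*-congˡ (orthogonal l k (k≢l ∘ ≡.sym))) (zeroʳ (d k))) ⟩
      d l * ⟨ vec l , vec l ⟩ ∎
      where open ≈-Reasoning

    ·-fromCoordinates : ∀ (Q : Matrix n) d i → (Q · fromCoordinates d) i ≈ sum (λ l → d l * (Q · vec l) i)
    ·-fromCoordinates Q d i = trans (⟨⟩-sumʳ (Q i) (λ l → scale (d l) (vec l)))
      (sum-cong-≋ (λ l → ⟨⟩-scaleʳ (Q i) (d l) (vec l)))

    -- The matrix that multiplies `vec l` by c l. The values are attached to indices rather than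
    -- eigenvalues, so they may differ within one eigenspace.
    withEigenvalues : Vector ℝ n → Matrix n
    withEigenvalues c i j = sum (λ l → c l * (weight l * (vec l i * vec l j)))

    coordinates : Vector ℝ n → Vector ℝ n
    coordinates y l = weight l * ⟨ vec l , y ⟩

    withEigenvalues-· : ∀ c y → withEigenvalues c · y ≋ fromCoordinates (λ l → c l * coordinates y l)
    withEigenvalues-· c y i = begin
      sum (λ j → sum (λ l → c l * (weight l * (vec l i * vec l j))) * y j)
        ≈⟨ sum-cong-≋ (λ j → trans (*-distribʳ-sum (y j) (λ l → c l * (weight l * (vec l i * vec l j))))
             (sum-cong-≋ (λ l → solve 5 (λ c w v u y → c :* (w :* (v :* u)) :* y := c :* w :* v :* (u :* y))
                (c l) (weight l) (vec l i) (vec l j) (y j)))) ⟩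
      sum (λ j → sum (λ l → c l * weight l * vec l i * (vec l j * y j)))
        ≈⟨ ∑-comm (λ j l → c l * weight l * vec l i * (vec l j * y j)) ⟩
      sum (λ l → sum (λ j → c l * weight l * vec l i * (vec l j * y j)))
        ≈⟨ sum-cong-≋ (λ l → trans (sym (*-distribˡ-sum (c l * weight l * vec l i) (λ j → vec l j * y j)))
             (solve 4 (λ c w v p → c :* w :* v :* p := c :* (w :* p) :* v) (c l) (weight l) (vec l i) ⟨ vec l , y ⟩)) ⟩
      fromCoordinates (λ l → c l * coordinates y l) i ∎
      where open ≈-Reasoning

    expansion : ∀ y → y ≋ fromCoordinates (coordinates y)
    expansion y i = begin
      y i
        ≈⟨ sym (e-· y i) ⟩
      (e · y) i
        ≈⟨ sum-cong-≋ (λ j → *-congʳ (trans (sym (resolution i j)) (sum-cong-≋ (λ l → sym (*-identityˡ (weight l * (vec l i * vec l j))))))) ⟩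
      (withEigenvalues (λ _ → 1#) · y) i
        ≈⟨ withEigenvalues-· (λ _ → 1#) y i ⟩
      fromCoordinates (λ l → 1# * coordinates y l) i
        ≈⟨ sum-cong-≋ (λ l → *-congʳ (*-identityˡ (coordinates y l))) ⟩
      fromCoordinates (coordinates y) i ∎
      where open ≈-Reasoning

    parseval : ∀ y z → ⟨ y , z ⟩ ≈ sum (λ l → coordinates y l * ⟨ vec l , z ⟩)
    parseval y z = begin
      ⟨ y , z ⟩
        ≈⟨ trans (⟨⟩-comm y z) (⟨⟩-cong {x = z} (λ _ → refl) (expansion y)) ⟩
      ⟨ z , fromCoordinates (coordinates y) ⟩
        ≈⟨ ⟨⟩-sumʳ z (λ l → scale (coordinates y l) (vec l)) ⟩
      sum (λ l → ⟨ z , scale (coordinates y l) (vec l) ⟩)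
        ≈⟨ sum-cong-≋ (λ l → trans (⟨⟩-scaleʳ z (coordinates y l) (vec l)) (*-congˡ (⟨⟩-comm z (vec l)))) ⟩
      sum (λ l → coordinates y l * ⟨ vec l , z ⟩) ∎
      where open ≈-Reasoning

    ⟨vec,withEigenvalues⟩ : ∀ c y l → ⟨ vec l , withEigenvalues c · y ⟩ ≈ c l * ⟨ vec l , y ⟩
    ⟨vec,withEigenvalues⟩ c y l = begin
      ⟨ vec l , withEigenvalues c · y ⟩
        ≈⟨ ⟨⟩-cong {x = vec l} (λ _ → refl) (withEigenvalues-· c y) ⟩
      ⟨ vec l , fromCoordinates (λ l → c l * coordinates y l) ⟩
        ≈⟨ ⟨vec,fromCoordinates⟩ (λ l → c l * coordinates y l) l ⟩
      c l * (weight l * ⟨ vec l , y ⟩) * ⟨ vec l , vec l ⟩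
        ≈⟨ solve 4 (λ c w p N → c :* (w :* p) :* N := c :* ((w :* N) :* p)) (c l) (weight l) ⟨ vec l , y ⟩ _ ⟩
      c l * ((weight l * ⟨ vec l , vec l ⟩) * ⟨ vec l , y ⟩)
        ≈⟨ *-congˡ (trans (*-congʳ (weight*norm≈1 l)) (*-identityˡ _)) ⟩
      c l * ⟨ vec l , y ⟩ ∎
      where open ≈-Reasoning

    ⟨vec,e⟩ : ∀ l a → ⟨ vec l , e a ⟩ ≈ vec l a
    ⟨vec,e⟩ l a = trans (⟨⟩-comm (vec l) (e a)) (⟨e, vec l ⟩ a)

    -- Stated for any self-adjoint `Q` with eigenvectors `vec l`, in order to apply both to H, where
    -- integrality is assumed, and to the power of K whose support defines the gcd.
    module Support {Q : Matrix n} (Q-adj : SelfAdjoint Q) (ν : Fin n → ℝ)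
                   (Q-eigen : ∀ l → Eigenspace Q (ν l) (vec l)) (a : Fin n) where

      eigenvalue-pairing : ∀ {η w} → Eigenspace Q η w → ∀ l → ν l * ⟨ vec l , w ⟩ ≈ η * ⟨ vec l , w ⟩
      eigenvalue-pairing {η} {w} Qw≋ηw l = begin
        ν l * ⟨ vec l , w ⟩        ≈⟨ sym (⟨⟩-scaleˡ (ν l) (vec l) w) ⟩
        ⟨ scale (ν l) (vec l) , w ⟩ ≈⟨ ⟨⟩-cong {y = w} (λ i → sym (Q-eigen l i)) (λ _ → refl) ⟩
        ⟨ Q · vec l , w ⟩          ≈⟨ Q-adj (vec l) w ⟩
        ⟨ vec l , Q · w ⟩          ≈⟨ ⟨⟩-cong {x = vec l} (λ _ → refl) Qw≋ηw ⟩
        ⟨ vec l , scale η w ⟩      ≈⟨ ⟨⟩-scaleʳ (vec l) η w ⟩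
        η * ⟨ vec l , w ⟩          ∎
        where open ≈-Reasoning

      -- With y = E e_a, expanding ⟨e_a, y⟩ = |y|² ≠ 0 in the basis yields an l for which both
      -- x_l(a) and ⟨x_l, y⟩ are nonzero. The first makes l an index of the support; the second
      -- forces η = ν_l, eigenvectors for different eigenvalues being orthogonal.
      supp⇒index : ∀ {η} → supp Q (e a) η → ∃ λ l → ¬ (vec l a ≈ 0#) × η ≈ ν l
      supp⇒index {η} (_ , E , E-proj , Ee≉𝟎) = l , vec≉0 , sym (*-cancelˡ pairing≉0
          (trans (*-comm _ _) (trans (eigenvalue-pairing (proj₁ (E-proj (e a))) l) (*-comm _ _))))
        where
        open ≈-Reasoning
        y = E · e a
        term : Fin n → ℝ
        term l = coordinates (e a) l * ⟨ vec l , y ⟩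
        sum≈⟨y,y⟩ : sum term ≈ ⟨ y , y ⟩
        sum≈⟨y,y⟩ = begin
          sum term          ≈⟨ sym (parseval (e a) y) ⟩
          ⟨ e a , y ⟩       ≈⟨ solve 2 (λ p q → p := (1ₚ :* p :+ :- 1ₚ :* q) :+ q) ⟨ e a , y ⟩ ⟨ y , y ⟩ ⟩
          (1# * ⟨ e a , y ⟩ + - 1# * ⟨ y , y ⟩) + ⟨ y , y ⟩
            ≈⟨ +-congʳ (sym (⟨⟩-combˡ 1# (e a) (- 1#) y y)) ⟩
          ⟨ comb 1# (e a) (- 1#) y , y ⟩ + ⟨ y , y ⟩
            ≈⟨ +-congʳ (⟨⟩-cong {y = y} (λ i → solve 2 (λ p q → 1ₚ :* p :+ :- 1ₚ :* q := p :- q) (e a i) (y i)) (λ _ → refl)) ⟩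
          ⟨ (λ v → e a v - y v) , y ⟩ + ⟨ y , y ⟩
            ≈⟨ +-congʳ (proj₂ (E-proj (e a)) y (proj₁ (E-proj (e a)))) ⟩
          0# + ⟨ y , y ⟩    ≈⟨ +-identityˡ _ ⟩
          ⟨ y , y ⟩         ∎
        nonzeroTerm : ∃ λ l → ¬ (term l ≈ 0#)
        nonzeroTerm = Fin.¬∀⟶∃¬ n (λ l → term l ≈ 0#) (λ l → term l ≟ 0#)
          (λ term≈0 → 0<⇒≉0 (x≉𝟎⇒0<⟨x,x⟩ Ee≉𝟎) (trans (sym sum≈⟨y,y⟩) (sum-zero {f = term} term≈0)))
        l = proj₁ nonzeroTerm
        vec≉0 : ¬ (vec l a ≈ 0#)
        vec≉0 v≈0 = proj₂ nonzeroTerm (trans (*-congʳ (trans (*-congˡ (trans (⟨vec,e⟩ l a) v≈0)) (zeroʳ _))) (zeroˡ _))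
        pairing≉0 : ¬ (⟨ vec l , y ⟩ ≈ 0#)
        pairing≉0 p≈0 = proj₂ nonzeroTerm (trans (*-congˡ p≈0) (zeroʳ _))

      -- The spectral projection collects all indices k with ν_k = ν_l, not only l. For the other k
      -- the pairing ⟨x_k, w⟩ with a vector w of the eigenspace vanishes, which gives orthogonality
      -- of the residual.
      index⇒supp : ∀ l → ¬ (vec l a ≈ 0#) → supp Q (e a) (ν l)
      index⇒supp l vec≉0 = (vec l , nonzero l , Q-eigen l) , E , E-proj , E-nonzero
        where
        open ≈-Reasoning
        χ : Fin n → ℝ
        χ k = indicator (ν k ≟ ν l)
        χν : ∀ k → χ k * ν k ≈ χ k * ν l
        χν k = go (ν k ≟ ν l)
          where
          go : (d : Dec (ν k ≈ ν l)) → indicator d * ν k ≈ indicator d * ν l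
          go (yes eq) = *-congˡ eq
          go (no _)   = trans (zeroˡ _) (sym (zeroˡ _))
        E = withEigenvalues χ
        E-eigen : ∀ y → Eigenspace Q (ν l) (E · y)
        E-eigen y i = begin
          (Q · (E · y)) i
            ≈⟨ ·-cong Q (withEigenvalues-· χ y) i ⟩
          (Q · fromCoordinates (λ k → χ k * coordinates y k)) i
            ≈⟨ ·-fromCoordinates Q (λ k → χ k * coordinates y k) i ⟩
          sum (λ k → χ k * coordinates y k * (Q · vec k) i)
            ≈⟨ sum-cong-≋ (λ k → trans (*-congˡ (Q-eigen k i)) (trans
                 (solve 4 (λ χ c ν v → χ :* c :* (ν :* v) := (χ :* ν) :* (c :* v)) (χ k) (coordinates y k) (ν k) (vec k i))
                 (trans (*-congʳ (χν k))
                 (solve 4 (λ χ c ν v → (χ :* ν) :* (c :* v) := ν :* (χ :* c :* v)) (χ k) (coordinates y k) (ν l) (vec k i))))) ⟩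
          sum (λ k → ν l * (χ k * coordinates y k * vec k i))
            ≈⟨ sym (*-distribˡ-sum (ν l) (λ k → χ k * coordinates y k * vec k i)) ⟩
          ν l * fromCoordinates (λ k → χ k * coordinates y k) i
            ≈⟨ *-congˡ (sym (withEigenvalues-· χ y i)) ⟩
          ν l * (E · y) i ∎
        E-residual : ∀ y w → Eigenspace Q (ν l) w → ⟨ (λ v → y v - (E · y) v) , w ⟩ ≈ 0#
        E-residual y w Qw≋ = begin
          ⟨ (λ v → y v - (E · y) v) , w ⟩
            ≈⟨ ⟨⟩-cong {y = w} (λ i → solve 2 (λ p q → p :- q := 1ₚ :* p :+ :- 1ₚ :* q) (y i) ((E · y) i)) (λ _ → refl) ⟩
          ⟨ residual , w ⟩
            ≈⟨ parseval residual w ⟩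
          sum (λ k → weight k * ⟨ vec k , residual ⟩ * ⟨ vec k , w ⟩)
            ≈⟨ sum-zero {f = λ k → weight k * ⟨ vec k , residual ⟩ * ⟨ vec k , w ⟩} (λ k → trans (*-congʳ (*-congˡ (trans
                 (⟨⟩-combʳ (vec k) 1# y (- 1#) (E · y)) (+-congˡ (*-congˡ (⟨vec,withEigenvalues⟩ χ y k))))))
                 (go k (ν k ≟ ν l))) ⟩
          0# ∎
          where
          residual = comb 1# y (- 1#) (E · y)
          go : ∀ k (d : Dec (ν k ≈ ν l)) →
               weight k * (1# * ⟨ vec k , y ⟩ + - 1# * (indicator d * ⟨ vec k , y ⟩)) * ⟨ vec k , w ⟩ ≈ 0#
          go k (yes _) = solve 3 (λ w p q → w :* (1ₚ :* p :+ :- 1ₚ :* (1ₚ :* p)) :* q := 0ₚ) (weight k) _ _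
          go k (no ν≉) = trans (*-congˡ (*-cancelˡ-0 (ν≉ ∘ x-y≈0⇒x≈y) (trans
            (solve 3 (λ a b p → (a :- b) :* p := a :* p :- b :* p) (ν k) (ν l) ⟨ vec k , w ⟩)
            (x≈y⇒x-y≈0 (eigenvalue-pairing Qw≋ k))))) (zeroʳ _)
        E-proj : IsOrthogonalProjection (Eigenspace Q (ν l)) E
        E-proj y = E-eigen y , E-residual y
        χl≈1 : χ l ≈ 1#
        χl≈1 = go (ν l ≟ ν l)
          where
          go : (d : Dec (ν l ≈ ν l)) → indicator d ≈ 1#
          go (yes _) = refl
          go (no ν≉) = ⊥-elim (ν≉ refl)
        E-nonzero : ¬ (E · e a ≋ 𝟎)
        E-nonzero Ee≋𝟎 = vec≉0 (begin
          vec l a                     ≈⟨ sym (trans (*-congʳ χl≈1) (trans (*-identityˡ _) (⟨vec,e⟩ l a))) ⟩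
          χ l * ⟨ vec l , e a ⟩       ≈⟨ sym (⟨vec,withEigenvalues⟩ χ (e a) l) ⟩
          ⟨ vec l , E · e a ⟩         ≈⟨ sum-zero {f = λ i → vec l i * (E · e a) i} (λ i → trans (*-congˡ (Ee≋𝟎 i)) (zeroʳ _)) ⟩
          0#                          ∎)

-- Absolute values and limits of sequences.

module Limits (em : ExcludedMiddle 0ℓ) (ℛ : CompleteOrderedField) where
  open OrderedField ℛ
  open RealAnalysis ℛ using (∣_∣; _⟶_)
  open LinearAlgebra ℝ-ring using (sum)

  ∣∣-elim : ∀ {x} (P : ℝ → Set) → P x → P (- x) → P ∣ x ∣
  ∣∣-elim {x} P px p-x with compare 0# x
  ... | tri< _ _ _ = px
  ... | tri≈ _ _ _ = px
  ... | tri> _ _ _ = p-x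

  0≤x⇒∣x∣≈x : ∀ {x} → 0# ≤ x → ∣ x ∣ ≈ x
  0≤x⇒∣x∣≈x {x} 0≤x with compare 0# x
  ... | tri< _ _ _ = refl
  ... | tri≈ _ _ _ = refl
  ... | tri> _ _ x<0 = ⊥-elim (<⇒≱ x<0 0≤x)

  x≤0⇒∣x∣≈-x : ∀ {x} → x ≤ 0# → ∣ x ∣ ≈ - x
  x≤0⇒∣x∣≈-x {x} x≤0 with compare 0# x
  ... | tri< 0<x _ _ = ⊥-elim (<⇒≱ 0<x x≤0)
  ... | tri≈ _ 0≈x _ = trans (sym 0≈x) (trans (solve 0 (0ₚ := :- 0ₚ)) (-‿cong 0≈x))
  ... | tri> _ _ _ = refl

  x≤∣x∣ : ∀ x → x ≤ ∣ x ∣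
  x≤∣x∣ x with ≤-total 0# x
  ... | inj₁ 0≤x = inj₂ (sym (0≤x⇒∣x∣≈x 0≤x))
  ... | inj₂ x≤0 = ≤-respʳ-≈ (sym (x≤0⇒∣x∣≈-x x≤0)) (≤-trans x≤0 (x≤0⇒0≤-x x≤0))

  -x≤∣x∣ : ∀ x → - x ≤ ∣ x ∣
  -x≤∣x∣ x with ≤-total 0# x
  ... | inj₂ x≤0 = inj₂ (sym (x≤0⇒∣x∣≈-x x≤0))
  ... | inj₁ 0≤x = ≤-respʳ-≈ (sym (0≤x⇒∣x∣≈x 0≤x))
    (≤-by (x + x) (0≤x+y 0≤x 0≤x) (solve 1 (λ x → x := :- x :+ (x :+ x)) x))

  0≤∣x∣ : ∀ x → 0# ≤ ∣ x ∣
  0≤∣x∣ x with ≤-total 0# x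
  ... | inj₁ 0≤x = ≤-trans 0≤x (x≤∣x∣ x)
  ... | inj₂ x≤0 = ≤-trans (x≤0⇒0≤-x x≤0) (-x≤∣x∣ x)

  ∣∣-cong : ∀ {x y} → x ≈ y → ∣ x ∣ ≈ ∣ y ∣
  ∣∣-cong {x} {y} x≈y = ≤-antisym
    (∣∣-elim (_≤ ∣ y ∣) (≤-respˡ-≈ (sym x≈y) (x≤∣x∣ y)) (≤-respˡ-≈ (-‿cong (sym x≈y)) (-x≤∣x∣ y)))
    (∣∣-elim (_≤ ∣ x ∣) (≤-respˡ-≈ x≈y (x≤∣x∣ x)) (≤-respˡ-≈ (-‿cong x≈y) (-x≤∣x∣ x)))

  ∣∣-neg : ∀ x → ∣ - x ∣ ≤ ∣ x ∣
  ∣∣-neg x = ∣∣-elim (_≤ ∣ x ∣) (-x≤∣x∣ x) (≤-respˡ-≈ (solve 1 (λ x → x := :- :- x) x) (x≤∣x∣ x))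

  ∣∣-triangle : ∀ x y → ∣ x + y ∣ ≤ ∣ x ∣ + ∣ y ∣
  ∣∣-triangle x y = ∣∣-elim (_≤ ∣ x ∣ + ∣ y ∣) (+-mono-≤ (x≤∣x∣ x) (x≤∣x∣ y))
    (≤-respˡ-≈ (solve 2 (λ x y → :- x :+ :- y := :- (x :+ y)) x y) (+-mono-≤ (-x≤∣x∣ x) (-x≤∣x∣ y)))

  ∣∣-*-≤ : ∀ x y → ∣ x * y ∣ ≤ ∣ x ∣ * ∣ y ∣
  ∣∣-*-≤ x y = ∣∣-elim (_≤ ∣ x ∣ * ∣ y ∣) (*≤ x (x≤∣x∣ x) (-x≤∣x∣ x))
    (≤-respˡ-≈ (solve 2 (λ x y → :- x :* y := :- (x :* y)) x y)
       (*≤ (- x) (-x≤∣x∣ x) (≤-respˡ-≈ (solve 1 (λ x → x := :- :- x) x) (x≤∣x∣ x))))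
    where
    *≤ : ∀ z → z ≤ ∣ x ∣ → - z ≤ ∣ x ∣ → z * y ≤ ∣ x ∣ * ∣ y ∣
    *≤ z z≤ -z≤ with ≤-total 0# y
    ... | inj₁ 0≤y = ≤-respʳ-≈ (*-congˡ (sym (0≤x⇒∣x∣≈x 0≤y)))
      (≤-by _ (0≤x*y (0≤y-x z≤) 0≤y) (solve 3 (λ a z y → a :* y := z :* y :+ (a :- z) :* y) ∣ x ∣ z y))
    ... | inj₂ y≤0 = ≤-respʳ-≈ (*-congˡ (sym (x≤0⇒∣x∣≈-x y≤0)))
      (≤-by _ (0≤x*y (0≤y-x -z≤) (x≤0⇒0≤-x y≤0)) (solve 3 (λ a z y → a :* :- y := z :* y :+ (a :- :- z) :* :- y) ∣ x ∣ z y))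

  ∣∣<⇒-< : ∀ {x ε} → ∣ x ∣ < ε → x < ε × - x < ε
  ∣∣<⇒-< {x} ∣x∣<ε = ≤-<-trans (x≤∣x∣ x) ∣x∣<ε , ≤-<-trans (-x≤∣x∣ x) ∣x∣<ε

  ε/2 : ∀ {ε} → 0# < ε → 0# < ε * ½
  ε/2 0<ε = *-pos 0<ε 0<½

  ⟶-cong : ∀ {u v a b} → (∀ m → u m ≈ v m) → a ≈ b → u ⟶ a → v ⟶ b
  ⟶-cong u≈v a≈b u⟶a ε 0<ε = proj₁ (u⟶a ε 0<ε) , λ m N≤m →
    <-respˡ-≈ (∣∣-cong (+-cong (u≈v m) (-‿cong a≈b))) (proj₂ (u⟶a ε 0<ε) m N≤m)

  ⟶-const : ∀ c → (λ _ → c) ⟶ c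
  ⟶-const c ε 0<ε = 0 , λ m _ → <-respˡ-≈ (sym (trans (∣∣-cong (-‿inverseʳ c)) (0≤x⇒∣x∣≈x ≤-refl))) 0<ε

  ⟶-+ : ∀ {u v a b} → u ⟶ a → v ⟶ b → (λ m → u m + v m) ⟶ (a + b)
  ⟶-+ {u} {v} {a} {b} u⟶a v⟶b ε 0<ε = N₁ ℕ.⊔ N₂ , λ m N≤m → begin-strict
    ∣ u m + v m - (a + b) ∣
      ≈⟨ ∣∣-cong (solve 4 (λ u v a b → u :+ v :- (a :+ b) := (u :- a) :+ (v :- b)) (u m) (v m) a b) ⟩
    ∣ (u m - a) + (v m - b) ∣      ≤⟨ ∣∣-triangle _ _ ⟩
    ∣ u m - a ∣ + ∣ v m - b ∣
      <⟨ +-mono-<-≤ (near₁ m (ℕ.m⊔n≤o⇒m≤o N₁ N₂ N≤m)) (<⇒≤ (near₂ m (ℕ.m⊔n≤o⇒n≤o N₁ N₂ N≤m))) ⟩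
    ε * ½ + ε * ½                  ≈⟨ ½+½ ε ⟩
    ε                              ∎
    where
    open ≤-Reasoning
    N₁ = proj₁ (u⟶a (ε * ½) (ε/2 0<ε))
    N₂ = proj₁ (v⟶b (ε * ½) (ε/2 0<ε))
    near₁ = proj₂ (u⟶a (ε * ½) (ε/2 0<ε))
    near₂ = proj₂ (v⟶b (ε * ½) (ε/2 0<ε))

  ⟶-scale : ∀ {u a} c → u ⟶ a → (λ m → c * u m) ⟶ (c * a)
  ⟶-scale {u} {a} c u⟶a ε 0<ε = N , λ m N≤m → begin-strict
    ∣ c * u m - c * a ∣    ≈⟨ ∣∣-cong (solve 3 (λ c u a → c :* u :- c :* a := c :* (u :- a)) c (u m) a) ⟩
    ∣ c * (u m - a) ∣      ≤⟨ ∣∣-*-≤ c (u m - a) ⟩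
    ∣ c ∣ * ∣ u m - a ∣    ≤⟨ *-monoˡ-≤ (0≤∣x∣ c) (<⇒≤ (near m N≤m)) ⟩
    ∣ c ∣ * δ              <⟨ <-by δ 0<δ (solve 2 (λ c d → (c :+ 1ₚ) :* d := c :* d :+ d) ∣ c ∣ δ) ⟩
    C * (ε * C ⁻¹)         ≈⟨ solve 3 (λ C e i → C :* (e :* i) := C :* i :* e) C ε (C ⁻¹) ⟩
    C * C ⁻¹ * ε           ≈⟨ trans (*-congʳ (x*x⁻¹≈1 0<C)) (*-identityˡ ε) ⟩
    ε                      ∎
    where
    open ≤-Reasoning
    C = ∣ c ∣ + 1#
    0<C : 0# < C
    0<C = <-respʳ-≈ (+-comm _ _) (0<x+y 0<1 (0≤∣x∣ c))
    δ = ε * C ⁻¹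
    0<δ = *-pos 0<ε (0<x⁻¹ 0<C)
    N = proj₁ (u⟶a δ 0<δ)
    near = proj₂ (u⟶a δ 0<δ)

  ⟶-neg : ∀ {u a} → u ⟶ a → (λ m → - u m) ⟶ (- a)
  ⟶-neg {u} {a} u⟶a = ⟶-cong (λ m → solve 1 (λ x → :- 1ₚ :* x := :- x) (u m))
    (solve 1 (λ x → :- 1ₚ :* x := :- x) a) (⟶-scale (- 1#) u⟶a)

  ⟶-- : ∀ {u v a b} → u ⟶ a → v ⟶ b → (λ m → u m - v m) ⟶ (a - b)
  ⟶-- u⟶a v⟶b = ⟶-+ u⟶a (⟶-neg v⟶b)

  ⟶-squeeze : ∀ {u v a} → (∀ m → ∣ u m - a ∣ ≤ v m) → v ⟶ 0# → u ⟶ a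
  ⟶-squeeze {v = v} ∣u∣≤v v⟶0 ε 0<ε = proj₁ (v⟶0 ε 0<ε) , λ m N≤m →
    ≤-<-trans (≤-trans (∣u∣≤v m) (≤-respˡ-≈ (solve 1 (λ x → x :- 0ₚ := x) (v m)) (x≤∣x∣ _)))
              (proj₂ (v⟶0 ε 0<ε) m N≤m)

  ⟶-null-* : ∀ {u v} → u ⟶ 0# → v ⟶ 0# → (λ m → u m * v m) ⟶ 0#
  ⟶-null-* {u} {v} u⟶0 v⟶0 ε 0<ε = N₁ ℕ.⊔ N₂ , λ m N≤m → begin-strict
    ∣ u m * v m - 0# ∣
      ≈⟨ ∣∣-cong (solve 2 (λ u v → u :* v :- 0ₚ := (u :- 0ₚ) :* (v :- 0ₚ)) (u m) (v m)) ⟩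
    ∣ (u m - 0#) * (v m - 0#) ∣       ≤⟨ ∣∣-*-≤ (u m - 0#) (v m - 0#) ⟩
    ∣ u m - 0# ∣ * ∣ v m - 0# ∣
      ≤⟨ *-mono-≤ 0≤1 (0≤∣x∣ _) (<⇒≤ (proj₂ (u⟶0 1# 0<1) m (ℕ.m⊔n≤o⇒m≤o N₁ N₂ N≤m))) ≤-refl ⟩
    1# * ∣ v m - 0# ∣                 ≈⟨ *-identityˡ _ ⟩
    ∣ v m - 0# ∣                      <⟨ proj₂ (v⟶0 ε 0<ε) m (ℕ.m⊔n≤o⇒n≤o N₁ N₂ N≤m) ⟩
    ε                                 ∎
    where
    open ≤-Reasoning
    N₁ = proj₁ (u⟶0 1# 0<1)
    N₂ = proj₁ (v⟶0 ε 0<ε)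

  ⟶-* : ∀ {u v a b} → u ⟶ a → v ⟶ b → (λ m → u m * v m) ⟶ (a * b)
  ⟶-* {u} {v} {a} {b} u⟶a v⟶b = ⟶-cong
    (λ m → solve 4 (λ u v a b → (u :- a) :* (v :- b) :+ (a :* v :+ b :* u) :- a :* b := u :* v) (u m) (v m) a b)
    (solve 2 (λ a b → 0ₚ :+ (a :* b :+ b :* a) :- a :* b := a :* b) a b)
    (⟶-- (⟶-+ (⟶-null-* (shift u⟶a) (shift v⟶b)) (⟶-+ (⟶-scale a v⟶b) (⟶-scale b u⟶a))) (⟶-const (a * b)))
    where
    shift : ∀ {w c} → w ⟶ c → (λ m → w m - c) ⟶ 0#
    shift {c = c} w⟶c = ⟶-cong (λ _ → refl) (-‿inverseʳ c) (⟶-- w⟶c (⟶-const c))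

  ⟶-sum : ∀ {n} {u : Fin n → ℕ → ℝ} {a : Vector ℝ n} → (∀ l → u l ⟶ a l) →
          (λ m → sum (λ l → u l m)) ⟶ sum a
  ⟶-sum {zero}  _   = ⟶-const 0#
  ⟶-sum {suc n} u⟶a = ⟶-+ (u⟶a fzero) (⟶-sum (u⟶a ∘ fsuc))

  ⟶-subsequence : ∀ {u a} (f : ℕ → ℕ) → (∀ m → m ℕ.≤ f m) → u ⟶ a → (u ∘ f) ⟶ a
  ⟶-subsequence f m≤fm u⟶a ε 0<ε = proj₁ (u⟶a ε 0<ε) , λ m N≤m →
    proj₂ (u⟶a ε 0<ε) (f m) (ℕ.≤-trans N≤m (m≤fm m))

  ⟶-lowerBound : ∀ {u a c} N → (∀ m → N ℕ.≤ m → c ≤ u m) → u ⟶ a → c ≤ a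
  ⟶-lowerBound {u} {a} {c} N c≤u u⟶a = ≮⇒≥ λ a<c →
    let N′ , near = u⟶a (c - a) (0<y-x a<c)
        m = N ℕ.⊔ N′
    in <⇒≱ (proj₁ (∣∣<⇒-< (near m (ℕ.m≤n⊔m N N′))))
         (+-mono-≤ (c≤u m (ℕ.m≤m⊔n N N′)) ≤-refl)

  ⟶-mono-≤ : ∀ {u v a b} → (∀ m → u m ≤ v m) → u ⟶ a → v ⟶ b → a ≤ b
  ⟶-mono-≤ {a = a} {b} u≤v u⟶a v⟶b = ≤-by (b - a)
    (⟶-lowerBound 0 (λ m _ → 0≤y-x (u≤v m)) (⟶-- v⟶b u⟶a)) (solve 2 (λ a b → b := a :+ (b :- a)) a b)

  ⟶-unique : ∀ {u a b} → u ⟶ a → u ⟶ b → a ≈ b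
  ⟶-unique u⟶a u⟶b = ≤-antisym (⟶-mono-≤ (λ _ → ≤-refl) u⟶a u⟶b) (⟶-mono-≤ (λ _ → ≤-refl) u⟶b u⟶a)

  monotone : ∀ {u : ℕ → ℝ} → (∀ m → u m ≤ u (suc m)) → ∀ {m n} → m ℕ.≤ n → u m ≤ u n
  monotone {u} step m≤n = go (ℕ.≤⇒≤′ m≤n)
    where
    go : ∀ {m n} → m ℕ.≤′ n → u m ≤ u n
    go ℕ.≤′-refl       = ≤-refl
    go (ℕ.≤′-step m≤n) = ≤-trans (go m≤n) (step _)

  monotoneConvergence : ∀ {u} → (∀ m → u m ≤ u (suc m)) → (∃ λ B → ∀ m → u m ≤ B) →
                        ∃ λ s → u ⟶ s × (∀ m → u m ≤ s)
  monotoneConvergence {u} step (B , u≤B) = s , converges , below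
    where
    sup = complete (λ x → ∃ λ m → x ≈ u m) (u 0 , 0 , refl)
            (B , λ { x (m , x≈um) → ≤-respˡ-≈ (sym x≈um) (u≤B m) })
    s = proj₁ sup
    below : ∀ m → u m ≤ s
    below m = proj₁ (proj₂ sup) (u m) (m , refl)
    module _ (ε : ℝ) (0<ε : 0# < ε) where
      close : (∃ λ N → s - ε < u N) → ∃ λ N → ∀ m → N ℕ.≤ m → ∣ u m - s ∣ < ε
      close (N , s-ε<uN) = N , λ m N≤m → ∣∣-elim (_< ε)
        (≤-<-trans (≤-by (s - u m) (0≤y-x (below m)) (solve 2 (λ u s → 0ₚ := (u :- s) :+ (s :- u)) (u m) s)) 0<ε)
        (<-by (u m - (s - ε)) (0<y-x (<-≤-trans s-ε<uN (monotone {u} step N≤m)))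
           (solve 3 (λ u s e → e := :- (u :- s) :+ (u :- (s :- e))) (u m) s ε))
      -- Excluded middle supplies the index: if no term exceeded s - ε, then s - ε would be a
      -- smaller upper bound.
      decide : Dec (∃ λ N → s - ε < u N) → ∃ λ N → s - ε < u N
      decide (yes near) = near
      decide (no far)   = ⊥-elim (<⇒≱ (<-by ε 0<ε (solve 2 (λ s e → s := (s :- e) :+ e) s ε))
        (proj₂ (proj₂ sup) (s - ε) λ { x (m , x≈um) → ≤-respˡ-≈ (sym x≈um) (≮⇒≥ λ s-ε<um → far (m , s-ε<um)) }))
    converges : u ⟶ s
    converges ε 0<ε = close ε 0<ε (decide ε 0<ε em)

-- Cauchy products and the formal exponential series.

module CauchyProduct (R : CommutativeRing 0ℓ 0ℓ) where
  open CommutativeRing R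
  open IntegerCoefficients R
  open LinearAlgebra R using (sum; sum-cong-≋; ∑-distrib-+; *-distribˡ-sum)
  open import Algebra.Definitions.RawSemiring (RawRing.rawSemiring rawRing) renaming (_×_ to _·1_) using ()
  open import Relation.Binary.Reasoning.Setoid setoid

  nat : ℕ → Carrier
  nat m = m ·1 1#

  Σ< : (ℕ → Carrier) → ℕ → Carrier
  Σ< f N = sum {N} (λ i → f (toℕ i))

  Σ<-cong : ∀ {f g} → (∀ m → f m ≈ g m) → ∀ N → Σ< f N ≈ Σ< g N
  Σ<-cong f≈g N = sum-cong-≋ {N} (λ i → f≈g (toℕ i))

  Σ<-snoc : ∀ f N → Σ< f (suc N) ≈ Σ< f N + f N
  Σ<-snoc f zero    = +-comm _ _
  Σ<-snoc f (suc N) = trans (+-congˡ (Σ<-snoc (f ∘ suc) N)) (sym (+-assoc _ _ _))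

  Σ<-+ : ∀ f g N → Σ< (λ m → f m + g m) N ≈ Σ< f N + Σ< g N
  Σ<-+ f g N = ∑-distrib-+ {N} (λ i → f (toℕ i)) (λ i → g (toℕ i))

  Σ<-scale : ∀ s f N → Σ< (λ m → s * f m) N ≈ s * Σ< f N
  Σ<-scale s f N = sym (*-distribˡ-sum {N} s (λ i → f (toℕ i)))

  conv : (ℕ → Carrier) → (ℕ → Carrier) → ℕ → Carrier
  conv f g zero    = f 0 * g 0
  conv f g (suc m) = f 0 * g (suc m) + conv (f ∘ suc) g m

  conv-cong : ∀ {f f′ g g′} → (∀ m → f m ≈ f′ m) → (∀ m → g m ≈ g′ m) → ∀ m → conv f g m ≈ conv f′ g′ m
  conv-cong f≈ g≈ zero    = *-cong (f≈ 0) (g≈ 0)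
  conv-cong f≈ g≈ (suc m) = +-cong (*-cong (f≈ 0) (g≈ (suc m))) (conv-cong (f≈ ∘ suc) g≈ m)

  conv-+ˡ : ∀ f f′ g m → conv (λ k → f k + f′ k) g m ≈ conv f g m + conv f′ g m
  conv-+ˡ f f′ g zero    = distribʳ _ _ _
  conv-+ˡ f f′ g (suc m) = trans (+-congˡ (conv-+ˡ (f ∘ suc) (f′ ∘ suc) g m))
    (solve 5 (λ a b c p q → (a :+ b) :* c :+ (p :+ q) := (a :* c :+ p) :+ (b :* c :+ q)) (f 0) (f′ 0) (g (suc m)) _ _)

  conv-scaleˡ : ∀ s f g m → conv (λ k → s * f k) g m ≈ s * conv f g m
  conv-scaleˡ s f g zero    = *-assoc _ _ _
  conv-scaleˡ s f g (suc m) = trans (+-congˡ (conv-scaleˡ s (f ∘ suc) g m))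
    (solve 4 (λ s a b c → s :* a :* b :+ s :* c := s :* (a :* b :+ c)) s (f 0) (g (suc m)) _)

  conv-scaleʳ : ∀ s f g m → conv f (λ k → s * g k) m ≈ s * conv f g m
  conv-scaleʳ s f g zero    = solve 3 (λ s a b → a :* (s :* b) := s :* (a :* b)) s (f 0) (g 0)
  conv-scaleʳ s f g (suc m) = trans (+-congˡ (conv-scaleʳ s (f ∘ suc) g m))
    (solve 4 (λ s a b c → a :* (s :* b) :+ s :* c := s :* (a :* b :+ c)) s (f 0) (g (suc m)) _)

  Σ<-conv : ∀ f g N → Σ< (conv f g) (suc N) ≈ f 0 * Σ< g (suc N) + Σ< (conv (f ∘ suc) g) N
  Σ<-conv f g N = begin
    f 0 * g 0 + Σ< (λ m → f 0 * g (suc m) + conv (f ∘ suc) g m) N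
      ≈⟨ +-congˡ (trans (Σ<-+ (λ m → f 0 * g (suc m)) (conv (f ∘ suc) g) N) (+-congʳ (Σ<-scale (f 0) (g ∘ suc) N))) ⟩
    f 0 * g 0 + (f 0 * Σ< (g ∘ suc) N + Σ< (conv (f ∘ suc) g) N)
      ≈⟨ solve 4 (λ a b c d → a :* b :+ (a :* c :+ d) := a :* (b :+ c) :+ d) (f 0) (g 0) (Σ< (g ∘ suc) N) _ ⟩
    f 0 * Σ< g (suc N) + Σ< (conv (f ∘ suc) g) N ∎

  -- The sum of f i * g j over i, j < N with i + j ≥ N: what the square of indices has beyond the
  -- triangle.
  defect : (ℕ → Carrier) → (ℕ → Carrier) → ℕ → Carrier
  defect f g N = Σ< f N * Σ< g N - Σ< (conv f g) N

  -- Shifting i by one turns the new index region into the old one together with the row j = N. The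
  -- difference is thereby rewritten as a sum of products, on which term-by-term estimates work.
  defect-suc : ∀ f g N → defect f g (suc N) ≈ defect (f ∘ suc) g N + Σ< (f ∘ suc) N * g N
  defect-suc f g N = begin
    (f 0 + F′) * Σ< g (suc N) - Σ< (conv f g) (suc N)
      ≈⟨ +-cong (*-congˡ (Σ<-snoc g N)) (-‿cong (trans (Σ<-conv f g N) (+-congʳ (*-congˡ (Σ<-snoc g N))))) ⟩
    (f 0 + F′) * (Σ< g N + g N) - (f 0 * (Σ< g N + g N) + Σ< (conv (f ∘ suc) g) N)
      ≈⟨ solve 5 (λ a F G b C → (a :+ F) :* (G :+ b) :- (a :* (G :+ b) :+ C) := (F :* G :- C) :+ F :* b)
           (f 0) F′ (Σ< g N) (g N) _ ⟩
    defect (f ∘ suc) g N + F′ * g N ∎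
    where F′ = Σ< (f ∘ suc) N

  -- Coefficients of the formal derivative of a power series; `conv` being the product of power
  -- series, it obeys the Leibniz rule.
  ∂ : (ℕ → Carrier) → ℕ → Carrier
  ∂ f m = nat (suc m) * f (suc m)

  conv-leibniz : ∀ f g m → ∂ (conv f g) m ≈ conv (∂ f) g m + conv f (∂ g) m
  -- `1ₚ :+ 0ₚ` is `nat 1` as it unfolds.
  conv-leibniz f g zero = solve 4 (λ f₀ f₁ g₀ g₁ → (1ₚ :+ 0ₚ) :* (f₀ :* g₁ :+ f₁ :* g₀)
      := ((1ₚ :+ 0ₚ) :* f₁) :* g₀ :+ f₀ :* ((1ₚ :+ 0ₚ) :* g₁)) (f 0) (f 1) (g 0) (g 1)
  conv-leibniz f g (suc m) = begin
    (1# + nat (suc m)) * (f 0 * g (2 ℕ.+ m) + conv f′ g (suc m))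
      ≈⟨ solve 4 (λ n a b c → (1ₚ :+ n) :* (a :* b :+ c) := (c :+ a :* ((1ₚ :+ n) :* b)) :+ n :* c)
           (nat (suc m)) (f 0) (g (2 ℕ.+ m)) (conv f′ g (suc m)) ⟩
    (conv f′ g (suc m) + f 0 * ∂ g (suc m)) + ∂ (conv f′ g) m
      ≈⟨ +-congˡ (conv-leibniz f′ g m) ⟩
    ((f 1 * g (suc m) + conv (f′ ∘ suc) g m) + f 0 * ∂ g (suc m)) + (conv (∂ f′) g m + conv f′ (∂ g) m)
      ≈⟨ solve 6 (λ a b c d p q → ((a :* b :+ c) :+ d) :+ (p :+ q) := (((1ₚ :+ 0ₚ) :* a) :* b :+ (c :+ p)) :+ (d :+ q))
           (f 1) (g (suc m)) _ _ _ _ ⟩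
    (∂ f 0 * g (suc m) + (conv (f′ ∘ suc) g m + conv (∂ f′) g m)) + (f 0 * ∂ g (suc m) + conv f′ (∂ g) m)
      ≈⟨ +-congʳ (+-congˡ (sym (conv-+ˡ (f′ ∘ suc) (∂ f′) g m))) ⟩
    (∂ f 0 * g (suc m) + conv (λ k → f′ (suc k) + ∂ f′ k) g m) + conv f (∂ g) (suc m)
      ≈⟨ +-congʳ (+-congˡ (conv-cong (λ k → solve 2 (λ n x → x :+ n :* x := (1ₚ :+ n) :* x) (nat (suc k)) (f′ (suc k)))
           (λ _ → refl) m)) ⟩
    conv (∂ f) g (suc m) + conv f (∂ g) (suc m) ∎
    where f′ = f ∘ suc

  -- The reciprocals of the positive integers are a parameter, so that one argument covers the real
  -- and the complex series.
  module ExponentialTerms (ν : ℕ → Carrier) (nat*ν≈1 : ∀ m → nat (suc m) * ν m ≈ 1#) where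

    expTerm : Carrier → ℕ → Carrier
    expTerm x zero    = 1#
    expTerm x (suc m) = ν m * (x * expTerm x m)

    ∂-expTerm : ∀ x m → ∂ (expTerm x) m ≈ x * expTerm x m
    ∂-expTerm x m = trans (sym (*-assoc _ _ _)) (trans (*-congʳ (nat*ν≈1 m)) (*-identityˡ _))

    -- Takes the place of the binomial theorem: by the Leibniz rule the product series satisfies c′
    -- = (x + y) c with c₀ = 1, and this recursion determines its coefficients.
    expTerm-+ : ∀ x y m → conv (expTerm x) (expTerm y) m ≈ expTerm (x + y) m
    expTerm-+ x y zero = *-identityˡ 1#
    expTerm-+ x y (suc m) = begin
      c (suc m)
        ≈⟨ sym (trans (*-congʳ (trans (*-comm _ _) (nat*ν≈1 m))) (*-identityˡ _)) ⟩
      ν m * nat (suc m) * c (suc m)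
        ≈⟨ trans (*-assoc _ _ _) (*-congˡ (conv-leibniz (expTerm x) (expTerm y) m)) ⟩
      ν m * (conv (∂ (expTerm x)) (expTerm y) m + conv (expTerm x) (∂ (expTerm y)) m)
        ≈⟨ *-congˡ (+-cong
             (trans (conv-cong (∂-expTerm x) (λ _ → refl) m) (conv-scaleˡ x (expTerm x) (expTerm y) m))
             (trans (conv-cong {f = expTerm x} (λ _ → refl) (∂-expTerm y) m) (conv-scaleʳ y (expTerm x) (expTerm y) m))) ⟩
      ν m * (x * c m + y * c m)
        ≈⟨ *-congˡ (trans (sym (distribʳ (c m) x y)) (*-congˡ (expTerm-+ x y m))) ⟩
      expTerm (x + y) (suc m) ∎
      where c = conv (expTerm x) (expTerm y)

-- The ring of complex numbers.

module ComplexNumbers (ℛ : CompleteOrderedField) where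
  open OrderedField ℛ
  open RealAnalysis ℛ public using (ℂ; _+i_; re; im; complexRawRing; ofReal)

  ℂ-ring : CommutativeRing 0ℓ 0ℓ
  ℂ-ring = record
    { Carrier = ℂ ; _≈_ = C._≈_ ; _+_ = C._+_ ; _*_ = C._*_ ; -_ = C.-_ ; 0# = C.0# ; 1# = C.1#
    ; isCommutativeRing = record
      { isRing = record
        { +-isAbelianGroup = record
          { isGroup = record
            { isMonoid = record
              { isSemigroup = record
                { isMagma = record
                  { isEquivalence = record
                    { refl  = refl , refl
                    ; sym   = λ (p , q) → sym p , sym q
                    ; trans = λ (p , q) (p′ , q′) → trans p p′ , trans q q′ }
                  ; ∙-cong = λ (p , q) (p′ , q′) → +-cong p p′ , +-cong q q′ }
                ; assoc = λ z w v → +-assoc _ _ _ , +-assoc _ _ _ }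
              ; identity = (λ z → +-identityˡ _ , +-identityˡ _) , (λ z → +-identityʳ _ , +-identityʳ _) }
            ; inverse = (λ z → -‿inverseˡ _ , -‿inverseˡ _) , (λ z → -‿inverseʳ _ , -‿inverseʳ _)
            ; ⁻¹-cong = λ (p , q) → -‿cong p , -‿cong q }
          ; comm = λ z w → +-comm _ _ , +-comm _ _ }
        ; *-cong = λ (p , q) (p′ , q′) →
            +-cong (*-cong p p′) (-‿cong (*-cong q q′)) , +-cong (*-cong p q′) (*-cong q p′)
        ; *-assoc = λ z w v →
            solve 6 (λ a b c d p q → (a :* c :- b :* d) :* p :- (a :* d :+ b :* c) :* q
                  := a :* (c :* p :- d :* q) :- b :* (c :* q :+ d :* p)) (re z) (im z) (re w) (im w) (re v) (im v)
          , solve 6 (λ a b c d p q → (a :* c :- b :* d) :* q :+ (a :* d :+ b :* c) :* p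
                  := a :* (c :* q :+ d :* p) :+ b :* (c :* p :- d :* q)) (re z) (im z) (re w) (im w) (re v) (im v)
        ; *-identity =
            (λ z → solve 2 (λ a b → 1ₚ :* a :- 0ₚ :* b := a) (re z) (im z)
                 , solve 2 (λ a b → 1ₚ :* b :+ 0ₚ :* a := b) (re z) (im z))
          , (λ z → solve 2 (λ a b → a :* 1ₚ :- b :* 0ₚ := a) (re z) (im z)
                 , solve 2 (λ a b → a :* 0ₚ :+ b :* 1ₚ := b) (re z) (im z))
        ; distrib =
            (λ z w v →
                solve 6 (λ a b c d p q → a :* (c :+ p) :- b :* (d :+ q) := (a :* c :- b :* d) :+ (a :* p :- b :* q))
                  (re z) (im z) (re w) (im w) (re v) (im v)
              , solve 6 (λ a b c d p q → a :* (d :+ q) :+ b :* (c :+ p) := (a :* d :+ b :* c) :+ (a :* q :+ b :* p))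
                  (re z) (im z) (re w) (im w) (re v) (im v))
          , (λ z w v →
                solve 6 (λ a b c d p q → (c :+ p) :* a :- (d :+ q) :* b := (c :* a :- d :* b) :+ (p :* a :- q :* b))
                  (re z) (im z) (re w) (im w) (re v) (im v)
              , solve 6 (λ a b c d p q → (c :+ p) :* b :+ (d :+ q) :* a := (c :* b :+ d :* a) :+ (p :* b :+ q :* a))
                  (re z) (im z) (re w) (im w) (re v) (im v)) }
      ; *-comm = λ z w →
            solve 4 (λ a b c d → a :* c :- b :* d := c :* a :- d :* b) (re z) (im z) (re w) (im w)
          , solve 4 (λ a b c d → a :* d :+ b :* c := c :* b :+ d :* a) (re z) (im z) (re w) (im w) } }
    where module C = RawRing complexRawRing

  conj : ℂ → ℂ
  conj z = re z +i (- im z)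

-- Convergence of the exponential series for nonnegative reals.

module RealExponential (em : ExcludedMiddle 0ℓ) (ℛ : CompleteOrderedField) where
  open OrderedField ℛ
  open Limits em ℛ public
  open RealAnalysis ℛ public using (fromℕ; ∣_∣; _⟶_)
  open CauchyProduct ℝ-ring public

  -- If x bounded all natural numbers, they would have a supremum s, and s - 1 would bound them too,
  -- since m + 1 ≤ s for every m.
  archimedean : ∀ x → ∃ λ m → x ≤ fromℕ m
  archimedean x = decide em
    where
    decide : Dec (∃ λ m → x ≤ fromℕ m) → ∃ λ m → x ≤ fromℕ m
    decide (yes bounded) = bounded
    decide (no ¬bounded) = ⊥-elim (<⇒≱ (<-by 1# 0<1 (solve 1 (λ s → s := (s :- 1ₚ) :+ 1ₚ) s)) (s-least (s - 1#) s-1-upper))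
      where
      isNat : ℝ → Set
      isNat y = ∃ λ m → y ≈ fromℕ m
      sup = complete isNat (0# , 0 , refl)
        (x , λ { y (m , y≈m) → ≤-respˡ-≈ (sym y≈m) (≮⇒≥ λ x<m → ¬bounded (m , <⇒≤ x<m)) })
      s = proj₁ sup
      s-least = proj₂ (proj₂ sup)
      s-1-upper : ∀ y → isNat y → y ≤ s - 1#
      s-1-upper y (m , y≈m) = ≤-respˡ-≈ (sym y≈m)
        (≤-by _ (0≤y-x (proj₁ (proj₂ sup) (1# + fromℕ m) (suc m , refl)))
          (solve 2 (λ s m → s :- 1ₚ := m :+ (s :- (1ₚ :+ m))) s (fromℕ m)))

  reciprocal : ℕ → ℝ
  reciprocal m = fromℕ (suc m) ⁻¹

  0<reciprocal : ∀ m → 0# < reciprocal m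
  0<reciprocal m = 0<x⁻¹ (0<fromℕ-suc m)

  open ExponentialTerms reciprocal (λ m → x*x⁻¹≈1 (0<fromℕ-suc m)) public

  Σ<-mono : ∀ {f g} → (∀ m → f m ≤ g m) → ∀ N → Σ< f N ≤ Σ< g N
  Σ<-mono f≤g zero    = ≤-refl
  Σ<-mono f≤g (suc N) = +-mono-≤ (f≤g 0) (Σ<-mono (f≤g ∘ suc) N)

  0≤Σ< : ∀ {f} → (∀ m → 0# ≤ f m) → ∀ N → 0# ≤ Σ< f N
  0≤Σ< 0≤f zero    = ≤-refl
  0≤Σ< 0≤f (suc N) = 0≤x+y (0≤f 0) (0≤Σ< (0≤f ∘ suc) N)

  Σ<-step : ∀ {f} → (∀ m → 0# ≤ f m) → ∀ N → Σ< f N ≤ Σ< f (suc N)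
  Σ<-step {f} 0≤f N = ≤-by (f N) (0≤f N) (Σ<-snoc f N)

  -- Adding the dominating series makes all terms nonnegative.
  dominatedConvergence : ∀ {f t} → (∀ m → ∣ f m ∣ ≤ t m) → (∃ λ s → Σ< t ⟶ s × (∀ N → Σ< t N ≤ s)) →
                         ∃ λ l → Σ< f ⟶ l
  dominatedConvergence {f} {t} ∣f∣≤t (s , t⟶s , t≤s) = proj₁ limit - s ,
    ⟶-cong (λ N → trans (+-congʳ (Σ<-+ f t N)) (solve 2 (λ a b → (a :+ b) :- b := a) (Σ< f N) (Σ< t N))) refl
      (⟶-- (proj₁ (proj₂ limit)) t⟶s)
    where
    0≤f+t : ∀ m → 0# ≤ f m + t m
    0≤f+t m = ≤-by _ (0≤y-x (≤-trans (-x≤∣x∣ (f m)) (∣f∣≤t m))) (solve 2 (λ f t → f :+ t := 0ₚ :+ (t :- :- f)) (f m) (t m))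
    f+t≤2t : ∀ m → f m + t m ≤ t m + t m
    f+t≤2t m = +-mono-≤ (≤-trans (x≤∣x∣ (f m)) (∣f∣≤t m)) ≤-refl
    limit = monotoneConvergence {Σ< (λ m → f m + t m)} (Σ<-step 0≤f+t)
      (s + s , λ N → ≤-trans (Σ<-mono f+t≤2t N) (≤-respˡ-≈ (sym (Σ<-+ t t N)) (+-mono-≤ (t≤s N) (t≤s N))))

  0≤expTerm : ∀ {x} → 0# ≤ x → ∀ m → 0# ≤ expTerm x m
  0≤expTerm 0≤x zero    = 0≤1
  0≤expTerm 0≤x (suc m) = 0≤x*y (<⇒≤ (0<reciprocal m)) (0≤x*y 0≤x (0≤expTerm 0≤x m))

  module _ {x} (0≤x : 0# ≤ x) where
    private
      t = expTerm x
      twice : ℝ → ℝ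
      twice y = y + y

    expTerm-halves : ∀ m → twice x ≤ fromℕ (suc m) → twice (t (suc m)) ≤ t m
    expTerm-halves m 2x≤1+m = *-cancelˡ-≤ (0<fromℕ-suc m) (≤-by ((fromℕ (suc m) - twice x) * t m)
      (0≤x*y (0≤y-x 2x≤1+m) (0≤expTerm 0≤x m)) (begin
        n * t m
          ≈⟨ solve 3 (λ n x t → n :* t := (x :* t :+ x :* t) :+ (n :- (x :+ x)) :* t) n x (t m) ⟩
        (x * t m + x * t m) + (n - (x + x)) * t m
          ≈⟨ +-congʳ (sym (+-cong (∂-expTerm x m) (∂-expTerm x m))) ⟩
        (n * t (suc m) + n * t (suc m)) + (n - (x + x)) * t m
          ≈⟨ +-congʳ (sym (distribˡ n _ _)) ⟩
        n * twice (t (suc m)) + (n - (x + x)) * t m ∎))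
      where
      open ≈-Reasoning
      n = fromℕ (suc m)

    -- Beyond B ≥ 2x each term is at most half of the one before, so 2 t_m dominates the tail from m
    -- on. Accordingly `bound` does not increase from B onwards.
    expSeries-bounded : ∃ λ M → ∀ N → Σ< t N ≤ M
    expSeries-bounded = bound B , λ N → ≤-trans (monotone {Σ< t} (Σ<-step (0≤expTerm 0≤x)) (ℕ.m≤m+n N B))
        (≤-trans (≤-by (twice (t (N ℕ.+ B))) (0≤x+y (0≤expTerm 0≤x (N ℕ.+ B)) (0≤expTerm 0≤x (N ℕ.+ B))) refl) (decreasing N))
      where
      B = proj₁ (archimedean (twice x))
      bound : ℕ → ℝ
      bound m = Σ< t m + twice (t m)
      2x≤ : ∀ j → twice x ≤ fromℕ (suc (j ℕ.+ B))
      2x≤ zero    = ≤-trans (proj₂ (archimedean (twice x))) (≤-by 1# 0≤1 (+-comm _ _))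
      2x≤ (suc j) = ≤-trans (2x≤ j) (≤-by 1# 0≤1 (+-comm _ _))
      decreasing : ∀ j → bound (j ℕ.+ B) ≤ bound B
      decreasing zero    = ≤-refl
      decreasing (suc j) = ≤-trans (≤-respˡ-≈ (+-congʳ (sym (Σ<-snoc t m)))
        (≤-by _ (0≤y-x (expTerm-halves m (2x≤ j)))
          (solve 3 (λ S t u → S :+ (t :+ t) := ((S :+ t) :+ u) :+ (t :- u)) (Σ< t m) (t m) (twice (t (suc m)))))) (decreasing j)
        where m = j ℕ.+ B

    expSeries-converges : ∃ λ s → Σ< t ⟶ s × (∀ N → Σ< t N ≤ s)
    expSeries-converges = monotoneConvergence {Σ< t} (Σ<-step (0≤expTerm 0≤x)) expSeries-bounded

  0≤conv : ∀ {f g} → (∀ m → 0# ≤ f m) → (∀ m → 0# ≤ g m) → ∀ m → 0# ≤ conv f g m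
  0≤conv 0≤f 0≤g zero    = 0≤x*y (0≤f 0) (0≤g 0)
  0≤conv 0≤f 0≤g (suc m) = 0≤x+y (0≤x*y (0≤f 0) (0≤g (suc m))) (0≤conv (0≤f ∘ suc) 0≤g m)

  ΣΣ≤Σconv : ∀ {f g} → (∀ m → 0# ≤ f m) → (∀ m → 0# ≤ g m) → ∀ M N →
             Σ< f M * Σ< g N ≤ Σ< (conv f g) (M ℕ.+ N)
  ΣΣ≤Σconv {f} {g} 0≤f 0≤g zero N = ≤-respˡ-≈ (sym (zeroˡ _)) (0≤Σ< (0≤conv 0≤f 0≤g) N)
  ΣΣ≤Σconv {f} {g} 0≤f 0≤g (suc M) N = begin
    (f 0 + Σ< f′ M) * Σ< g N                         ≈⟨ distribʳ _ _ _ ⟩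
    f 0 * Σ< g N + Σ< f′ M * Σ< g N
      ≤⟨ +-mono-≤ (*-monoˡ-≤ (0≤f 0) (monotone {Σ< g} (Σ<-step 0≤g) (ℕ.m≤n+m N (suc M)))) (ΣΣ≤Σconv (0≤f ∘ suc) 0≤g M N) ⟩
    f 0 * Σ< g (suc M ℕ.+ N) + Σ< (conv f′ g) (M ℕ.+ N) ≈⟨ sym (Σ<-conv f g (M ℕ.+ N)) ⟩
    Σ< (conv f g) (suc M ℕ.+ N)                      ∎
    where
    open ≤-Reasoning
    f′ = f ∘ suc

  -- All products with i, j < N occur among those with i + j < 2N. For nonnegative terms the defect
  -- is therefore at most the block from N to 2N of the series at x + y, which tends to 0 by
  -- convergence.
  expDefect-null : ∀ {x y} → 0# ≤ x → 0# ≤ y →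
                   ∃ λ v → v ⟶ 0# × (∀ N → defect (expTerm x) (expTerm y) N ≤ v N)
  expDefect-null {x} {y} 0≤x 0≤y = (λ N → e (N ℕ.+ N) - e N)
    , ⟶-cong (λ _ → refl) (-‿inverseʳ _) (⟶-- (⟶-subsequence (λ N → N ℕ.+ N) (λ N → ℕ.m≤m+n N N) e⟶) e⟶)
    , λ N → +-mono-≤ (≤-respʳ-≈ (conv≈e (N ℕ.+ N)) (ΣΣ≤Σconv (0≤expTerm 0≤x) (0≤expTerm 0≤y) N N))
                     (≤-reflexive (-‿cong (conv≈e N)))
    where
    e = Σ< (expTerm (x + y))
    e⟶ = proj₁ (proj₂ (expSeries-converges (0≤x+y 0≤x 0≤y)))
    conv≈e : ∀ N → Σ< (conv (expTerm x) (expTerm y)) N ≈ e N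
    conv≈e = Σ<-cong (expTerm-+ x y)

-- The complex exponential and its functional equation.

module ComplexExponential (em : ExcludedMiddle 0ℓ) (ℛ : CompleteOrderedField) where
  open OrderedField ℛ
  open ComplexNumbers ℛ public
  open RealExponential em ℛ
  module C  = CommutativeRing ℂ-ring
  module CP = CauchyProduct ℂ-ring

  infix 4 _⟶ᶜ_
  _⟶ᶜ_ : (ℕ → ℂ) → ℂ → Set
  u ⟶ᶜ l = (re ∘ u ⟶ re l) × (im ∘ u ⟶ im l)

  ⟶ᶜ-unique : ∀ {u a b} → u ⟶ᶜ a → u ⟶ᶜ b → a C.≈ b
  ⟶ᶜ-unique (p , q) (p′ , q′) = ⟶-unique p p′ , ⟶-unique q q′

  ⟶ᶜ-cong : ∀ {u v a b} → (∀ m → u m C.≈ v m) → a C.≈ b → u ⟶ᶜ a → v ⟶ᶜ b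
  ⟶ᶜ-cong u≈v a≈b (p , q) = ⟶-cong (proj₁ ∘ u≈v) (proj₁ a≈b) p , ⟶-cong (proj₂ ∘ u≈v) (proj₂ a≈b) q

  ⟶ᶜ-- : ∀ {u v a b} → u ⟶ᶜ a → v ⟶ᶜ b → (λ m → u m C.- v m) ⟶ᶜ (a C.- b)
  ⟶ᶜ-- (p , q) (p′ , q′) = ⟶-- p p′ , ⟶-- q q′

  ⟶ᶜ-* : ∀ {u v a b} → u ⟶ᶜ a → v ⟶ᶜ b → (λ m → u m C.* v m) ⟶ᶜ (a C.* b)
  ⟶ᶜ-* (p , q) (p′ , q′) = ⟶-- (⟶-* p p′) (⟶-* q q′) , ⟶-+ (⟶-* p q′) (⟶-* q p′)

  -- The 1-norm: subadditive and submultiplicative without square roots, and it bounds both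
  -- coordinates.
  ‖_‖ : ℂ → ℝ
  ‖ z ‖ = ∣ re z ∣ + ∣ im z ∣

  0≤‖z‖ : ∀ z → 0# ≤ ‖ z ‖
  0≤‖z‖ z = 0≤x+y (0≤∣x∣ (re z)) (0≤∣x∣ (im z))

  ‖‖-cong : ∀ {z w} → z C.≈ w → ‖ z ‖ ≈ ‖ w ‖
  ‖‖-cong (p , q) = +-cong (∣∣-cong p) (∣∣-cong q)

  ‖‖-+ : ∀ z w → ‖ z C.+ w ‖ ≤ ‖ z ‖ + ‖ w ‖
  ‖‖-+ z w = ≤-respʳ-≈
    (solve 4 (λ a b c d → (a :+ c) :+ (b :+ d) := (a :+ b) :+ (c :+ d)) (∣ re z ∣) (∣ im z ∣) (∣ re w ∣) (∣ im w ∣))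
    (+-mono-≤ (∣∣-triangle (re z) (re w)) (∣∣-triangle (im z) (im w)))

  ‖‖-* : ∀ z w → ‖ z C.* w ‖ ≤ ‖ z ‖ * ‖ w ‖
  ‖‖-* z w = ≤-respʳ-≈
    (solve 4 (λ a b c d → (a :* c :+ b :* d) :+ (a :* d :+ b :* c) := (a :+ b) :* (c :+ d))
       (∣ re z ∣) (∣ im z ∣) (∣ re w ∣) (∣ im w ∣))
    (+-mono-≤
      (≤-trans (∣∣-triangle _ _) (+-mono-≤ (∣∣-*-≤ (re z) (re w)) (≤-trans (∣∣-neg _) (∣∣-*-≤ (im z) (im w)))))
      (≤-trans (∣∣-triangle _ _) (+-mono-≤ (∣∣-*-≤ (re z) (im w)) (∣∣-*-≤ (im z) (re w)))))

  ‖ofReal‖ : ∀ {x} → 0# ≤ x → ‖ ofReal x ‖ ≈ x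
  ‖ofReal‖ {x} 0≤x = trans (+-cong (0≤x⇒∣x∣≈x 0≤x) (0≤x⇒∣x∣≈x ≤-refl)) (+-identityʳ x)

  ‖0‖ : ‖ C.0# ‖ ≈ 0#
  ‖0‖ = ‖ofReal‖ ≤-refl

  nat≈ofReal : ∀ m → CP.nat m C.≈ ofReal (fromℕ m)
  nat≈ofReal zero    = C.refl
  nat≈ofReal (suc m) = +-congˡ (proj₁ (nat≈ofReal m)) , trans (+-congˡ (proj₂ (nat≈ofReal m))) (+-identityˡ 0#)

  ofReal-* : ∀ x y → ofReal x C.* ofReal y C.≈ ofReal (x * y)
  ofReal-* x y = solve 2 (λ x y → x :* y :- 0ₚ :* 0ₚ := x :* y) x y
               , solve 2 (λ x y → x :* 0ₚ :+ 0ₚ :* y := 0ₚ) x y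

  ofReal-cong : ∀ {x y} → x ≈ y → ofReal x C.≈ ofReal y
  ofReal-cong x≈y = x≈y , refl

  open CP.ExponentialTerms (ofReal ∘ reciprocal) (λ m → C.trans (C.*-congʳ (nat≈ofReal (suc m)))
      (C.trans (ofReal-* (fromℕ (suc m)) (reciprocal m)) (ofReal-cong (x*x⁻¹≈1 (0<fromℕ-suc m))))) public
    renaming (expTerm to expTermᶜ; expTerm-+ to expTermᶜ-+) using ()

  expTermᶜ-cong : ∀ {z w} → z C.≈ w → ∀ m → expTermᶜ z m C.≈ expTermᶜ w m
  expTermᶜ-cong z≈w zero    = C.refl
  expTermᶜ-cong z≈w (suc m) = C.*-congˡ {ofReal (reciprocal m)} (C.*-cong z≈w (expTermᶜ-cong z≈w m))

  ‖expTerm‖≤ : ∀ z m → ‖ expTermᶜ z m ‖ ≤ expTerm ‖ z ‖ m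
  ‖expTerm‖≤ z zero    = ≤-reflexive (‖ofReal‖ 0≤1)
  ‖expTerm‖≤ z (suc m) = begin
    ‖ ofReal ν C.* (z C.* t) ‖      ≤⟨ ‖‖-* (ofReal ν) (z C.* t) ⟩
    ‖ ofReal ν ‖ * ‖ z C.* t ‖      ≈⟨ *-congʳ (‖ofReal‖ (<⇒≤ (0<reciprocal m))) ⟩
    ν * ‖ z C.* t ‖
      ≤⟨ *-monoˡ-≤ (<⇒≤ (0<reciprocal m)) (≤-trans (‖‖-* z t) (*-monoˡ-≤ (0≤‖z‖ z) (‖expTerm‖≤ z m))) ⟩
    ν * (‖ z ‖ * expTerm ‖ z ‖ m)   ∎
    where
    open ≤-Reasoning
    ν = reciprocal m
    t = expTermᶜ z m

  re-Σ< : ∀ f N → re (CP.Σ< f N) ≈ Σ< (re ∘ f) N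
  re-Σ< f zero    = refl
  re-Σ< f (suc N) = +-congˡ (re-Σ< (f ∘ suc) N)

  im-Σ< : ∀ f N → im (CP.Σ< f N) ≈ Σ< (im ∘ f) N
  im-Σ< f zero    = refl
  im-Σ< f (suc N) = +-congˡ (im-Σ< (f ∘ suc) N)

  expLimits : ∀ z → ∃ λ l → CP.Σ< (expTermᶜ z) ⟶ᶜ l
  expLimits z = (proj₁ reLimit +i proj₁ imLimit)
    , ⟶-cong (λ N → sym (re-Σ< (expTermᶜ z) N)) refl (proj₂ reLimit)
    , ⟶-cong (λ N → sym (im-Σ< (expTermᶜ z) N)) refl (proj₂ imLimit)
    where
    dominating = expSeries-converges (0≤‖z‖ z)
    reLimit = dominatedConvergence {re ∘ expTermᶜ z}
      (λ m → ≤-trans (≤-by _ (0≤∣x∣ (im (expTermᶜ z m))) refl) (‖expTerm‖≤ z m)) dominating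
    imLimit = dominatedConvergence {im ∘ expTermᶜ z}
      (λ m → ≤-trans (≤-by _ (0≤∣x∣ (re (expTermᶜ z m))) (+-comm _ _)) (‖expTerm‖≤ z m)) dominating

  -- Unfolding the suprema behind exp would make conversion checks very slow.
  abstract
    exp-converges : ∀ z → ∃ λ l → CP.Σ< (expTermᶜ z) ⟶ᶜ l
    exp-converges = expLimits

  exp : ℂ → ℂ
  exp z = proj₁ (exp-converges z)

  exp-limit : ∀ z → CP.Σ< (expTermᶜ z) ⟶ᶜ exp z
  exp-limit z = proj₂ (exp-converges z)

  exp-cong : ∀ {z w} → z C.≈ w → exp z C.≈ exp w
  exp-cong {z} {w} z≈w = ⟶ᶜ-unique
    (⟶ᶜ-cong (CP.Σ<-cong {expTermᶜ z} {expTermᶜ w} (expTermᶜ-cong z≈w)) (C.refl {exp z}) (exp-limit z)) (exp-limit w)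

  ‖Σ<‖≤ : ∀ {f t} → (∀ m → ‖ f m ‖ ≤ t m) → ∀ N → ‖ CP.Σ< f N ‖ ≤ Σ< t N
  ‖Σ<‖≤ ‖f‖≤t zero    = ≤-reflexive ‖0‖
  ‖Σ<‖≤ {f} ‖f‖≤t (suc N) = ≤-trans (‖‖-+ (f 0) _) (+-mono-≤ (‖f‖≤t 0) (‖Σ<‖≤ (‖f‖≤t ∘ suc) N))

  -- Induction along `defect-suc`. Thus the defect of the complex series inherits the null bound
  -- from the nonnegative real series that dominate its factors.
  ‖defect‖≤ : ∀ {f g s t} → (∀ m → ‖ f m ‖ ≤ s m) → (∀ m → ‖ g m ‖ ≤ t m) → ∀ N →
              ‖ CP.defect f g N ‖ ≤ defect s t N
  ‖defect‖≤ f≤s g≤t zero = ≤-reflexive (trans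
    (‖‖-cong {w = C.0#} (solve 0 ((0ₚ :* 0ₚ :- 0ₚ :* 0ₚ) :- 0ₚ := 0ₚ) , solve 0 ((0ₚ :* 0ₚ :+ 0ₚ :* 0ₚ) :- 0ₚ := 0ₚ)))
    (trans ‖0‖ (solve 0 (0ₚ := 0ₚ :* 0ₚ :- 0ₚ))))
  ‖defect‖≤ {f} {g} {s} {t} f≤s g≤t (suc N) = begin
    ‖ CP.defect f g (suc N) ‖
      ≈⟨ ‖‖-cong (CP.defect-suc f g N) ⟩
    ‖ CP.defect (f ∘ suc) g N C.+ CP.Σ< (f ∘ suc) N C.* g N ‖
      ≤⟨ ‖‖-+ _ _ ⟩
    ‖ CP.defect (f ∘ suc) g N ‖ + ‖ CP.Σ< (f ∘ suc) N C.* g N ‖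
      ≤⟨ +-mono-≤ (‖defect‖≤ (f≤s ∘ suc) g≤t N) (≤-trans (‖‖-* _ _)
           (*-mono-≤ (≤-trans (0≤‖z‖ _) (‖Σ<‖≤ (f≤s ∘ suc) N)) (0≤‖z‖ _) (‖Σ<‖≤ (f≤s ∘ suc) N) (g≤t N))) ⟩
    defect (s ∘ suc) t N + Σ< (s ∘ suc) N * t N
      ≈⟨ sym (defect-suc s t N) ⟩
    defect s t (suc N) ∎
    where open ≤-Reasoning

  exp-+ : ∀ z w → exp (z C.+ w) C.≈ exp z C.* exp w
  exp-+ z w = sym (x-y≈0⇒x≈y (proj₁ difference≈0)) , sym (x-y≈0⇒x≈y (proj₂ difference≈0))
    where
    S = CP.Σ< ∘ expTermᶜ
    sum⟶ : (λ N → S z N C.* S w N C.- S (z C.+ w) N) ⟶ᶜ (exp z C.* exp w C.- exp (z C.+ w))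
    sum⟶ = ⟶ᶜ-- {λ N → S z N C.* S w N} {S (z C.+ w)} {exp z C.* exp w} {exp (z C.+ w)}
      (⟶ᶜ-* {S z} {S w} {exp z} {exp w} (exp-limit z) (exp-limit w)) (exp-limit (z C.+ w))
    null = expDefect-null (0≤‖z‖ z) (0≤‖z‖ w)
    v = proj₁ null
    v⟶0 = proj₁ (proj₂ null)
    D = CP.defect (expTermᶜ z) (expTermᶜ w)
    defect≈ : ∀ N → D N C.≈ S z N C.* S w N C.- S (z C.+ w) N
    defect≈ N = C.+-congˡ {S z N C.* S w N} (C.-‿cong (CP.Σ<-cong (expTermᶜ-+ z w) N))
    ‖D‖≤v : ∀ N → ‖ D N ‖ ≤ v N
    ‖D‖≤v N = ≤-trans (‖defect‖≤ (‖expTerm‖≤ z) (‖expTerm‖≤ w) N) (proj₂ (proj₂ null) N)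
    x-0 : ∀ x → ∣ x - 0# ∣ ≈ ∣ x ∣
    x-0 x = ∣∣-cong (solve 1 (λ x → x :- 0ₚ := x) x)
    reBound : ∀ N → ∣ re (D N) - 0# ∣ ≤ v N
    reBound N = ≤-trans (≤-by _ (0≤∣x∣ (im (D N))) (+-congʳ (sym (x-0 (re (D N)))))) (‖D‖≤v N)
    imBound : ∀ N → ∣ im (D N) - 0# ∣ ≤ v N
    imBound N = ≤-trans (≤-by _ (0≤∣x∣ (re (D N))) (trans (+-comm _ _) (+-congʳ (sym (x-0 (im (D N))))))) (‖D‖≤v N)
    difference≈0 : exp z C.* exp w C.- exp (z C.+ w) C.≈ C.0#
    difference≈0 = ⟶ᶜ-unique sum⟶ (⟶ᶜ-cong defect≈ (C.refl {C.0#}) (⟶-squeeze reBound v⟶0 , ⟶-squeeze imBound v⟶0))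

  exp-0 : exp C.0# C.≈ C.1#
  exp-0 = ⟶ᶜ-unique shifted⟶exp (⟶ᶜ-cong (λ N → C.sym {S (suc N)} {C.1#} (partialSum N)) (C.refl {C.1#}) 1⟶1)
    where
    S = CP.Σ< (expTermᶜ C.0#)
    shifted⟶exp : (S ∘ suc) ⟶ᶜ exp C.0#
    shifted⟶exp = ⟶-subsequence suc ℕ.n≤1+n (proj₁ (exp-limit C.0#)) , ⟶-subsequence suc ℕ.n≤1+n (proj₂ (exp-limit C.0#))
    1⟶1 : (λ _ → C.1#) ⟶ᶜ C.1#
    1⟶1 = ⟶-const 1# , ⟶-const 0#
    term≈0 : ∀ m → expTermᶜ C.0# (suc m) C.≈ C.0#
    term≈0 m = C.trans (C.*-congˡ {ofReal (reciprocal m)} (C.zeroˡ (expTermᶜ C.0# m))) (C.zeroʳ (ofReal (reciprocal m)))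
    partialSum : ∀ N → S (suc N) C.≈ C.1#
    partialSum N = C.trans (C.+-congˡ {C.1#} (LA.sum-zero {N} (λ i → term≈0 (toℕ i)))) (C.+-identityʳ C.1#)
      where module LA = LinearAlgebra ℂ-ring

-- Cosine, sine and the least positive zero of the sine.

module Trigonometry (em : ExcludedMiddle 0ℓ) (ℛ : CompleteOrderedField) where
  open OrderedField ℛ
  open ComplexExponential em ℛ
  open RealExponential em ℛ
  open RealAnalysis ℛ using (fromℤ)

  cis : ℝ → ℂ
  cis θ = exp (0# +i θ)

  cos sin : ℝ → ℝ
  cos = re ∘ cis
  sin = im ∘ cis

  cis-cong : ∀ {x y} → x ≈ y → cis x C.≈ cis y
  cis-cong x≈y = exp-cong (refl , x≈y)

  cis-+ : ∀ x y → cis (x + y) C.≈ cis x C.* cis y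
  cis-+ x y = C.trans (exp-cong (sym (+-identityˡ 0#) , refl)) (exp-+ (0# +i x) (0# +i y))

  cis-0 : cis 0# C.≈ C.1#
  cis-0 = exp-0

  cis-neg : ∀ x → cis (- x) C.≈ conj (cis x)
  cis-neg x = ⟶ᶜ-unique (exp-limit (0# +i (- x)))
    (⟶ᶜ-cong conj-partialSum (C.refl {conj (cis x)})
      (proj₁ (exp-limit (0# +i x)) , ⟶-neg (proj₂ (exp-limit (0# +i x)))))
    where
    term : ∀ m → conj (expTermᶜ (0# +i x) m) C.≈ expTermᶜ (0# +i (- x)) m
    term zero    = refl , solve 0 (:- 0ₚ := 0ₚ)
    term (suc m) = C.trans
      ( solve 4 (λ ν x a b → ν :* (0ₚ :* a :- x :* b) :- 0ₚ :* (0ₚ :* b :+ x :* a)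
                  := ν :* (0ₚ :* a :- :- x :* :- b) :- 0ₚ :* (0ₚ :* :- b :+ :- x :* a)) ν x (re t) (im t)
      , solve 4 (λ ν x a b → :- (ν :* (0ₚ :* b :+ x :* a) :+ 0ₚ :* (0ₚ :* a :- x :* b))
                  := ν :* (0ₚ :* :- b :+ :- x :* a) :+ 0ₚ :* (0ₚ :* a :- :- x :* :- b)) ν x (re t) (im t) )
      (C.*-congˡ {ofReal ν} (C.*-congˡ {0# +i (- x)} (term m)))
      where
      ν = reciprocal m
      t = expTermᶜ (0# +i x) m
    conj-Σ< : ∀ f N → conj (CP.Σ< f N) C.≈ CP.Σ< (conj ∘ f) N
    conj-Σ< f zero    = refl , solve 0 (:- 0ₚ := 0ₚ)
    conj-Σ< f (suc N) = C.trans (refl , solve 2 (λ a b → :- (a :+ b) := :- a :+ :- b) (im (f 0)) (im (CP.Σ< (f ∘ suc) N)))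
      (C.+-congˡ {conj (f 0)} (conj-Σ< (f ∘ suc) N))
    conj-partialSum : ∀ N → conj (CP.Σ< (expTermᶜ (0# +i x)) N) C.≈ CP.Σ< (expTermᶜ (0# +i (- x))) N
    conj-partialSum N = C.trans (conj-Σ< (expTermᶜ (0# +i x)) N) (CP.Σ<-cong term N)

  cos²+sin²≈1 : ∀ x → cos x * cos x + sin x * sin x ≈ 1#
  cos²+sin²≈1 x = begin
    cos x * cos x + sin x * sin x
      ≈⟨ solve 2 (λ c s → c :* c :+ s :* s := c :* c :- s :* :- s) (cos x) (sin x) ⟩
    re (cis x C.* conj (cis x))
      ≈⟨ proj₁ (C.trans (C.*-congˡ {cis x} (C.sym (cis-neg x))) (C.sym (cis-+ x (- x)))) ⟩
    re (cis (x - x))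
      ≈⟨ proj₁ (C.trans (cis-cong (-‿inverseʳ x)) cis-0) ⟩
    1# ∎
    where open ≈-Reasoning

  cis-ℕ-multiple : ∀ {x y} → cis x C.≈ cis y → ∀ q → cis (fromℕ q * x) C.≈ cis (fromℕ q * y)
  cis-ℕ-multiple {x} {y} eq zero    = cis-cong (trans (zeroˡ x) (sym (zeroˡ y)))
  cis-ℕ-multiple {x} {y} eq (suc q) = C.trans (split x) (C.trans (C.*-cong eq (cis-ℕ-multiple eq q)) (C.sym (split y)))
    where
    split : ∀ z → cis ((1# + fromℕ q) * z) C.≈ cis z C.* cis (fromℕ q * z)
    split z = C.trans (cis-cong (solve 2 (λ q z → (1ₚ :+ q) :* z := z :+ q :* z) (fromℕ q) z)) (cis-+ z (fromℕ q * z))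

  cis-ℤ-multiple : ∀ {x y} → cis x C.≈ cis y → ∀ q → cis (fromℤ q * x) C.≈ cis (fromℤ q * y)
  cis-ℤ-multiple eq (+ q)    = cis-ℕ-multiple eq q
  cis-ℤ-multiple {x} {y} eq -[1+ q ] = C.trans (split x) (C.trans
      (proj₁ ih , -‿cong (proj₂ ih)) (C.sym (split y)))
    where
    ih = cis-ℕ-multiple eq (suc q)
    split : ∀ z → cis (- fromℕ (suc q) * z) C.≈ conj (cis (fromℕ (suc q) * z))
    split z = C.trans (cis-cong (solve 2 (λ q z → :- q :* z := :- (q :* z)) (fromℕ (suc q)) z)) (cis-neg _)

  sin-zero-+ : ∀ {x y} → sin x ≈ 0# → sin y ≈ 0# → sin (x + y) ≈ 0#
  sin-zero-+ {x} {y} sx≈0 sy≈0 = trans (proj₂ (cis-+ x y)) (trans (+-cong (*-congˡ sy≈0) (*-congʳ sx≈0))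
    (solve 2 (λ a b → a :* 0ₚ :+ 0ₚ :* b := 0ₚ) (cos x) (cos y)))

  sin-zero-neg : ∀ {x} → sin x ≈ 0# → sin (- x) ≈ 0#
  sin-zero-neg {x} sx≈0 = trans (proj₂ (cis-neg x)) (trans (-‿cong sx≈0) (solve 0 (:- 0ₚ := 0ₚ)))

  sin-zero-ℕ-multiple : ∀ {x} → sin x ≈ 0# → ∀ q → sin (fromℕ q * x) ≈ 0#
  sin-zero-ℕ-multiple {x} sx≈0 zero    = trans (proj₂ (cis-cong (zeroˡ x))) (proj₂ cis-0)
  sin-zero-ℕ-multiple {x} sx≈0 (suc q) = trans
    (proj₂ (cis-cong (solve 2 (λ q z → (1ₚ :+ q) :* z := z :+ q :* z) (fromℕ q) x)))
    (sin-zero-+ sx≈0 (sin-zero-ℕ-multiple sx≈0 q))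

  expTerm-cong : ∀ {x y} → x ≈ y → ∀ m → expTerm x m ≈ expTerm y m
  expTerm-cong x≈y zero    = refl
  expTerm-cong x≈y (suc m) = *-congˡ (*-cong x≈y (expTerm-cong x≈y m))

  -- From index 2 on the terms at least halve, so 2 t_N bounds what the partial sums can still lose
  -- after N. The invariant carries this reserve along; it starts at N = 2, where the partial sum is
  -- x and 2 t₂ = x².
  sin-lowerBound : ∀ {x} → 0# ≤ x → x ≤ 1# → x - x * x ≤ sin x
  sin-lowerBound {x} 0≤x x≤1 = ⟶-lowerBound 2 late (proj₂ (exp-limit (0# +i x)))
    where
    f = expTermᶜ (0# +i x)
    t = expTerm x
    s : ℕ → ℝ
    s N = im (CP.Σ< f N)
    -im-f≤t : ∀ m → - im (f m) ≤ t m
    -im-f≤t m = begin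
      - im (f m)                      ≤⟨ -x≤∣x∣ (im (f m)) ⟩
      ∣ im (f m) ∣                    ≤⟨ ≤-by _ (0≤∣x∣ (re (f m))) (+-comm _ _) ⟩
      ‖ f m ‖                         ≤⟨ ‖expTerm‖≤ (0# +i x) m ⟩
      expTerm ‖ 0# +i x ‖ m           ≈⟨ expTerm-cong (trans (+-cong (0≤x⇒∣x∣≈x ≤-refl) (0≤x⇒∣x∣≈x 0≤x)) (+-identityˡ x)) m ⟩
      t m                             ∎
      where open ≤-Reasoning
    t₁≈x : t 1 ≈ x
    t₁≈x = trans (solve 1 (λ t → t := (1ₚ :+ 0ₚ) :* t) (t 1)) (trans (∂-expTerm x 0) (*-identityʳ x))
    2t₂≈x² : t 2 + t 2 ≈ x * x
    2t₂≈x² = trans (solve 1 (λ t → t :+ t := (1ₚ :+ (1ₚ :+ 0ₚ)) :* t) (t 2)) (trans (∂-expTerm x 1) (*-congˡ t₁≈x))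
    s₂≈x : s 2 ≈ x
    s₂≈x = trans (solve 2 (λ ν x → 0ₚ :+ ((ν :* (0ₚ :* 0ₚ :+ x :* 1ₚ) :+ 0ₚ :* (0ₚ :* 1ₚ :- x :* 0ₚ)) :+ 0ₚ) := ν :* (x :* 1ₚ))
                   (reciprocal 0) x) t₁≈x
    2≤ : ∀ j → x + x ≤ fromℕ (3 ℕ.+ j)
    2≤ j = ≤-by _ (0≤x+y (0≤x+y (0≤y-x x≤1) (0≤y-x x≤1)) (0≤fromℕ (suc j)))
      (solve 2 (λ x n → 1ₚ :+ (1ₚ :+ n) := (x :+ x) :+ (((1ₚ :- x) :+ (1ₚ :- x)) :+ n)) x (fromℕ (suc j)))
    invariant : ∀ j → (x - x * x) + (t (2 ℕ.+ j) + t (2 ℕ.+ j)) ≤ s (2 ℕ.+ j)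
    invariant zero = ≤-reflexive (trans (+-congˡ 2t₂≈x²) (trans (solve 2 (λ x y → (x :- y) :+ y := x) x (x * x)) (sym s₂≈x)))
    invariant (suc j) = begin
      (x - x * x) + (t (suc m) + t (suc m))
        ≤⟨ +-mono-≤ ≤-refl (expTerm-halves 0≤x m (2≤ j)) ⟩
      (x - x * x) + t m
        ≤⟨ ≤-by _ (0≤y-x (-im-f≤t m)) (solve 3 (λ y t i → (y :+ (t :+ t)) :+ i := (y :+ t) :+ (t :- :- i)) (x - x * x) (t m) (im (f m))) ⟩
      ((x - x * x) + (t m + t m)) + im (f m)
        ≤⟨ +-mono-≤ (invariant j) ≤-refl ⟩
      s m + im (f m)
        ≈⟨ sym (proj₂ (CP.Σ<-snoc f m)) ⟩
      s (suc m) ∎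
      where
      open ≤-Reasoning
      m = 2 ℕ.+ j
    late : ∀ N → 2 ℕ.≤ N → x - x * x ≤ s N
    late (suc (suc j)) (ℕ.s≤s (ℕ.s≤s ℕ.z≤n)) =
      ≤-trans (≤-by _ (0≤x+y (0≤expTerm 0≤x (2 ℕ.+ j)) (0≤expTerm 0≤x (2 ℕ.+ j))) refl) (invariant j)

  sin-positive : ∀ {x} → 0# < x → x < 1# → 0# < sin x
  sin-positive {x} 0<x x<1 = <-≤-trans
    (<-respʳ-≈ (solve 1 (λ x → x :* (1ₚ :- x) := x :- x :* x) x) (*-pos 0<x (0<y-x x<1)))
    (sin-lowerBound (<⇒≤ 0<x) (<⇒≤ x<1))

  LeastPositiveZero : ℝ → Set
  LeastPositiveZero p = 0# < p × sin p ≈ 0# × (∀ x → 0# < x → x < p → ¬ (sin x ≈ 0#))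

  -- The zeros form a subgroup with gaps of length at least 1, so its positive part attains its infimum.
  leastPositiveZero : (∃ λ u → 0# < u × sin u ≈ 0#) → ∃ LeastPositiveZero
  leastPositiveZero (u , 0<u , su≈0) = least (near em)
    where
    -- Negated because completeness speaks of suprema: -s is the infimum of the positive zeros, and
    -- `NearZero` asks for one less than 1 above it.
    NegatedZero : ℝ → Set
    NegatedZero y = ∃ λ x → 0# < x × sin x ≈ 0# × y ≈ - x
    sup = complete NegatedZero (- u , u , 0<u , su≈0 , refl)
      (0# , λ { y (x , 0<x , _ , y≈-x) → <⇒≤ (<-by x 0<x (trans (sym (-‿inverseˡ x)) (+-congʳ (sym y≈-x)))) })
    s = proj₁ sup
    -x≤s : ∀ {x} → 0# < x → sin x ≈ 0# → - x ≤ s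
    -x≤s {x} 0<x sx≈0 = proj₁ (proj₂ sup) (- x) (x , 0<x , sx≈0 , refl)
    NearZero : Set
    NearZero = ∃ λ z → 0# < z × sin z ≈ 0# × z < 1# - s
    near : Dec NearZero → NearZero
    near (yes z)  = z
    near (no ¬near) = ⊥-elim (<⇒≱ (<-by 1# 0<1 (solve 1 (λ s → s := (s :- 1ₚ) :+ 1ₚ) s)) (proj₂ (proj₂ sup) (s - 1#)
      λ { y (x , 0<x , sx≈0 , y≈-x) → ≤-respˡ-≈ (sym y≈-x)
            (≤-by _ (0≤y-x (≮⇒≥ λ x<1-s → ¬near (x , 0<x , sx≈0 , x<1-s)))
              (solve 2 (λ s x → s :- 1ₚ := :- x :+ (x :- (1ₚ :- s))) s x)) }))
    least : NearZero → ∃ LeastPositiveZero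
    least (z , 0<z , sz≈0 , z<1-s) = z , 0<z , sz≈0 , λ x 0<x x<z sx≈0 →
      0<⇒≉0 (sin-positive (0<y-x x<z) (<-by _ (0<x+y (0<y-x z<1-s) (0≤y-x (-x≤s 0<x sx≈0)))
               (solve 3 (λ x z s → 1ₚ := (z :- x) :+ (((1ₚ :- s) :- z) :+ (s :- :- x))) x z s)))
            (sin-zero-+ sz≈0 (sin-zero-neg sx≈0))

  -- Double angle at h = p/2: sin h ≠ 0 by minimality of p, so 2 sin h cos h = sin p = 0 gives cos h
  -- = 0, and cos p = 2 cos² h - 1.
  cos-leastPositiveZero : ∀ {p} → LeastPositiveZero p → cos p ≈ - 1#
  cos-leastPositiveZero {p} (0<p , sp≈0 , p-least) = begin
    cos p
      ≈⟨ sym (proj₁ (cis-cong (½+½ p))) ⟩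
    cos (h + h)
      ≈⟨ proj₁ (cis-+ h h) ⟩
    cos h * cos h - sin h * sin h
      ≈⟨ solve 2 (λ c s → c :* c :- s :* s := (c :* c :+ c :* c) :- (c :* c :+ s :* s)) (cos h) (sin h) ⟩
    (cos h * cos h + cos h * cos h) - (cos h * cos h + sin h * sin h)
      ≈⟨ +-cong (trans (+-cong (*-congˡ ch≈0) (*-congˡ ch≈0)) (solve 1 (λ c → c :* 0ₚ :+ c :* 0ₚ := 0ₚ) (cos h)))
                (-‿cong (cos²+sin²≈1 h)) ⟩
    0# - 1#
      ≈⟨ +-identityˡ _ ⟩
    - 1# ∎
    where
    open ≈-Reasoning
    h = p * ½
    0<h = ε/2 0<p
    sh≉0 : ¬ (sin h ≈ 0#)
    sh≉0 = p-least h 0<h (<-by h 0<h (sym (½+½ p)))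
    2≉0 : ¬ (1# + 1# ≈ 0#)
    2≉0 = 0<⇒≉0 (0<x+y 0<1 0≤1)
    ch≈0 : cos h ≈ 0#
    ch≈0 = *-cancelˡ-0 (*-≉0 2≉0 sh≉0) (begin
      (1# + 1#) * sin h * cos h        ≈⟨ solve 2 (λ s c → (1ₚ :+ 1ₚ) :* s :* c := c :* s :+ s :* c) (sin h) (cos h) ⟩
      cos h * sin h + sin h * cos h    ≈⟨ sym (proj₂ (cis-+ h h)) ⟩
      sin (h + h)                      ≈⟨ proj₂ (cis-cong (½+½ p)) ⟩
      sin p                            ≈⟨ sp≈0 ⟩
      0#                               ∎)

-- Agreement of the imaginary part of the exponential with the sine series.

module SineSeries (em : ExcludedMiddle 0ℓ) (ℛ : CompleteOrderedField) where
  open OrderedField ℛ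
  open ComplexExponential em ℛ
  open RealExponential em ℛ
  open Trigonometry em ℛ
  open RealAnalysis ℛ using (IsPi; IsSin)
  open import Algebra.Definitions.RawSemiring (RawRing.rawSemiring (CommutativeRing.rawRing ℝ-ring)) using (_^_)
  open import Algebra.Definitions.RawSemiring (RawRing.rawSemiring complexRawRing) using () renaming (_^_ to _^ᶜ_)
  open import Algebra.Properties.Semiring.Mult semiring using (×1-homo-*)

  -- Inverses of different expressions for one number are compared through their products, since
  -- `⁻¹` comes without a congruence axiom.
  inverse-unique : ∀ {x y} → 0# < x → x * y ≈ 1# → y ≈ x ⁻¹
  inverse-unique 0<x xy≈1 = *-cancelˡ (0<⇒≉0 0<x) (trans xy≈1 (sym (x*x⁻¹≈1 0<x)))

  0<fromℕ! : ∀ m → 0# < fromℕ (m !)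
  0<fromℕ! zero    = 0<fromℕ-suc 0
  0<fromℕ! (suc m) = <-respʳ-≈ (sym (×1-homo-* (suc m) (m !))) (*-pos (0<fromℕ-suc m) (0<fromℕ! m))

  inverse-! : ∀ m → fromℕ (suc m !) ⁻¹ ≈ reciprocal m * fromℕ (m !) ⁻¹
  inverse-! m = sym (inverse-unique (0<fromℕ! (suc m)) (begin
    fromℕ (suc m !) * (reciprocal m * fromℕ (m !) ⁻¹)
      ≈⟨ *-congʳ (×1-homo-* (suc m) (m !)) ⟩
    fromℕ (suc m) * fromℕ (m !) * (reciprocal m * fromℕ (m !) ⁻¹)
      ≈⟨ solve 4 (λ a b c d → a :* b :* (c :* d) := (a :* c) :* (b :* d)) (fromℕ (suc m)) (fromℕ (m !)) _ _ ⟩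
    (fromℕ (suc m) * reciprocal m) * (fromℕ (m !) * fromℕ (m !) ⁻¹)
      ≈⟨ *-cong (x*x⁻¹≈1 (0<fromℕ-suc m)) (x*x⁻¹≈1 (0<fromℕ! m)) ⟩
    1# * 1#
      ≈⟨ *-identityˡ 1# ⟩
    1# ∎))
    where open ≈-Reasoning

  inverse-0! : fromℕ (0 !) ⁻¹ ≈ 1#
  inverse-0! = sym (inverse-unique (0<fromℕ! 0) (solve 0 ((1ₚ :+ 0ₚ) :* 1ₚ := 1ₚ)))

  power/!≈expTerm : ∀ x m → x ^ m * fromℕ (m !) ⁻¹ ≈ expTerm x m
  power/!≈expTerm x zero    = trans (*-congˡ inverse-0!) (*-identityˡ 1#)
  power/!≈expTerm x (suc m) = begin
    x * x ^ m * fromℕ (suc m !) ⁻¹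
      ≈⟨ *-congˡ (inverse-! m) ⟩
    x * x ^ m * (reciprocal m * fromℕ (m !) ⁻¹)
      ≈⟨ solve 4 (λ x p r i → x :* p :* (r :* i) := r :* (x :* (p :* i))) x (x ^ m) (reciprocal m) _ ⟩
    reciprocal m * (x * (x ^ m * fromℕ (m !) ⁻¹))
      ≈⟨ *-congˡ (*-congˡ (power/!≈expTerm x m)) ⟩
    expTerm x (suc m) ∎
    where open ≈-Reasoning

  powerᶜ/!≈expTermᶜ : ∀ z m → ofReal (fromℕ (m !) ⁻¹) C.* (z ^ᶜ m) C.≈ expTermᶜ z m
  powerᶜ/!≈expTermᶜ z zero    = C.trans (C.*-congʳ {C.1#} (ofReal-cong inverse-0!)) (C.*-identityˡ C.1#)
  powerᶜ/!≈expTermᶜ z (suc m) = begin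
    ofReal (fromℕ (suc m !) ⁻¹) C.* (z C.* z ^ᶜ m)
      ≈⟨ C.*-congʳ {z C.* z ^ᶜ m} (C.trans (ofReal-cong (inverse-! m)) (C.sym (ofReal-* ν i))) ⟩
    (ofReal ν C.* ofReal i) C.* (z C.* z ^ᶜ m)
      ≈⟨ S.solve 4 (λ r i z p → (r S.:* i) S.:* (z S.:* p) S.:= r S.:* (z S.:* (i S.:* p))) (ofReal ν) (ofReal i) z (z ^ᶜ m) ⟩
    ofReal ν C.* (z C.* (ofReal i C.* z ^ᶜ m))
      ≈⟨ C.*-congˡ {ofReal ν} (C.*-congˡ {z} (powerᶜ/!≈expTermᶜ z m)) ⟩
    expTermᶜ z (suc m) ∎
    where
    open import Relation.Binary.Reasoning.Setoid C.setoid
    module S = IntegerCoefficients ℂ-ring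
    ν = reciprocal m
    i = fromℕ (m !) ⁻¹

  module _ (x : ℝ) where
    private
      f = expTermᶜ (0# +i x)
      t = expTerm x

    odd-from-even : ∀ {σ} j → f j C.≈ ofReal (σ * t j) → f (suc j) C.≈ (0# +i (σ * t (suc j)))
    odd-from-even {σ} j fj≈ = C.trans (C.*-congˡ {ofReal (reciprocal j)} (C.*-congˡ {0# +i x} fj≈))
      ( solve 4 (λ r x s t → r :* (0ₚ :* (s :* t) :- x :* 0ₚ) :- 0ₚ :* (0ₚ :* 0ₚ :+ x :* (s :* t)) := 0ₚ) (reciprocal j) x σ (t j)
      , solve 4 (λ r x s t → r :* (0ₚ :* 0ₚ :+ x :* (s :* t)) :+ 0ₚ :* (0ₚ :* (s :* t) :- x :* 0ₚ) := s :* (r :* (x :* t)))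
          (reciprocal j) x σ (t j) )

    even-from-odd : ∀ {σ} j → f j C.≈ (0# +i (σ * t j)) → f (suc j) C.≈ ofReal (- 1# * σ * t (suc j))
    even-from-odd {σ} j fj≈ = C.trans (C.*-congˡ {ofReal (reciprocal j)} (C.*-congˡ {0# +i x} fj≈))
      ( solve 4 (λ r x s t → r :* (0ₚ :* 0ₚ :- x :* (s :* t)) :- 0ₚ :* (0ₚ :* (s :* t) :+ x :* 0ₚ) := :- 1ₚ :* s :* (r :* (x :* t)))
          (reciprocal j) x σ (t j)
      , solve 4 (λ r x s t → r :* (0ₚ :* (s :* t) :+ x :* 0ₚ) :+ 0ₚ :* (0ₚ :* 0ₚ :- x :* (s :* t)) := 0ₚ) (reciprocal j) x σ (t j) )

    -- Each multiplication by ix swaps the real and the imaginary axis, so even and odd terms are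
    -- determined in alternation.
    evenTerm : ∀ m → f (2 ℕ.* m) C.≈ ofReal ((- 1#) ^ m * t (2 ℕ.* m))
    oddTerm  : ∀ m → f (suc (2 ℕ.* m)) C.≈ (0# +i ((- 1#) ^ m * t (suc (2 ℕ.* m))))
    evenTerm zero = sym (*-identityˡ 1#) , refl
    evenTerm (suc m) = ≡.subst (λ j → f j C.≈ ofReal ((- 1#) ^ suc m * t j)) (≡.sym (ℕ.*-suc 2 m))
      (even-from-odd (suc (2 ℕ.* m)) (oddTerm m))
    oddTerm m = odd-from-even (2 ℕ.* m) (evenTerm m)

    sinTerm : ℕ → ℝ
    sinTerm m = (- 1#) ^ m * x ^ suc (2 ℕ.* m) / fromℕ (suc (2 ℕ.* m) !)

    sinTerm≈ : ∀ m → im (f (suc (2 ℕ.* m))) ≈ sinTerm m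
    sinTerm≈ m = trans (proj₂ (oddTerm m)) (trans (*-congˡ (sym (power/!≈expTerm x (suc (2 ℕ.* m))))) (sym (*-assoc _ _ _)))

    -- The even terms are real, so 2N exponential terms contribute N sine terms; the sine series is
    -- thus a subsequence of the partial sums.
    sinPartialSum : ∀ N → im (CP.Σ< f (2 ℕ.* N)) ≈ Σ< sinTerm N
    sinPartialSum zero    = refl
    sinPartialSum (suc N) = begin
      im (CP.Σ< f (2 ℕ.* suc N))
        ≡⟨ ≡.cong (λ j → im (CP.Σ< f j)) (ℕ.*-suc 2 N) ⟩
      im (CP.Σ< f (suc (suc (2 ℕ.* N))))
        ≈⟨ trans (proj₂ (CP.Σ<-snoc f (suc (2 ℕ.* N)))) (+-congʳ (proj₂ (CP.Σ<-snoc f (2 ℕ.* N)))) ⟩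
      im (CP.Σ< f (2 ℕ.* N)) + im (f (2 ℕ.* N)) + im (f (suc (2 ℕ.* N)))
        ≈⟨ +-cong (trans (+-cong (sinPartialSum N) (proj₂ (evenTerm N))) (+-identityʳ _)) (sinTerm≈ N) ⟩
      Σ< sinTerm N + sinTerm N
        ≈⟨ sym (Σ<-snoc sinTerm N) ⟩
      Σ< sinTerm (suc N) ∎
      where open ≈-Reasoning

    isSin : IsSin x (sin x)
    isSin = ⟶-cong sinPartialSum refl
      (⟶-subsequence (2 ℕ.*_) (λ m → ℕ.m≤m+n m (m ℕ.+ 0)) (proj₂ (exp-limit (0# +i x))))

  isPi : ∀ {p} → LeastPositiveZero p → IsPi p
  isPi {p} (0<p , sp≈0 , p-least) = 0<p , ⟶-cong (λ _ → refl) sp≈0 (isSin p)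
    , λ x 0<x x<p sinx≈0 → p-least x 0<x x<p (⟶-unique (isSin x) sinx≈0)

-- Perfect state transfer as a condition on phases.

module TransferCriterion (em : ExcludedMiddle 0ℓ) (ℛ : CompleteOrderedField) where
  open OrderedField ℛ
  open SpectralCalculus ℛ using (EigenFamily; module Calculus)
  open LinearAlgebra ℝ-ring
  open ComplexExponential em ℛ
  open RealExponential em ℛ using (fromℕ; ⟶-const; ⟶-+)
  open Trigonometry em ℛ using (cis)
  open SineSeries em ℛ using (powerᶜ/!≈expTermᶜ)
  open RealAnalysis ℛ using (Eigenspace; 𝕚; UnitModulus; expPartialSum; IsExp; TransferTime)
  open import Algebra.Definitions.RawSemiring (RawRing.rawSemiring complexRawRing) using () renaming (_^_ to _^ᶜ_)
  module CL = LinearAlgebra ℂ-ring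
  module S = IntegerCoefficients ℂ-ring

  ofReal-sum : ∀ {n} (f : Vector ℝ n) → ofReal (sum f) C.≈ CL.sum (ofReal ∘ f)
  ofReal-sum {zero}  f = C.refl {C.0#}
  ofReal-sum {suc n} f = +-congˡ (proj₁ (ofReal-sum (f ∘ fsuc))) , trans (proj₂ (ofReal-sum (f ∘ fsuc))) (sym (+-identityˡ _))

  ofReal-e : ∀ {n} (i j : Fin n) → CL.e i j C.≈ ofReal (e i j)
  ofReal-e i j with i Fin.≟ j
  ... | yes _ = C.refl {C.1#}
  ... | no  _ = C.refl {C.0#}

  re-*ofReal : ∀ z x → re (z C.* ofReal x) ≈ re z * x
  re-*ofReal z x = solve 3 (λ a b x → a :* x :- b :* 0ₚ := a :* x) (re z) (im z) x

  im-*ofReal : ∀ z x → im (z C.* ofReal x) ≈ im z * x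
  im-*ofReal z x = solve 3 (λ a b x → a :* 0ₚ :+ b :* x := b :* x) (re z) (im z) x

  re-sum : ∀ {n} (z : Vector ℂ n) (x : Vector ℝ n) → re (CL.sum (λ l → z l C.* ofReal (x l))) ≈ sum (λ l → re (z l) * x l)
  re-sum {zero}  z x = refl
  re-sum {suc n} z x = +-cong (re-*ofReal (z fzero) (x fzero)) (re-sum (z ∘ fsuc) (x ∘ fsuc))

  im-sum : ∀ {n} (z : Vector ℂ n) (x : Vector ℝ n) → im (CL.sum (λ l → z l C.* ofReal (x l))) ≈ sum (λ l → im (z l) * x l)
  im-sum {zero}  z x = refl
  im-sum {suc n} z x = +-cong (im-*ofReal (z fzero) (x fzero)) (im-sum (z ∘ fsuc) (x ∘ fsuc))

  ⟶ᶜ-sum : ∀ {n} {u : Fin n → ℕ → ℂ} {a : Vector ℂ n} → (∀ l → u l ⟶ᶜ a l) → (λ m → CL.sum (λ l → u l m)) ⟶ᶜ CL.sum a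
  ⟶ᶜ-sum {zero}  u⟶a = ⟶-const 0# , ⟶-const 0#
  ⟶ᶜ-sum {suc n} u⟶a = ⟶-+ (proj₁ (u⟶a fzero)) (proj₁ (⟶ᶜ-sum (u⟶a ∘ fsuc)))
                      , ⟶-+ (proj₂ (u⟶a fzero)) (proj₂ (⟶ᶜ-sum (u⟶a ∘ fsuc)))

  module _ {n} {A M : Matrix n} (family : EigenFamily A e n) (μ : Fin n → ℝ)
           (M-eigen : ∀ l → Eigenspace M (μ l) (EigenFamily.vec family l)) where
    open EigenFamily family
    open Calculus family

    private
      P : Fin n → Matrix n
      P l i j = weight l * (vec l i * vec l j)

    M-P : ∀ l i j → sum (λ r → M i r * P l r j) ≈ μ l * P l i j
    M-P l i j = begin
      sum (λ r → M i r * (weight l * (vec l r * vec l j)))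
        ≈⟨ sum-cong-≋ (λ r → solve 4 (λ m w v u → m :* (w :* (v :* u)) := (w :* u) :* (m :* v)) (M i r) (weight l) (vec l r) (vec l j)) ⟩
      sum (λ r → (weight l * vec l j) * (M i r * vec l r))
        ≈⟨ sym (*-distribˡ-sum (weight l * vec l j) (λ r → M i r * vec l r)) ⟩
      (weight l * vec l j) * (M · vec l) i
        ≈⟨ *-congˡ (M-eigen l i) ⟩
      (weight l * vec l j) * (μ l * vec l i)
        ≈⟨ solve 4 (λ w u m v → (w :* u) :* (m :* v) := m :* (w :* (v :* u))) (weight l) (vec l j) (μ l) (vec l i) ⟩
      μ l * P l i j ∎
      where open ≈-Reasoning

    module _ (τ : ℝ) where
      private
        w : ℂ
        w = C.- (𝕚 C.* ofReal τ)
        W : CL.Matrix n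
        W = CL.scaleᴹ w (λ i j → ofReal (M i j))
        z : Fin n → ℂ
        z l = w C.* ofReal (μ l)

      phase : Fin n → ℂ
      phase l = cis (- (τ * μ l))

      z≈ : ∀ l → z l C.≈ (0# +i (- (τ * μ l)))
      z≈ l = solve 2 (λ t m → :- (0ₚ :* t :- 1ₚ :* 0ₚ) :* m :- :- (0ₚ :* 0ₚ :+ 1ₚ :* t) :* 0ₚ := 0ₚ) τ (μ l)
           , solve 2 (λ t m → :- (0ₚ :* t :- 1ₚ :* 0ₚ) :* 0ₚ :+ :- (0ₚ :* 0ₚ :+ 1ₚ :* t) :* m := :- (t :* m)) τ (μ l)

      power-spectral : ∀ m i j → (W CL.^^ m) i j C.≈ CL.sum (λ l → z l ^ᶜ m C.* ofReal (P l i j))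
      power-spectral zero i j = begin
        CL.e i j
          ≈⟨ C.trans (ofReal-e i j) (ofReal-cong (sym (resolution i j))) ⟩
        ofReal (sum (λ l → P l i j))
          ≈⟨ ofReal-sum (λ l → P l i j) ⟩
        CL.sum (λ l → ofReal (P l i j))
          ≈⟨ CL.sum-cong-≋ (λ l → C.sym (C.*-identityˡ (ofReal (P l i j)))) ⟩
        CL.sum (λ l → C.1# C.* ofReal (P l i j)) ∎
        where open import Relation.Binary.Reasoning.Setoid C.setoid
      power-spectral (suc m) i j = begin
        CL.sum (λ r → W i r C.* (W CL.^^ m) r j)
          ≈⟨ CL.sum-cong-≋ (λ r → C.trans (C.*-congˡ {W i r} (power-spectral m r j))
               (C.trans (CL.*-distribˡ-sum (W i r) (λ l → z l ^ᶜ m C.* ofReal (P l r j)))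
                 (CL.sum-cong-≋ (λ l → S.solve 4 (λ w m z p → (w S.:* m) S.:* (z S.:* p) S.:= (z S.:* w) S.:* (m S.:* p))
                   w (ofReal (M i r)) (z l ^ᶜ m) (ofReal (P l r j)))))) ⟩
        CL.sum (λ r → CL.sum (λ l → (z l ^ᶜ m C.* w) C.* (ofReal (M i r) C.* ofReal (P l r j))))
          ≈⟨ CL.∑-comm (λ r l → (z l ^ᶜ m C.* w) C.* (ofReal (M i r) C.* ofReal (P l r j))) ⟩
        CL.sum (λ l → CL.sum (λ r → (z l ^ᶜ m C.* w) C.* (ofReal (M i r) C.* ofReal (P l r j))))
          ≈⟨ CL.sum-cong-≋ (λ l → column l) ⟩
        CL.sum (λ l → z l ^ᶜ suc m C.* ofReal (P l i j)) ∎
        where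
        open import Relation.Binary.Reasoning.Setoid C.setoid
        column : ∀ l → CL.sum (λ r → (z l ^ᶜ m C.* w) C.* (ofReal (M i r) C.* ofReal (P l r j))) C.≈
                       z l ^ᶜ suc m C.* ofReal (P l i j)
        column l = begin
          CL.sum (λ r → (z l ^ᶜ m C.* w) C.* (ofReal (M i r) C.* ofReal (P l r j)))
            ≈⟨ C.sym (CL.*-distribˡ-sum (z l ^ᶜ m C.* w) (λ r → ofReal (M i r) C.* ofReal (P l r j))) ⟩
          (z l ^ᶜ m C.* w) C.* CL.sum (λ r → ofReal (M i r) C.* ofReal (P l r j))
            ≈⟨ C.*-congˡ {z l ^ᶜ m C.* w} (C.trans (CL.sum-cong-≋ (λ r → ofReal-* (M i r) (P l r j)))
                 (C.trans (C.sym (ofReal-sum (λ r → M i r * P l r j)))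
                   (C.trans (ofReal-cong (M-P l i j)) (C.sym (ofReal-* (μ l) (P l i j)))))) ⟩
          (z l ^ᶜ m C.* w) C.* (ofReal (μ l) C.* ofReal (P l i j))
            ≈⟨ S.solve 4 (λ z w m p → (z S.:* w) S.:* (m S.:* p) S.:= ((w S.:* m) S.:* z) S.:* p)
                 (z l ^ᶜ m) w (ofReal (μ l)) (ofReal (P l i j)) ⟩
          z l ^ᶜ suc m C.* ofReal (P l i j) ∎

      -- Exchanging the two finite sums leaves one scalar exponential series per basis vector, which
      -- reduces entrywise convergence to that of `exp`.
      partialSum-spectral : ∀ N i j → expPartialSum W N i j C.≈ CL.sum (λ l → CP.Σ< (expTermᶜ (z l)) N C.* ofReal (P l i j))
      partialSum-spectral N i j = begin
        CL.sum {N} (λ m → inv m C.* (W CL.^^ toℕ m) i j)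
          ≈⟨ CL.sum-cong-≋ {N} (λ m → C.trans (C.*-congˡ {inv m} (power-spectral (toℕ m) i j))
               (C.trans (CL.*-distribˡ-sum (inv m) (λ l → z l ^ᶜ toℕ m C.* ofReal (P l i j)))
                 (CL.sum-cong-≋ (λ l → C.trans (C.sym (C.*-assoc (inv m) (z l ^ᶜ toℕ m) (ofReal (P l i j))))
                   (C.*-congʳ {ofReal (P l i j)} (powerᶜ/!≈expTermᶜ (z l) (toℕ m))))))) ⟩
        CL.sum {N} (λ m → CL.sum (λ l → expTermᶜ (z l) (toℕ m) C.* ofReal (P l i j)))
          ≈⟨ CL.∑-comm {N} (λ m l → expTermᶜ (z l) (toℕ m) C.* ofReal (P l i j)) ⟩
        CL.sum (λ l → CL.sum {N} (λ m → expTermᶜ (z l) (toℕ m) C.* ofReal (P l i j)))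
          ≈⟨ CL.sum-cong-≋ (λ l → C.sym (CL.*-distribʳ-sum {N} (ofReal (P l i j)) (λ m → expTermᶜ (z l) (toℕ m)))) ⟩
        CL.sum (λ l → CP.Σ< (expTermᶜ (z l)) N C.* ofReal (P l i j)) ∎
        where
        open import Relation.Binary.Reasoning.Setoid C.setoid
        inv : Fin N → ℂ
        inv m = ofReal (fromℕ (toℕ m !) ⁻¹)

      U : CL.Matrix n
      U i j = CL.sum (λ l → phase l C.* ofReal (P l i j))

      partialSum⟶U : ∀ i j → (λ N → expPartialSum W N i j) ⟶ᶜ U i j
      partialSum⟶U i j = ⟶ᶜ-cong (λ N → C.sym {expPartialSum W N i j} (partialSum-spectral N i j)) (C.refl {U i j})
        (⟶ᶜ-sum λ l → ⟶ᶜ-* {CP.Σ< (expTermᶜ (z l))} {λ _ → ofReal (P l i j)} {phase l} {ofReal (P l i j)}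
          (⟶ᶜ-cong (λ _ → C.refl) (exp-cong (z≈ l)) (exp-limit (z l))) (⟶-const (P l i j) , ⟶-const 0#))

      U-isExp : IsExp W U
      U-isExp = partialSum⟶U

      IsExp⇒≈U : ∀ {V} → IsExp W V → ∀ i j → V i j C.≈ U i j
      IsExp⇒≈U V-isExp i j = ⟶ᶜ-unique (V-isExp i j) (partialSum⟶U i j)

      -- The equation U e_a = γ e_b paired with each basis vector, which diagonalises U.
      PhaseCondition : Fin n → Fin n → Set
      PhaseCondition a b = ∃ λ γ → UnitModulus γ × (∀ l → phase l C.* ofReal (vec l a) C.≈ γ C.* ofReal (vec l b))

      re-U : ∀ i j → re (U i j) ≈ withEigenvalues (re ∘ phase) i j
      re-U i j = re-sum phase (λ l → P l i j)

      im-U : ∀ i j → im (U i j) ≈ withEigenvalues (im ∘ phase) i j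
      im-U i j = im-sum phase (λ l → P l i j)

      -- The eigenbasis is real, so the complex equation splits into two real ones; this and its
      -- converse are applied once to real and once to imaginary parts.
      pairing-from-column : ∀ {c g a b} → (∀ p → withEigenvalues c p a ≈ g * e b p) →
                            ∀ l → c l * vec l a ≈ g * vec l b
      pairing-from-column {c} {g} {a} {b} column l = begin
        c l * vec l a
          ≈⟨ *-congˡ (sym (⟨vec,e⟩ l a)) ⟩
        c l * ⟨ vec l , e a ⟩
          ≈⟨ sym (⟨vec,withEigenvalues⟩ c (e a) l) ⟩
        ⟨ vec l , withEigenvalues c · e a ⟩
          ≈⟨ ⟨⟩-cong {x = vec l} (λ _ → refl) (λ p → trans (·-e (withEigenvalues c) a p) (column p)) ⟩
        ⟨ vec l , scale g (e b) ⟩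
          ≈⟨ trans (⟨⟩-scaleʳ (vec l) g (e b)) (*-congˡ (⟨vec,e⟩ l b)) ⟩
        g * vec l b ∎
        where open ≈-Reasoning

      column-from-pairing : ∀ {c g a b} → (∀ l → c l * vec l a ≈ g * vec l b) →
                            ∀ p → withEigenvalues c p a ≈ g * e b p
      column-from-pairing {c} {g} {a} {b} pairing p = begin
        withEigenvalues c p a
          ≈⟨ sum-cong-≋ (λ l → trans
               (solve 4 (λ c w v u → c :* (w :* (v :* u)) := (c :* u) :* (w :* v)) (c l) (weight l) (vec l p) (vec l a))
               (trans (*-congʳ (pairing l))
                 (solve 4 (λ g u w v → (g :* u) :* (w :* v) := g :* (w :* (v :* u))) g (vec l b) (weight l) (vec l p)))) ⟩
        sum (λ l → g * P l p b)
          ≈⟨ sym (*-distribˡ-sum g (λ l → P l p b)) ⟩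
        g * sum (λ l → P l p b)
          ≈⟨ *-congˡ (trans (resolution p b) (e-symmetric p b)) ⟩
        g * e b p ∎
        where open ≈-Reasoning

      transferTime⇒phase : ∀ {a b} → TransferTime M a b τ → PhaseCondition a b
      transferTime⇒phase {a} {b} (_ , V , V-isExp , γ , ∣γ∣≈1 , Vea≋γeb) = γ , ∣γ∣≈1 , λ l →
          trans (re-*ofReal (phase l) (vec l a)) (trans
            (pairing-from-column {re ∘ phase} {re γ} {a} {b} reColumn l) (sym (re-*ofReal γ (vec l b))))
        , trans (im-*ofReal (phase l) (vec l a)) (trans
            (pairing-from-column {im ∘ phase} {im γ} {a} {b} imColumn l) (sym (im-*ofReal γ (vec l b))))
        where
        column : ∀ p → U p a C.≈ γ C.* ofReal (e b p)
        column p = C.trans (C.sym {V p a} (IsExp⇒≈U {V} V-isExp p a))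
          (C.trans (C.sym {x = (V CL.· CL.e a) p} (CL.·-e V a p)) (C.trans (Vea≋γeb p) (C.*-congˡ {γ} (ofReal-e b p))))
        reColumn : ∀ p → withEigenvalues (re ∘ phase) p a ≈ re γ * e b p
        reColumn p = trans (sym (re-U p a)) (trans (proj₁ (column p)) (re-*ofReal γ (e b p)))
        imColumn : ∀ p → withEigenvalues (im ∘ phase) p a ≈ im γ * e b p
        imColumn p = trans (sym (im-U p a)) (trans (proj₂ (column p)) (im-*ofReal γ (e b p)))

      phase⇒transferTime : ∀ {a b} → 0# < τ → PhaseCondition a b → TransferTime M a b τ
      phase⇒transferTime {a} {b} 0<τ (γ , ∣γ∣≈1 , pairing) = 0<τ , U , U-isExp , γ , ∣γ∣≈1 , λ p →
        C.trans (CL.·-e U a p) (C.trans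
          ( trans (re-U p a) (trans (column-from-pairing {re ∘ phase} {re γ} {a} {b} rePairing p) (sym (re-*ofReal γ (e b p))))
          , trans (im-U p a) (trans (column-from-pairing {im ∘ phase} {im γ} {a} {b} imPairing p) (sym (im-*ofReal γ (e b p)))) )
          (C.*-congˡ {γ} (C.sym {CL.e b p} (ofReal-e b p))))
        where
        rePairing : ∀ l → re (phase l) * vec l a ≈ re γ * vec l b
        rePairing l = trans (sym (re-*ofReal (phase l) (vec l a))) (trans (proj₁ (pairing l)) (re-*ofReal γ (vec l b)))
        imPairing : ∀ l → im (phase l) * vec l a ≈ im γ * vec l b
        imPairing l = trans (sym (im-*ofReal (phase l) (vec l a))) (trans (proj₂ (pairing l)) (im-*ofReal γ (vec l b)))

-- Greatest common divisors over a decidable set of indices.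

module FiniteGCD where
  open import Data.Integer.Solver using (module +-*-Solver)

  select : ∀ {P : Set} → Dec P → ℕ → ℕ
  select (yes _) d = d
  -- The value 0 is neutral for the gcd.
  select (no _)  _ = 0

  gcdOn : ∀ {n} {J : Fin n → Set} → (∀ l → Dec (J l)) → (Fin n → ℕ) → ℕ
  gcdOn {zero}  J? D = 0
  gcdOn {suc n} J? D = gcd (select (J? fzero) (D fzero)) (gcdOn (J? ∘ fsuc) (D ∘ fsuc))

  private
    select-yes : ∀ {P : Set} {Q : ℕ → Set} (P? : Dec P) {d} → P → Q (select P? d) → Q d
    select-yes (yes _) _ q = q
    select-yes (no ¬p) p _ = ⊥-elim (¬p p)

    select-cases : ∀ {P : Set} {Q : ℕ → Set} (P? : Dec P) {d} → Q 0 → (P → Q d) → Q (select P? d)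
    select-cases (yes p) _  q = q p
    select-cases (no _)  q0 _ = q0

  gcdOn-∣ : ∀ {n} {J : Fin n → Set} (J? : ∀ l → Dec (J l)) D {l} → J l → gcdOn J? D ℕ.∣ D l
  gcdOn-∣ {suc n} J? D {fzero}  j = select-yes {Q = gcdOn J? D ℕ.∣_} (J? fzero) j (ℕ.gcd[m,n]∣m _ _)
  gcdOn-∣ {suc n} J? D {fsuc l} j = ℕ.∣-trans (ℕ.gcd[m,n]∣n (select (J? fzero) (D fzero)) _) (gcdOn-∣ (J? ∘ fsuc) (D ∘ fsuc) j)

  -- Serves for two predicates: being a multiple of d, and being an m with sin(m θ) = 0.
  gcdOn-closed : ∀ {n} {J : Fin n → Set} (J? : ∀ l → Dec (J l)) D (Q : ℕ → Set) → Q 0 →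
                 (∀ {x y} → Q x → Q y → Q (gcd x y)) → (∀ l → J l → Q (D l)) → Q (gcdOn J? D)
  gcdOn-closed {zero}  J? D Q q0 q-gcd q = q0
  gcdOn-closed {suc n} J? D Q q0 q-gcd q = q-gcd (select-cases {Q = Q} (J? fzero) q0 (q fzero))
    (gcdOn-closed (J? ∘ fsuc) (D ∘ fsuc) Q q0 q-gcd (q ∘ fsuc))

  gcdOn-greatest : ∀ {n} {J : Fin n → Set} (J? : ∀ l → Dec (J l)) D {d} →
                   (∀ l → J l → d ℕ.∣ D l) → d ℕ.∣ gcdOn J? D
  gcdOn-greatest J? D {d} = gcdOn-closed J? D (d ℕ.∣_) (d ℕ.∣0) ℕ.gcd-greatest

  telescope : ∀ {d} i j l → d ℤ.∣ i ℤ.- j → d ℤ.∣ l ℤ.- j → d ℤ.∣ i ℤ.- l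
  telescope {d} i j l d∣i-j d∣l-j = ≡.subst (d ℤ.∣_)
    (solve 3 (λ i j l → (i :- j) :- (l :- j) := i :- l) ≡.refl i j l) (ℤ.∣m∣n⇒∣m-n d∣i-j d∣l-j)
    where open +-*-Solver

  ≡⇒∣difference : ∀ {d i j} → i ≡ j → d ℤ.∣ i ℤ.- j
  ≡⇒∣difference {i = i} i≡j = ℤ.divides (+ 0) (ℤ.i≡j⇒i-j≡0 i≡j)

-- Integers among the reals, and gcds of differences.

module IntegersInReals (em : ExcludedMiddle 0ℓ) (ℛ : CompleteOrderedField) where
  open OrderedField ℛ
  open Limits em ℛ
  open RealAnalysis ℛ
  open import Algebra.Properties.Semiring.Mult.TCOptimised semiring using (×ᵤ≈×)
  open import Algebra.Properties.Semiring.Mult semiring using (×1-homo-*)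
  open import Algebra.Definitions.RawSemiring (RawRing.rawSemiring (CommutativeRing.rawRing ℝ-ring)) using (_^_)

  fromℤ≈ι : ∀ i → fromℤ i ≈ ι i
  fromℤ≈ι (+ m)    = ×ᵤ≈× m 1#
  fromℤ≈ι -[1+ m ] = -‿cong (×ᵤ≈× (suc m) 1#)

  fromℤ-+ : ∀ i j → fromℤ (i ℤ.+ j) ≈ fromℤ i + fromℤ j
  fromℤ-+ i j = trans (fromℤ≈ι (i ℤ.+ j)) (trans (ι-+ i j) (sym (+-cong (fromℤ≈ι i) (fromℤ≈ι j))))

  fromℤ-* : ∀ i j → fromℤ (i ℤ.* j) ≈ fromℤ i * fromℤ j
  fromℤ-* i j = trans (fromℤ≈ι (i ℤ.* j)) (trans (ι-* i j) (sym (*-cong (fromℤ≈ι i) (fromℤ≈ι j))))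

  fromℤ-neg : ∀ i → fromℤ (ℤ.- i) ≈ - fromℤ i
  fromℤ-neg i = trans (fromℤ≈ι (ℤ.- i)) (trans (ι-neg i) (-‿cong (sym (fromℤ≈ι i))))

  fromℤ-- : ∀ i j → fromℤ (i ℤ.- j) ≈ fromℤ i - fromℤ j
  fromℤ-- i j = trans (fromℤ-+ i (ℤ.- j)) (+-congˡ (fromℤ-neg j))

  fromℤ-^ : ∀ i k → fromℤ (i ℤ.^ k) ≈ fromℤ i ^ k
  fromℤ-^ i zero    = +-identityʳ 1#
  fromℤ-^ i (suc k) = trans (fromℤ-* i (i ℤ.^ k)) (*-congˡ (fromℤ-^ i k))

  fromℤ≈0⇒≡0 : ∀ i → fromℤ i ≈ 0# → i ≡ + 0
  fromℤ≈0⇒≡0 (+ zero)  _    = ≡.refl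
  fromℤ≈0⇒≡0 (+ suc m) i≈0  = ⊥-elim (0<⇒≉0 (0<fromℕ-suc m) i≈0)
  fromℤ≈0⇒≡0 -[1+ m ]  i≈0  = ⊥-elim (0<⇒≉0 (0<fromℕ-suc m)
    (trans (solve 1 (λ x → x := :- :- x) (fromℕ (suc m))) (trans (-‿cong i≈0) (solve 0 (:- 0ₚ := 0ₚ)))))

  fromℤ-injective : ∀ {i j} → fromℤ i ≈ fromℤ j → i ≡ j
  fromℤ-injective {i} {j} i≈j = ℤ.i-j≡0⇒i≡j i j (fromℤ≈0⇒≡0 (i ℤ.- j) (trans (fromℤ-- i j) (x≈y⇒x-y≈0 i≈j)))

  ∣fromℤ∣ : ∀ i → ∣ fromℤ i ∣ ≈ fromℕ ℤ.∣ i ∣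
  ∣fromℤ∣ (+ m)    = 0≤x⇒∣x∣≈x (0≤fromℕ m)
  ∣fromℤ∣ -[1+ m ] = trans (x≤0⇒∣x∣≈-x (≤-by (fromℕ (suc m)) (<⇒≤ (0<fromℕ-suc m)) (sym (-‿inverseˡ _))))
    (solve 1 (λ x → :- :- x := x) (fromℕ (suc m)))

  module DifferenceGCD {n} {J : Fin n → Set} (J? : ∀ l → Dec (J l)) (N : Fin n → ℤ) where
    open FiniteGCD

    δ : Fin n → ℕ
    δ j = gcdOn J? (λ l → ℤ.∣ N l ℤ.- N j ∣)

    δ-divides : ∀ j l → J l → + δ j ℤ.∣ N l ℤ.- N j
    δ-divides j l Jl = ℤ.∣ᵤ⇒∣ (gcdOn-∣ J? (λ l → ℤ.∣ N l ℤ.- N j ∣) Jl)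

    -- Membership is translated only up to `≈`, because S is not assumed to respect the equality of
    -- ℝ.
    module _ {S : ℝ → Set} (S⇒index : ∀ {η} → S η → ∃ λ l → J l × η ≈ fromℤ (N l))
             (index⇒S : ∀ l → J l → ∃ λ η → S η × η ≈ fromℤ (N l)) where

      distance : ∀ {η η₁} l j → η ≈ fromℤ (N l) → η₁ ≈ fromℤ (N j) → ∣ η - η₁ ∣ ≈ fromℕ ℤ.∣ N l ℤ.- N j ∣
      distance l j η≈ η₁≈ = trans (∣∣-cong (trans (+-cong η≈ (-‿cong η₁≈)) (sym (fromℤ-- (N l) (N j))))) (∣fromℤ∣ (N l ℤ.- N j))

      -- Independence of the base point: the gcd is computed at index j, but the differences are
      -- taken from η₁. Every N l - N j₁ is a difference of two differences from N j, and
      -- conversely. The excluded case η ≈ η₁ contributes 0, which everything divides.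
      isGCD : ∀ j {η₁ j₁} → J j → J j₁ → η₁ ≈ fromℤ (N j₁) → IsGCD (Differences S η₁) (δ j)
      isGCD j {η₁} {j₁} Jj Jj₁ η₁≈ = divides , greatest
        where
        divides : ∀ s → Differences S η₁ s → δ j Divides s
        divides s (η , Sη , _ , s≈) = fromIndex (S⇒index Sη)
          where
          fromIndex : (∃ λ l → J l × η ≈ fromℤ (N l)) → δ j Divides s
          fromIndex (l , Jl , η≈) = + q , trans s≈ (trans (distance l j₁ η≈ η₁≈)
              (trans (reflexive (≡.cong fromℕ eq)) (×1-homo-* q (δ j))))
            where
            δ∣ : δ j ℕ.∣ ℤ.∣ N l ℤ.- N j₁ ∣
            δ∣ = ℤ.∣⇒∣ᵤ (telescope (N l) (N j) (N j₁) (δ-divides j l Jl) (δ-divides j j₁ Jj₁))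
            q = ℕ._∣_.quotient δ∣
            eq = ℕ._∣_.equality δ∣
        greatest : ∀ d → (∀ s → Differences S η₁ s → d Divides s) → d ℕ.∣ δ j
        greatest d d-divides = gcdOn-greatest J? (λ l → ℤ.∣ N l ℤ.- N j ∣) λ l Jl →
            ℤ.∣⇒∣ᵤ (telescope (N l) (N j₁) (N j) (d∣ l Jl (index⇒S l Jl)) (d∣ j Jj (index⇒S j Jj)))
          where
          d∣ : ∀ l → J l → (∃ λ η → S η × η ≈ fromℤ (N l)) → + d ℤ.∣ N l ℤ.- N j₁
          d∣ l Jl (η , Sη , η≈) = decide (η ≟ η₁)
            where
            decide : Dec (η ≈ η₁) → + d ℤ.∣ N l ℤ.- N j₁
            decide (yes η≈η₁) = ≡⇒∣difference {i = N l} {N j₁} (fromℤ-injective (trans (sym η≈) (trans η≈η₁ η₁≈)))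
            decide (no η≉η₁) = ℤ.∣ᵤ⇒∣ (ℤ.∣⇒∣ᵤ {+ d} {+ ℤ.∣ N l ℤ.- N j₁ ∣} (ℤ.divides m (fromℤ-injective
                (trans (sym (distance l j₁ η≈ η₁≈)) (trans s≈md (sym (fromℤ-* m (+ d))))))))
              where
              m = proj₁ (d-divides _ (η , Sη , η≉η₁ , refl))
              s≈md = proj₂ (d-divides _ (η , Sη , η≉η₁ , refl))

-- The minimum transfer time for eigenvalues w N l.

module MinimalTransferTime (em : ExcludedMiddle 0ℓ) (ℛ : CompleteOrderedField) where
  open OrderedField ℛ
  open SpectralCalculus ℛ using (EigenFamily; module Calculus)
  open LinearAlgebra ℝ-ring
  open ComplexExponential em ℛ
  open Trigonometry em ℛ
  open SineSeries em ℛ using (isPi)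
  open TransferCriterion em ℛ
  open IntegersInReals em ℛ
  open FiniteGCD using (gcdOn-closed)
  open RealAnalysis ℛ using (Eigenspace; UnitModulus; TransferTime; fromℕ; fromℤ; IsPi; IsLeast)
  open import Algebra.Properties.Semiring.Mult semiring using (×-homo-+; ×1-homo-*)

  UnitModulus-* : ∀ {z w} → UnitModulus z → UnitModulus w → UnitModulus (z C.* w)
  UnitModulus-* {z} {w} ∣z∣≈1 ∣w∣≈1 = trans
    (solve 4 (λ a b c d → (a :* c :- b :* d) :* (a :* c :- b :* d) :+ (a :* d :+ b :* c) :* (a :* d :+ b :* c)
                := (a :* a :+ b :* b) :* (c :* c :+ d :* d)) (re z) (im z) (re w) (im w))
    (trans (*-cong ∣z∣≈1 ∣w∣≈1) (*-identityˡ 1#))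

  -- The Bézout identity is used with natural coefficients, gcd + j y = i x, up to exchanging x and
  -- y.
  sin-zero-gcd : ∀ θ {x y} → sin (fromℕ x * θ) ≈ 0# → sin (fromℕ y * θ) ≈ 0# → sin (fromℕ (gcd x y) * θ) ≈ 0#
  sin-zero-gcd θ {x} {y} sx≈0 sy≈0 = fromBézout (ℕ.Bézout.identity (ℕ.gcd-GCD x y))
    where
    sin-difference : ∀ d i j x y → sin (fromℕ x * θ) ≈ 0# → sin (fromℕ y * θ) ≈ 0# →
                     d ℕ.+ j ℕ.* y ≡ i ℕ.* x → sin (fromℕ d * θ) ≈ 0#
    sin-difference d i j x y sx≈0 sy≈0 eq = trans (proj₂ (cis-cong angle))
        (sin-zero-+ (sin-zero-ℕ-multiple sx≈0 i) (sin-zero-neg (sin-zero-ℕ-multiple sy≈0 j)))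
      where
      open ≈-Reasoning
      d+jy≈ix : fromℕ d + fromℕ j * fromℕ y ≈ fromℕ i * fromℕ x
      d+jy≈ix = trans (sym (trans (×-homo-+ 1# d (j ℕ.* y)) (+-congˡ (×1-homo-* j y))))
        (trans (reflexive (≡.cong fromℕ eq)) (×1-homo-* i x))
      angle : fromℕ d * θ ≈ fromℕ i * (fromℕ x * θ) + - (fromℕ j * (fromℕ y * θ))
      angle = begin
        fromℕ d * θ
          ≈⟨ solve 4 (λ d j y t → d :* t := (d :+ j :* y) :* t :+ :- (j :* (y :* t))) (fromℕ d) (fromℕ j) (fromℕ y) θ ⟩
        (fromℕ d + fromℕ j * fromℕ y) * θ + - (fromℕ j * (fromℕ y * θ))
          ≈⟨ +-congʳ (trans (*-congʳ d+jy≈ix) (*-assoc _ _ _)) ⟩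
        fromℕ i * (fromℕ x * θ) + - (fromℕ j * (fromℕ y * θ)) ∎
    fromBézout : ℕ.Bézout.Identity (gcd x y) x y → sin (fromℕ (gcd x y) * θ) ≈ 0#
    fromBézout (ℕ.Bézout.+- i j eq) = sin-difference (gcd x y) i j x y sx≈0 sy≈0 eq
    fromBézout (ℕ.Bézout.-+ i j eq) = sin-difference (gcd x y) j i y x sy≈0 sx≈0 eq

  sin-zero-abs : ∀ θ i → sin (fromℤ i * θ) ≈ 0# → sin (fromℕ ℤ.∣ i ∣ * θ) ≈ 0#
  sin-zero-abs θ (+ m)    s≈0 = s≈0
  sin-zero-abs θ -[1+ m ] s≈0 = trans
    (proj₂ (cis-cong (solve 2 (λ m t → m :* t := :- (:- m :* t)) (fromℕ (suc m)) θ))) (sin-zero-neg s≈0)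

  module _ {n} {A M : Matrix n} (family : EigenFamily A e n) (μ : Fin n → ℝ)
           (M-eigen : ∀ l → Eigenspace M (μ l) (EigenFamily.vec family l)) where
    open EigenFamily family
    open Calculus family

    module _ {a b : Fin n} (a≢b : a ≢ b) {w : ℝ} (0<w : 0# < w) (N : Fin n → ℤ)
             (μ≈wN : ∀ l → ¬ (vec l a ≈ 0#) → μ l ≈ w * fromℤ (N l))
             (l₀ : Fin n) (l₀∈J : ¬ (vec l₀ a ≈ 0#)) where

      Active : Fin n → Set
      Active l = ¬ (vec l a ≈ 0#)

      active? : ∀ l → Dec (Active l)
      active? l = em

      open DifferenceGCD {J = Active} active? N using (δ; δ-divides)

      private
        d = δ l₀
        F = family
        q : ∀ l → Active l → ℤ
        q l Jl = ℤ._∣_.quotient (δ-divides l₀ l Jl)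

      N≈ : ∀ l (Jl : Active l) → fromℤ (N l) ≈ fromℤ (N l₀) + fromℤ (q l Jl) * fromℕ d
      N≈ l Jl = begin
        fromℤ (N l)
          ≈⟨ solve 2 (λ a b → a := b :+ (a :- b)) (fromℤ (N l)) (fromℤ (N l₀)) ⟩
        fromℤ (N l₀) + (fromℤ (N l) - fromℤ (N l₀))
          ≈⟨ +-congˡ (trans (sym (fromℤ-- (N l) (N l₀))) (trans
               (reflexive (≡.cong fromℤ (ℤ._∣_.equality (δ-divides l₀ l Jl)))) (fromℤ-* (q l Jl) (+ d)))) ⟩
        fromℤ (N l₀) + fromℤ (q l Jl) * fromℕ d ∎
        where open ≈-Reasoning

      module AtTime (τ : ℝ) where
        u : ℝ
        u = fromℕ d * (τ * w)

        base : ℂ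
        base = cis (- (τ * w * fromℤ (N l₀)))

        -- As d divides N l - N l₀, the phases relative to l₀ depend on the time only through
        -- integer multiples of the one angle u.
        phase-split : ∀ l Jl → phase F μ M-eigen τ l C.≈ base C.* cis (fromℤ (q l Jl) * - u)
        phase-split l Jl = C.trans (cis-cong (begin
            - (τ * μ l)
              ≈⟨ -‿cong (*-congˡ (trans (μ≈wN l Jl) (*-congˡ (N≈ l Jl)))) ⟩
            - (τ * (w * (fromℤ (N l₀) + fromℤ (q l Jl) * fromℕ d)))
              ≈⟨ solve 5 (λ t w n q d → :- (t :* (w :* (n :+ q :* d))) := :- (t :* w :* n) :+ q :* :- (d :* (t :* w)))
                   τ w (fromℤ (N l₀)) (fromℤ (q l Jl)) (fromℕ d) ⟩
            - (τ * w * fromℤ (N l₀)) + fromℤ (q l Jl) * - u ∎))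
          (cis-+ (- (τ * w * fromℤ (N l₀))) (fromℤ (q l Jl) * - u))
          where open ≈-Reasoning

      -- Relative to l₀ all phases are real, being products of two ratios vec l b / vec l a up to |γ|² = 1.
      module WithPhase (τ : ℝ) (phaseCondition : PhaseCondition F μ M-eigen τ a b) where
        open AtTime τ public
        γ = proj₁ phaseCondition
        ∣γ∣≈1 = proj₁ (proj₂ phaseCondition)
        pairing = proj₂ (proj₂ phaseCondition)
        E = phase F μ M-eigen τ

        rePairing : ∀ l → re (E l) * vec l a ≈ re γ * vec l b
        rePairing l = trans (sym (re-*ofReal (E l) (vec l a))) (trans (proj₁ (pairing l)) (re-*ofReal γ (vec l b)))

        imPairing : ∀ l → im (E l) * vec l a ≈ im γ * vec l b
        imPairing l = trans (sym (im-*ofReal (E l) (vec l a))) (trans (proj₂ (pairing l)) (im-*ofReal γ (vec l b)))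

        sin-N-difference : ∀ l → Active l → sin (fromℤ (N l ℤ.- N l₀) * (τ * w)) ≈ 0#
        sin-N-difference l Jl = begin
          sin (fromℤ (N l ℤ.- N l₀) * (τ * w))
            ≈⟨ proj₂ (cis-cong (trans (*-congʳ (fromℤ-- (N l) (N l₀)))
                 (solve 4 (λ t w n m → (n :- m) :* (t :* w) := :- (t :* (w :* m)) :+ :- :- (t :* (w :* n)))
                   τ w (fromℤ (N l)) (fromℤ (N l₀))))) ⟩
          sin (- (τ * (w * fromℤ (N l₀))) + - - (τ * (w * fromℤ (N l))))
            ≈⟨ proj₂ (cis-cong (sym (+-cong (-‿cong (*-congˡ (μ≈wN l₀ l₀∈J))) (-‿cong (-‿cong (*-congˡ (μ≈wN l Jl))))))) ⟩
          sin (- (τ * μ l₀) + - - (τ * μ l))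
            ≈⟨ proj₂ (C.trans (cis-+ (- (τ * μ l₀)) (- - (τ * μ l))) (C.*-congˡ {E l₀} (cis-neg (- (τ * μ l))))) ⟩
          re (E l₀) * - im (E l) + im (E l₀) * re (E l)
            -- Multiplied by x_l₀(a) x_l(a), the expression becomes the imaginary part of γ times
            -- its conjugate times a real number.
            ≈⟨ *-cancelˡ-0 (*-≉0 l₀∈J Jl) (begin
                 vec l₀ a * vec l a * (re (E l₀) * - im (E l) + im (E l₀) * re (E l))
                   ≈⟨ solve 6 (λ x y c s c′ s′ → x :* y :* (c :* :- s′ :+ s :* c′) := (s :* x) :* (c′ :* y) :- (c :* x) :* (s′ :* y))
                        (vec l₀ a) (vec l a) (re (E l₀)) (im (E l₀)) (re (E l)) (im (E l)) ⟩
                 (im (E l₀) * vec l₀ a) * (re (E l) * vec l a) - (re (E l₀) * vec l₀ a) * (im (E l) * vec l a)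
                   ≈⟨ +-cong (*-cong (imPairing l₀) (rePairing l)) (-‿cong (*-cong (rePairing l₀) (imPairing l))) ⟩
                 (im γ * vec l₀ b) * (re γ * vec l b) - (re γ * vec l₀ b) * (im γ * vec l b)
                   ≈⟨ solve 4 (λ g h x y → (h :* x) :* (g :* y) :- (g :* x) :* (h :* y) := 0ₚ) (re γ) (im γ) (vec l₀ b) (vec l b) ⟩
                 0# ∎) ⟩
          0# ∎
          where open ≈-Reasoning

        sin-u : sin u ≈ 0#
        sin-u = gcdOn-closed active? (λ l → ℤ.∣ N l ℤ.- N l₀ ∣) (λ m → sin (fromℕ m * (τ * w)) ≈ 0#)
          (trans (proj₂ (cis-cong (zeroˡ (τ * w)))) (proj₂ cis-0))
          (λ {x} {y} → sin-zero-gcd (τ * w) {x} {y})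
          (λ l Jl → sin-zero-abs (τ * w) (N l ℤ.- N l₀) (sin-N-difference l Jl))

        -- If all phases agreed, e a and e b would be proportional.
        cis-u≉1 : ¬ (cis u C.≈ C.1#)
        cis-u≉1 cu≈1 = <-irrefl (trans (sym 0≈∣base∣²) (cos²+sin²≈1 (- (τ * w * fromℤ (N l₀))))) 0<1
          where
          open ≈-Reasoning
          cis-q : ∀ j → cis (fromℤ j * - u) C.≈ C.1#
          cis-q j = C.trans (cis-ℤ-multiple (C.trans (cis-neg u) (C.trans (proj₁ cu≈1 , -‿cong (proj₂ cu≈1))
              (C.trans (refl , solve 0 (:- 0ₚ := 0ₚ)) (C.sym cis-0)))) j)
            (C.trans (cis-cong (zeroʳ (fromℤ j))) cis-0)
          samePhase : ∀ l → Active l → E l C.≈ base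
          samePhase l Jl = C.trans (phase-split l Jl) (C.trans (C.*-congˡ {base} (cis-q (q l Jl))) (C.*-identityʳ base))
          -- Taken for the real and the imaginary part. Equal phases give base e_a = γ e_b, whose
          -- right side vanishes at coordinate a; so base = 0, against |base| = 1.
          component : ∀ (f : ℂ → ℝ) → (∀ {z z′} → z C.≈ z′ → f z ≈ f z′) → (∀ l → f (E l) * vec l a ≈ f γ * vec l b) → f base ≈ 0#
          component f f-cong f-pairing = begin
            f base
              ≈⟨ sym (trans (*-congˡ (e-diagonal a)) (*-identityʳ (f base))) ⟩
            f base * e a a
              ≈⟨ *-congˡ (sym (resolution a a)) ⟩
            f base * sum (λ l → weight l * (vec l a * vec l a))
              ≈⟨ *-distribˡ-sum (f base) (λ l → weight l * (vec l a * vec l a)) ⟩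
            withEigenvalues (λ _ → f base) a a
              ≈⟨ column-from-pairing F μ M-eigen τ {λ _ → f base} {f γ} {a} {b} (λ l → sameValue l em) a ⟩
            f γ * e b a
              ≈⟨ trans (*-congˡ (e-offDiagonal (a≢b ∘ ≡.sym))) (zeroʳ (f γ)) ⟩
            0# ∎
            where
            sameValue : ∀ l → Dec (vec l a ≈ 0#) → f base * vec l a ≈ f γ * vec l b
            sameValue l (no Jl)   = trans (*-congʳ (sym (f-cong (samePhase l Jl)))) (f-pairing l)
            sameValue l (yes v≈0) = trans (trans (*-congˡ v≈0) (zeroʳ _))
              (sym (trans (sym (f-pairing l)) (trans (*-congˡ v≈0) (zeroʳ _))))
          0≈∣base∣² : re base * re base + im base * im base ≈ 0#
          0≈∣base∣² = trans (+-cong (*-congˡ (component re proj₁ rePairing)) (*-congˡ (component im proj₂ imPairing)))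
            (solve 2 (λ a b → a :* 0ₚ :+ b :* 0ₚ := 0ₚ) (re base) (im base))

        -- If δ were 0, then u would be 0 at the given transfer time, and cis u would be 1.
        δ≢0 : d ≢ 0
        δ≢0 d≡0 = cis-u≉1 (C.trans (cis-cong (trans (*-congʳ (reflexive (≡.cong fromℕ d≡0))) (zeroˡ (τ * w)))) cis-0)

        cis-u≈-1 : cis u C.≈ (C.- C.1#)
        cis-u≈-1 = x-y≈0⇒x≈y (*-cancelˡ-0 cos-u-1≉0 (begin
            (cos u - 1#) * (cos u - - 1#)
              ≈⟨ solve 2 (λ c s → (c :- 1ₚ) :* (c :- :- 1ₚ) := (c :* c :+ s :* s) :- 1ₚ :- s :* s) (cos u) (sin u) ⟩
            (cos u * cos u + sin u * sin u) - 1# - sin u * sin u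
              ≈⟨ +-cong (+-congʳ (cos²+sin²≈1 u)) (-‿cong (*-congˡ sin-u)) ⟩
            1# - 1# - sin u * 0#
              ≈⟨ solve 1 (λ s → 1ₚ :- 1ₚ :- s :* 0ₚ := 0ₚ) (sin u) ⟩
            0# ∎))
          , trans sin-u (solve 0 (0ₚ := :- 0ₚ))
          where
          open ≈-Reasoning
          cos-u-1≉0 : ¬ (cos u - 1# ≈ 0#)
          cos-u-1≉0 eq = cis-u≉1 (x-y≈0⇒x≈y eq , sin-u)

      module _ {τ : ℝ} (τ-transfer : TransferTime M a b τ) where
        private
          0<τ = proj₁ τ-transfer
          module P = WithPhase τ (transferTime⇒phase F μ M-eigen τ τ-transfer)

        0<fromℕδ : 0# < fromℕ d
        0<fromℕδ = positive d P.δ≢0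
          where
          positive : ∀ m → m ≢ 0 → 0# < fromℕ m
          positive zero    m≢0 = ⊥-elim (m≢0 ≡.refl)
          positive (suc m) _   = 0<fromℕ-suc m

        private
          W = w * fromℕ d
          0<W : 0# < W
          0<W = *-pos 0<w 0<fromℕδ

          W*[x/W]≈x : ∀ x → W * (x / W) ≈ x
          W*[x/W]≈x x = trans (solve 3 (λ W x i → W :* (x :* i) := (W :* i) :* x) W x (W ⁻¹))
            (trans (*-congʳ (x*x⁻¹≈1 0<W)) (*-identityˡ x))

          πZero : ∃ LeastPositiveZero
          πZero = leastPositiveZero (P.u , *-pos 0<fromℕδ (*-pos 0<τ 0<w) , P.sin-u)

        π : ℝ
        π = proj₁ πZero

        0<π : 0# < π
        0<π = proj₁ (proj₂ πZero)

        cis-π≈-1 : cis π C.≈ (C.- C.1#)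
        cis-π≈-1 = cos-leastPositiveZero (proj₂ πZero) , trans (proj₁ (proj₂ (proj₂ πZero))) (solve 0 (0ₚ := :- 0ₚ))

        τ₀ : ℝ
        τ₀ = π / W

        0<τ₀ : 0# < τ₀
        0<τ₀ = *-pos 0<π (0<x⁻¹ 0<W)

        τ₀-lowerBound : ∀ s → TransferTime M a b s → τ₀ ≤ s
        τ₀-lowerBound s s-transfer = *-cancelˡ-≤ 0<W (≤-respˡ-≈ (sym (W*[x/W]≈x π))
          (≤-respʳ-≈ (solve 3 (λ d s w → d :* (s :* w) := w :* d :* s) (fromℕ d) s w)
            (≮⇒≥ λ u<π → proj₂ (proj₂ (proj₂ πZero)) Q.u (*-pos 0<fromℕδ (*-pos (proj₁ s-transfer) 0<w)) u<π Q.sin-u)))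
          where module Q = WithPhase s (transferTime⇒phase F μ M-eigen s s-transfer)

        τ₀-transfer : TransferTime M a b τ₀
        τ₀-transfer = phase⇒transferTime F μ M-eigen τ₀ 0<τ₀
            (γ′ , UnitModulus-* {ρ} {P.γ} (UnitModulus-* {Q.base} {back} (cos²+sin²≈1 _) (cos²+sin²≈1 _)) P.∣γ∣≈1
                , λ l → pairing l em)
          where
          module Q = AtTime τ₀
          module S′ = IntegerCoefficients ℂ-ring
          -- `back` inverts the common factor of the phases at τ, so ρ exchanges it for the one at
          -- τ₀, and γ is multiplied by ρ accordingly.
          back ρ γ′ : ℂ
          back = cis (τ * w * fromℤ (N l₀))
          ρ = Q.base C.* back
          γ′ = ρ C.* P.γ
          Qu≈π : Q.u ≈ π
          Qu≈π = trans (solve 3 (λ d t w → d :* (t :* w) := w :* d :* t) (fromℕ d) τ₀ w) (W*[x/W]≈x π)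
          cis-Qu≈cis-Pu : cis (- Q.u) C.≈ cis (- P.u)
          cis-Qu≈cis-Pu = C.trans (cis-neg Q.u) (C.trans (proj₁ same , -‿cong (proj₂ same)) (C.sym (cis-neg P.u)))
            where
            same : cis Q.u C.≈ cis P.u
            same = C.trans (cis-cong Qu≈π) (C.trans cis-π≈-1 (C.sym P.cis-u≈-1))
          back*base≈1 : back C.* P.base C.≈ C.1#
          back*base≈1 = C.trans (C.sym (cis-+ (τ * w * fromℤ (N l₀)) (- (τ * w * fromℤ (N l₀)))))
            (C.trans (cis-cong (-‿inverseʳ (τ * w * fromℤ (N l₀)))) cis-0)
          phase≈ : ∀ l → Active l → phase F μ M-eigen τ₀ l C.≈ ρ C.* P.E l
          phase≈ l Jl = begin
            phase F μ M-eigen τ₀ l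
              ≈⟨ Q.phase-split l Jl ⟩
            Q.base C.* cis (fromℤ (q l Jl) * - Q.u)
              ≈⟨ C.*-congˡ {Q.base} (cis-ℤ-multiple cis-Qu≈cis-Pu (q l Jl)) ⟩
            Q.base C.* turn
              ≈⟨ C.*-congˡ {Q.base} (C.sym (C.trans (C.*-congʳ {turn} back*base≈1) (C.*-identityˡ turn))) ⟩
            Q.base C.* ((back C.* P.base) C.* turn)
              ≈⟨ S′.solve 4 (λ x y z t → x S′.:* ((y S′.:* z) S′.:* t) S′.:= (x S′.:* y) S′.:* (z S′.:* t)) Q.base back P.base turn ⟩
            ρ C.* (P.base C.* turn)
              ≈⟨ C.*-congˡ {ρ} (C.sym (P.phase-split l Jl)) ⟩
            ρ C.* P.E l ∎
            where
            open import Relation.Binary.Reasoning.Setoid C.setoid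
            turn = cis (fromℤ (q l Jl) * - P.u)
          scaled : ∀ l → ρ C.* (P.E l C.* ofReal (vec l a)) C.≈ γ′ C.* ofReal (vec l b)
          scaled l = C.trans (C.*-congˡ {ρ} (P.pairing l)) (C.sym (C.*-assoc ρ P.γ (ofReal (vec l b))))
          pairing : ∀ l → Dec (vec l a ≈ 0#) → phase F μ M-eigen τ₀ l C.* ofReal (vec l a) C.≈ γ′ C.* ofReal (vec l b)
          pairing l (no Jl) = C.trans (C.*-congʳ {ofReal (vec l a)} (phase≈ l Jl))
            (C.trans (C.*-assoc ρ (P.E l) (ofReal (vec l a))) (scaled l))
          -- Here x_l(a) = 0, and the equation at τ already shows that γ x_l(b) = 0.
          pairing l (yes v≈0) = C.trans (vanish (phase F μ M-eigen τ₀ l))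
            (C.trans (C.sym (C.trans (C.*-congˡ {ρ} (vanish (P.E l))) (C.zeroʳ ρ))) (scaled l))
            where
            vanish : ∀ z → z C.* ofReal (vec l a) C.≈ C.0#
            vanish z = C.trans (C.*-congˡ {z} (ofReal-cong v≈0)) (C.zeroʳ z)

        minimalTransferTime : d ≢ 0 × ∃ λ π → IsPi π × IsLeast (TransferTime M a b) (π / (w * fromℕ d))
        minimalTransferTime = P.δ≢0 , π , isPi (proj₂ πZero) , τ₀-transfer , τ₀-lowerBound

-- Powers of H and of K = H/c in a common eigenbasis.

module Corollary (em : ExcludedMiddle 0ℓ) (ℛ : CompleteOrderedField) where
  open OrderedField ℛ
  open SpectralCalculus ℛ
  open MinimalTransferTime em ℛ using (minimalTransferTime)
  open IntegersInReals em ℛ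
  open RealAnalysis ℛ using (fromℕ; fromℤ; Eigenspace; supp; TransferTime; IsGCD; Differences; IsPi; IsLeast)
  open import Algebra.Definitions.RawSemiring (RawRing.rawSemiring rawRing) using (_^_)
  open import Algebra.Properties.Semiring.Exp semiring using (^-congˡ)
  open import Algebra.Properties.CommutativeSemiring.Exp commutativeSemiring using (^-distrib-*)

  scaleᴹ-· : ∀ {n} s (A : Matrix n) x → scaleᴹ s A · x ≋ scale s (A · x)
  scaleᴹ-· s A x i = trans (sum-cong-≋ (λ j → *-assoc s (A i j) (x j))) (sym (*-distribˡ-sum s (λ j → A i j * x j)))

  ^^-eigen : ∀ {n} {A : Matrix n} {μ x} → Eigenspace A μ x → ∀ k → Eigenspace (A ^^ k) (μ ^ k) x
  ^^-eigen {x = x} Ax≋μx zero i = trans (e-· x i) (sym (*-identityˡ (x i)))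
  ^^-eigen {A = A} {μ} {x} Ax≋μx (suc k) i = begin
    ((A ⊗ (A ^^ k)) · x) i          ≈⟨ ⊗-· A (A ^^ k) x i ⟩
    (A · (A ^^ k) · x) i            ≈⟨ ·-cong A (^^-eigen Ax≋μx k) i ⟩
    (A · scale (μ ^ k) x) i         ≈⟨ ·-scale A (μ ^ k) x i ⟩
    μ ^ k * (A · x) i               ≈⟨ *-congˡ (Ax≋μx i) ⟩
    μ ^ k * (μ * x i)               ≈⟨ solve 3 (λ p m x → p :* (m :* x) := (m :* p) :* x) (μ ^ k) μ (x i) ⟩
    μ ^ suc k * x i                 ∎
    where open ≈-Reasoning

  0<x^k : ∀ {x} → 0# < x → ∀ k → 0# < x ^ k
  0<x^k 0<x zero    = 0<1
  0<x^k 0<x (suc k) = *-pos 0<x (0<x^k 0<x k)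

  module _ {n} {H : Matrix n} (H-sym : Symmetric H) {a b : Fin n} (a≢b : a ≢ b) {c} (0<c : 0# < c)
           (integral : ∀ μ → supp H (e a) μ → ∃ λ m → μ ≈ c * fromℤ m) (k : ℕ) where
    private
      family : EigenFamily H e n
      family = eigenDecomposition H-sym
    open EigenFamily family
    open Calculus family

    private
      K : Matrix n
      K = scaleᴹ (c ⁻¹) H

      S : ℝ → Set
      S = supp (K ^^ k) (e a)

      Active : Fin n → Set
      Active l = ¬ (vec l a ≈ 0#)

      exponentOf : ∀ l → Dec (Active l) → ℤ
      exponentOf l (yes Jl) = proj₁ (integral (val l) (index⇒supp l Jl))
        where open Support (symmetric⇒selfAdjoint H-sym) val eigen a
      -- A default outside the support of e_a, where eigenvalues need not lie in cℤ.
      exponentOf l (no _)   = + 0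

      m N : Fin n → ℤ
      m l = exponentOf l em
      N l = m l ℤ.^ k

      val≈cm : ∀ l → Active l → val l ≈ c * fromℤ (m l)
      val≈cm l Jl = go em
        where
        open Support (symmetric⇒selfAdjoint H-sym) val eigen a
        go : (d : Dec (Active l)) → val l ≈ c * fromℤ (exponentOf l d)
        go (yes Jl′) = proj₂ (integral (val l) (index⇒supp l Jl′))
        go (no ¬Jl)  = ⊥-elim (¬Jl Jl)

      -- The eigenvalues of H^k, which govern the transfer times, and of K^k, which enter the gcd.
      -- On active indices they are c^k N l and N l.
      μ ν : Fin n → ℝ
      μ l = val l ^ k
      ν l = (c ⁻¹ * val l) ^ k

      μ-eigen : ∀ l → Eigenspace (H ^^ k) (μ l) (vec l)
      μ-eigen l = ^^-eigen (eigen l) k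

      ν-eigen : ∀ l → Eigenspace (K ^^ k) (ν l) (vec l)
      ν-eigen l = ^^-eigen {A = K} K-eigen k
        where
        K-eigen : Eigenspace K (c ⁻¹ * val l) (vec l)
        K-eigen i = trans (scaleᴹ-· (c ⁻¹) H (vec l) i) (trans (*-congˡ (eigen l i)) (sym (*-assoc _ _ _)))

      μ≈c^kN : ∀ l → Active l → μ l ≈ c ^ k * fromℤ (N l)
      μ≈c^kN l Jl = trans (^-congˡ k (val≈cm l Jl)) (trans (^-distrib-* c (fromℤ (m l)) k) (*-congˡ (sym (fromℤ-^ (m l) k))))

      ν≈N : ∀ l → Active l → ν l ≈ fromℤ (N l)
      ν≈N l Jl = trans (^-congˡ k (begin
          c ⁻¹ * val l               ≈⟨ *-congˡ (val≈cm l Jl) ⟩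
          c ⁻¹ * (c * fromℤ (m l))   ≈⟨ solve 3 (λ i c m → i :* (c :* m) := (c :* i) :* m) (c ⁻¹) c (fromℤ (m l)) ⟩
          c * c ⁻¹ * fromℤ (m l)     ≈⟨ trans (*-congʳ (x*x⁻¹≈1 0<c)) (*-identityˡ _) ⟩
          fromℤ (m l)                ∎)) (sym (fromℤ-^ (m l) k))
        where open ≈-Reasoning

      K-sym : Symmetric K
      K-sym i j = *-congˡ (H-sym i j)

    open Support {K ^^ k} (^^-selfAdjoint (symmetric⇒selfAdjoint K-sym) k) ν ν-eigen a
    open DifferenceGCD {J = Active} (λ _ → em) N

    private
      S⇒index : ∀ {η} → S η → ∃ λ l → Active l × η ≈ fromℤ (N l)
      S⇒index Sη = go (supp⇒index Sη)
        where
        go : ∀ {η} → (∃ λ l → Active l × η ≈ ν l) → ∃ λ l → Active l × η ≈ fromℤ (N l)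
        go (l , Jl , η≈ν) = l , Jl , trans η≈ν (ν≈N l Jl)

      index⇒S : ∀ l → Active l → ∃ λ η → S η × η ≈ fromℤ (N l)
      index⇒S l Jl = ν l , index⇒supp l Jl , ν≈N l Jl

    gcd×minimalTransferTime : (∃ λ τ → TransferTime (H ^^ k) a b τ) → ∀ η₀ → S η₀ →
             ∃ λ δ → IsGCD (Differences S η₀) δ
                   × (∀ η₁ → S η₁ → IsGCD (Differences S η₁) δ)
                   × δ ≢ 0
                   × ∃ λ π → IsPi π × IsLeast (TransferTime (H ^^ k) a b) (π / ((c ^ k) * fromℕ δ))
    gcd×minimalTransferTime (τ , τ-transfer) η₀ Sη₀ = δ l₀ , gcd-everywhere η₀ Sη₀ , gcd-everywhere
      , minimalTransferTime family μ μ-eigen a≢b (0<x^k 0<c k) N μ≈c^kN l₀ (proj₁ (proj₂ (S⇒index Sη₀))) τ-transfer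
      where
      l₀ = proj₁ (S⇒index Sη₀)
      gcd-everywhere : ∀ η₁ → S η₁ → IsGCD (Differences S η₁) (δ l₀)
      gcd-everywhere η₁ Sη₁ = isGCD S⇒index index⇒S l₀
        (proj₁ (proj₂ (S⇒index Sη₀))) (proj₁ (proj₂ (S⇒index Sη₁))) (proj₂ (proj₂ (S⇒index Sη₁)))

open import Algebra.Definitions.RawSemiring using (_^_)

corollary1p2 :
    ExcludedMiddle 0ℓ →
    (ℛ : CompleteOrderedField) →
    let open CompleteOrderedField ℛ renaming (Carrier to ℝ)
        open Matrices rawRing
        open RealAnalysis ℛ
        _^ℝ_ = _^_ (RawRing.rawSemiring rawRing)
    in
    (n : ℕ) (H : Matrix n) → Symmetric H →
    (a b : Fin n) → a ≢ b →
    (c : ℝ) → 0# < c →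
    (∀ μ → supp H (e a) μ ⊎ supp H (e b) μ → ∃ λ m → μ ≈ c * fromℤ m) →
    (k : ℕ) → 𝒦 H a b k →
    let K = scaleᴹ (c ⁻¹) H
        S = supp (K ^^ k) (e a)
    in
    (η₀ : ℝ) → S η₀ →
    ∃ λ δ → IsGCD (Differences S η₀) δ
          × (∀ η₁ → S η₁ → IsGCD (Differences S η₁) δ)
          × δ ≢ 0
          × ∃ λ π → IsPi π
                  × IsLeast (TransferTime (H ^^ k) a b) (π / ((c ^ℝ k) * fromℕ δ))
corollary1p2 em ℛ n H H-sym a b a≢b c 0<c integral k (_ , transfer) η₀ Sη₀ =
  Corollary.gcd×minimalTransferTime em ℛ H-sym a≢b 0<c (λ μ → integral μ ∘ inj₁) k transfer η₀ Sη₀
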